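{- For all integers $n,k\ge 1$, $$N_{n+k-1}(x)=\frac{1}{n!\,k!}\sum_{\pi\in\mathfrak{S}_n,\ \sigma\in\mathfrak{S}_k}B_\pi(x)\,B_\sigma(x)\,E_{\ell_\pi,\ell_\sigma}(x).$$
   Context: $\mathfrak{S}_n$ is the symmetric group on $\{1,\ldots,n\}$; permutations are written in one-line notation $w=w_1\cdots w_n$, and $\operatorname{des}(w)=|\{i:w_i>w_{i+1}\}|$. The Narayana polynomial is $N_n(x)=\sum_{k=0}^{n-1}\frac1n\binom nk\binom n{k+1}x^k$. For $m,n\ge1$, $E_{m,n}(x)=\sum x^{\operatorname{des}(w)}$, where the sum is over all $w\in\mathfrak{S}_{m+n}$ with $w_1\le m$ and $w_{m+n}\ge m+1$. The type B Narayana polynomial is $B_n(x)=\sum_{k=0}^{n-1}\binom{n-1}{k}^2x^k$. For a permutation $w$ with cycle type $(\lambda_1,\ldots,\lambda_\ell)$ (fixed points counted as cycles), $\ell_w=\ell$ is the number of cycles of $w$ and $B_w(x)=B_{\lambda_1}(x)\cdots B_{\lambda_\ell}(x)$. -}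

module Defs where

open import Data.Fin.Base as Fin using (Fin; zero; toℕ; punchIn)
open import Data.Fin.Properties as Finₚ using (punchIn-injective)
open import Data.Fin.Permutation as Perm
  using (Permutation′; _⟨$⟩ʳ_; insert; remove; insert-remove)
open import Data.Integer.Base using (+_)
open import Data.List.Base
  using (List; []; _∷_; _++_; map; foldr; filter; length; zip; drop; head; last;
         replicate; applyUpTo; iterate; deduplicate; tabulate; allFin;
         cartesianProductWith)
open import Data.List.Membership.Propositional.Properties using (∈-allFin)
open import Data.List.Relation.Unary.All as All using ([]; _∷_)
open import Data.List.Relation.Unary.AllPairs using ([]; _∷_)
open import Data.List.Relation.Unary.Any as Any using (Any; here)
import Data.List.Relation.Unary.Any.Properties as Anyₚ
open import Data.List.Relation.Unary.Unique.Propositional.Properties using (allFin⁺)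
import Data.List.Relation.Unary.Unique.Setoid as UniqueS
import Data.List.Relation.Unary.Unique.Setoid.Properties as UniqueSₚ
import Data.Maybe.Relation.Unary.Any as Maybe
open import Data.Nat.Base using (ℕ; zero; suc; _+_; _*_; _∸_; _^_; _≤_; _<_; _!)
open import Data.Nat.Combinatorics using (_C_)
open import Data.Nat.Properties using (_≤?_; _<?_; _!*_!≢0)
open import Data.Product.Base using (_×_; _,_)
open import Data.Rational.Base as ℚ using (ℚ; 0ℚ; 1ℚ)
open import Function.Base using (_∘_)
open import Level using (0ℓ)
open import Relation.Binary.Bundles using (Setoid)
open import Relation.Binary.PropositionalEquality
  using (_≡_; refl; sym; trans; cong; setoid)
open import Relation.Unary using (Decidable)
open import Relation.Nullary.Decidable using (_×-dec_)

------------------------------------------------------------------------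
-- Polynomials in one variable over ℚ

-- a₀ ∷ a₁ ∷ a₂ ∷ … stands for a₀ + a₁ x + a₂ x² + ⋯; trailing zeros are
-- allowed, so polynomials are compared with _≈_ and not with _≡_.
Poly : Set
Poly = List ℚ

coeff : Poly → ℕ → ℚ
coeff []      _       = 0ℚ
coeff (a ∷ _) zero    = a
coeff (_ ∷ p) (suc i) = coeff p i

infix  4 _≈_
infixl 6 _⊕_
infixl 7 _⊗_
infixr 7 _·_

_≈_ : Poly → Poly → Set
p ≈ q = ∀ i → coeff p i ≡ coeff q i

_⊕_ : Poly → Poly → Poly
[]      ⊕ q       = q
(a ∷ p) ⊕ []      = a ∷ p
(a ∷ p) ⊕ (b ∷ q) = (a ℚ.+ b) ∷ (p ⊕ q)

_·_ : ℚ → Poly → Poly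
c · p = map (c ℚ.*_) p

_⊗_ : Poly → Poly → Poly
[]      ⊗ q = []
(a ∷ p) ⊗ q = (a · q) ⊕ (0ℚ ∷ (p ⊗ q))

X^_ : ℕ → Poly
X^ k = replicate k 0ℚ ++ (1ℚ ∷ [])

∑ : ∀ {A : Set} → List A → (A → Poly) → Poly
∑ xs f = foldr _⊕_ [] (map f xs)

∏ : ∀ {A : Set} → List A → (A → Poly) → Poly
∏ xs f = foldr _⊗_ (1ℚ ∷ []) (map f xs)

infix 3 ∑ ∏
syntax ∑ xs (λ x → p) = ∑[ x ∈ xs ] p
syntax ∏ xs (λ x → p) = ∏[ x ∈ xs ] p

ℕ→ℚ : ℕ → ℚ
ℕ→ℚ m = + m ℚ./ 1

------------------------------------------------------------------------
-- Narayana polynomials of types A and B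

-- applyUpTo c n is the coefficient list of ∑_{k<n} c(k) xᵏ.
-- The sum for n = 0 is empty.
N : ℕ → Poly
N zero      = []
N n@(suc _) =
  applyUpTo (λ k → (+ 1 ℚ./ n) ℚ.* ℕ→ℚ (n C k) ℚ.* ℕ→ℚ (n C suc k)) n

B : ℕ → Poly
B n = applyUpTo (λ k → ℕ→ℚ (((n ∸ 1) C k) ^ 2)) n

------------------------------------------------------------------------
-- The symmetric group, acting on Fin n = {0,…,n-1} instead of {1,…,n}

-- Enumeration by the value at 0; each permutation is listed exactly once
-- up to pointwise equality (𝔖-complete and 𝔖-unique below).
𝔖 : ∀ n → List (Permutation′ n)
𝔖 zero    = Perm.id ∷ []
𝔖 (suc n) = cartesianProductWith (insert zero) (allFin (suc n)) (𝔖 n)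

permSetoid : ℕ → Setoid 0ℓ 0ℓ
permSetoid n = record
  { Carrier       = Permutation′ n
  ; _≈_           = Perm._≈_
  ; isEquivalence = record
    { refl  = λ _ → refl
    ; sym   = λ p i → sym (p i)
    ; trans = λ p q i → trans (p i) (q i)
    }
  }

private
  insert-cong : ∀ {n} j {π ρ : Permutation′ n} → π Perm.≈ ρ →
                insert zero j π Perm.≈ insert zero j ρ
  insert-cong j p zero        = refl
  insert-cong j p (Fin.suc i) = cong (punchIn j) (p i)

  insert-injective : ∀ {n} {j k} {π ρ : Permutation′ n} →
                     insert zero j π Perm.≈ insert zero k ρ →
                     j ≡ k × π Perm.≈ ρ
  insert-injective {j = j} p with refl ← p zero =
    refl , λ i → punchIn-injective j _ _ (p (Fin.suc i))

𝔖-complete : ∀ {n} (π : Permutation′ n) → Any (π Perm.≈_) (𝔖 n)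
𝔖-complete {zero}  π = here λ ()
𝔖-complete {suc n} π =
  Anyₚ.cartesianProductWith⁺ (insert zero)
    (λ { {ρ} refl q i → trans (sym (insert-remove zero π i)) (insert-cong _ q i) })
    (∈-allFin (π ⟨$⟩ʳ zero)) (𝔖-complete (remove zero π))

𝔖-unique : ∀ n → UniqueS.Unique (permSetoid n) (𝔖 n)
𝔖-unique zero    = [] ∷ []
𝔖-unique (suc n) =
  UniqueSₚ.cartesianProductWith⁺ (setoid _) (permSetoid n) (permSetoid (suc n))
    (insert zero)
    (λ {_} {_} {π} {ρ} → insert-injective {π = π} {ρ = ρ})
    (allFin⁺ (suc n)) (𝔖-unique n)

oneLine : ∀ {n} → Permutation′ n → List (Fin n)
oneLine π = tabulate (π ⟨$⟩ʳ_)

des : ∀ {n} → Permutation′ n → ℕ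
des π = length (filter (λ (a , b) → b Finₚ.<? a) (zip (oneLine π) (drop 1 (oneLine π))))

------------------------------------------------------------------------
-- Cycles

-- A cycle has at most n elements, so i, π i, …, πⁿ⁻¹ i exhaust the cycle of i.
cycleOf : ∀ {n} → Permutation′ n → Fin n → List (Fin n)
cycleOf {n} π i = deduplicate Finₚ._≟_ (iterate (π ⟨$⟩ʳ_) i n)

-- Each cycle is represented by its least element.
cycleReps : ∀ {n} → Permutation′ n → List (Fin n)
cycleReps {n} π = filter (λ i → All.all? (i Finₚ.≤?_) (cycleOf π i)) (allFin n)

cycleType : ∀ {n} → Permutation′ n → List ℕ
cycleType π = map (length ∘ cycleOf π) (cycleReps π)

ℓ : ∀ {n} → Permutation′ n → ℕ
ℓ π = length (cycleType π)

Bₚ : ∀ {n} → Permutation′ n → Poly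
Bₚ π = ∏[ c ∈ cycleType π ] B c

------------------------------------------------------------------------
-- The polynomials E

-- With values shifted down by one, w₁ ≤ m reads w₁ < m and
-- w_{m+n} ≥ m+1 reads w_{m+n} ≥ m.  E 0 0 is zero by convention.
module _ (m n : ℕ) where

  Admissible : Permutation′ (m + n) → Set
  Admissible w = Maybe.Any (λ a → toℕ a < m) (head (oneLine w))
               × Maybe.Any (λ a → m ≤ toℕ a) (last (oneLine w))

  admissible? : Decidable Admissible
  admissible? w = Maybe.dec (λ a → toℕ a <? m) (head (oneLine w))
            ×-dec Maybe.dec (λ a → m ≤? toℕ a) (last (oneLine w))

  E : Poly
  E = ∑[ w ∈ filter admissible? (𝔖 (m + n)) ] X^ des w

1/[_!*_!] : ℕ → ℕ → ℚ
1/[ n !* k !] = (+ 1 ℚ./ (n ! * k !)) {{n !* k !≢0}}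

{-# OPTIONS --safe #-}
module Submission where

-- A permutation counted by E m n alternates between maximal runs of small and of large
-- letters, and every step from a large to a small letter is a descent.  If A r m enumerates
-- the ways to split m letters into a row of r blocks, by descents inside the blocks, then
--   E m n = ∑_r xʳ A (r+1) m A (r+1) n,
-- and inserting a new smallest letter shows
--   A r (m+1) = r (A (r−1) m + (1+x) A r m + x A (r+1) m).
-- Let ν r n be the weight of the walks from 0 to r in n steps that stay positive after the
-- start, with steps up, level and down of weight 1, 1+x and x.  B (k+1) is the weight of the
-- unrestricted closed walks with k steps.  Building permutations cycle by cycle and
-- splitting walks at their last visit to 0 gives ∑_π B_π A r ℓ(π) = n! ν r n over 𝔖 n, so the
-- right-hand side of the theorem is ∑_r xʳ ν (r+1) n ν (r+1) k.  The transfer matrix of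
-- positive walks is self-adjoint for the weight xʳ at height r+1; hence this sum depends only
-- on n + k and equals ν 1 (n+k−1), which is the Narayana polynomial.

open import Algebra.Bundles using (CommutativeSemiring)
open import Data.Bool.Base using (Bool; true; false; if_then_else_; _∧_)
open import Data.Fin.Base as Fin using (Fin; toℕ; punchIn)
import Data.Fin.Properties as Finₚ
open import Data.Fin.Permutation as Perm using (Permutation′; insert; _⟨$⟩ʳ_)
open import Data.List.Base as List
  using (List; []; _∷_; _++_; foldr; map; length; filter; zip; drop; head; last;
         tabulate; allFin; cartesianProductWith)
open import Data.List.Properties using (map-tabulate)
open import Data.List.Relation.Binary.Permutation.Propositional as ↭ using (_↭_; ↭-refl)
open import Data.List.Relation.Binary.Permutation.Propositional.Properties using (↭-length)
open import Data.List.Relation.Unary.All as All using (All; []; _∷_)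
import Data.Maybe.Relation.Unary.Any as Maybe
open import Data.Nat.Base as ℕ
  using (ℕ; zero; suc; z≤n; s≤s; _<ᵇ_; _≤ᵇ_; _∸_; _!; pred; _<_; _≤_)
open import Data.Nat.Induction using (<-rec)
import Data.Nat.Properties as ℕₚ
open import Data.Product.Base using (_,_)
open import Defs using (𝔖; oneLine; des; admissible?)
open import Function.Base using (_∘_; id)
open import Level using (0ℓ)
open import Relation.Binary.PropositionalEquality as ≡ using (_≡_)
open import Relation.Nullary using (does; yes; no; Dec; ¬_; contradiction)
open import Relation.Nullary.Decidable using (dec-true; dec-false)
open import Relation.Unary using (Decidable)

-- Finite sums in a commutative semiring

-- The recursion for `A` brings in a factor `r`, while the sum over permutations has to produce
-- `n !`. The two are reconciled by the cycle lemma `n * ν r n = r * κ r n`, where `κ` is the weight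
-- of unrestricted walks: taking off the cycle of one of `n + 1` elements leaves
-- `n ! * r * κ r (n + 1)`, and this is `(n + 1) ! * ν r (n + 1)`. Two enumerations of the symmetric
-- group are in play. The given one, by the value at 0, suits descents but scrambles cycles; a
-- second one inserts a new element into the cycles of a smaller permutation. Sums are carried from
-- one to the other. The walks and words live over an arbitrary commutative semiring. Hence
-- factorials are multiplied out instead of divided by, differences are moved to the other side, and
-- sums over the number of runs or the height are cut off at a common bound `M`, beyond which all
-- terms vanish.

module Sums (R : CommutativeSemiring 0ℓ 0ℓ) where

  open CommutativeSemiring R hiding (zero)
  open import Algebra.Properties.Semiring.Mult semiring using (_×_; ×-homo-+; ×1-homo-*)
  open import Algebra.Solver.Ring.NaturalCoefficients.Default R
    using (solve; _:=_; _:+_; _:*_)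
  open import Relation.Binary.Reasoning.Setoid setoid

  infix 9 ⌜_⌝
  ⌜_⌝ : ℕ → Carrier
  ⌜ n ⌝ = n × 1#

  ⌜⌝-+ : ∀ m n → ⌜ m ℕ.+ n ⌝ ≈ ⌜ m ⌝ + ⌜ n ⌝
  ⌜⌝-+ = ×-homo-+ 1#

  ⌜⌝-* : ∀ m n → ⌜ m ℕ.* n ⌝ ≈ ⌜ m ⌝ * ⌜ n ⌝
  ⌜⌝-* = ×1-homo-*

  interchange : ∀ a b c d → (a + b) + (c + d) ≈ (a + c) + (b + d)
  interchange = solve 4 (λ a b c d → (a :+ b) :+ (c :+ d) := (a :+ c) :+ (b :+ d)) refl

  x*yz≈y*xz : ∀ a b c → a * (b * c) ≈ b * (a * c)
  x*yz≈y*xz = solve 3 (λ a b c → a :* (b :* c) := b :* (a :* c)) refl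

  Σ< : ℕ → (ℕ → Carrier) → Carrier
  Σ< zero    f = 0#
  Σ< (suc n) f = f 0 + Σ< n (f ∘ suc)

  Σ<-cong : ∀ n {f g} → (∀ i → f i ≈ g i) → Σ< n f ≈ Σ< n g
  Σ<-cong zero    p = refl
  Σ<-cong (suc n) p = +-cong (p 0) (Σ<-cong n (p ∘ suc))

  Σ<-0 : ∀ n → Σ< n (λ _ → 0#) ≈ 0#
  Σ<-0 zero    = refl
  Σ<-0 (suc n) = trans (+-identityˡ _) (Σ<-0 n)

  Σ<-+ : ∀ n f g → Σ< n (λ i → f i + g i) ≈ Σ< n f + Σ< n g
  Σ<-+ zero    f g = sym (+-identityˡ 0#)
  Σ<-+ (suc n) f g = trans (+-congˡ (Σ<-+ n (f ∘ suc) (g ∘ suc))) (interchange _ _ _ _)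

  Σ<-*ˡ : ∀ n c f → Σ< n (λ i → c * f i) ≈ c * Σ< n f
  Σ<-*ˡ zero    c f = sym (zeroʳ c)
  Σ<-*ˡ (suc n) c f = trans (+-congˡ (Σ<-*ˡ n c (f ∘ suc))) (sym (distribˡ c _ _))

  Σ<-split : ∀ m n f → Σ< (m ℕ.+ n) f ≈ Σ< m f + Σ< n (λ i → f (m ℕ.+ i))
  Σ<-split zero    n f = sym (+-identityˡ _)
  Σ<-split (suc m) n f = trans (+-congˡ (Σ<-split m n (f ∘ suc))) (sym (+-assoc _ _ _))

  Σ<-last : ∀ n f → Σ< (suc n) f ≈ Σ< n f + f n
  Σ<-last zero    f = +-comm _ _
  Σ<-last (suc n) f = trans (+-congˡ (Σ<-last n (f ∘ suc))) (sym (+-assoc _ _ _))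

  -- With both end terms zero, the index moves by one while the length of the sum stays the same, so
  -- a single cut-off `M` serves throughout.
  Σ<-shift : ∀ n f → f 0 ≈ 0# → f n ≈ 0# → Σ< n f ≈ Σ< n (f ∘ suc)
  Σ<-shift n f f0≈0 fn≈0 = begin
    Σ< n f                  ≈⟨ +-identityʳ _ ⟨
    Σ< n f + 0#             ≈⟨ +-congˡ fn≈0 ⟨
    Σ< n f + f n            ≈⟨ Σ<-last n f ⟨
    f 0 + Σ< n (f ∘ suc)    ≈⟨ +-congʳ f0≈0 ⟩
    0# + Σ< n (f ∘ suc)     ≈⟨ +-identityˡ _ ⟩
    Σ< n (f ∘ suc)          ∎

  module _ {A : Set} where

    ΣL : List A → (A → Carrier) → Carrier
    ΣL xs f = foldr _+_ 0# (map f xs)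

    ΣL-cong : ∀ xs {f g} → (∀ a → f a ≈ g a) → ΣL xs f ≈ ΣL xs g
    ΣL-cong []       p = refl
    ΣL-cong (a ∷ xs) p = +-cong (p a) (ΣL-cong xs p)

    ΣL-0 : ∀ xs → ΣL xs (λ _ → 0#) ≈ 0#
    ΣL-0 []       = refl
    ΣL-0 (_ ∷ xs) = trans (+-identityˡ _) (ΣL-0 xs)

    ΣL-+ : ∀ xs f g → ΣL xs (λ a → f a + g a) ≈ ΣL xs f + ΣL xs g
    ΣL-+ []       f g = sym (+-identityˡ 0#)
    ΣL-+ (a ∷ xs) f g = trans (+-congˡ (ΣL-+ xs f g)) (interchange _ _ _ _)

    ΣL-*ˡ : ∀ xs c f → ΣL xs (λ a → c * f a) ≈ c * ΣL xs f
    ΣL-*ˡ []       c f = sym (zeroʳ c)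
    ΣL-*ˡ (a ∷ xs) c f = trans (+-congˡ (ΣL-*ˡ xs c f)) (sym (distribˡ c _ _))

    ΣL-*ʳ : ∀ xs c f → ΣL xs (λ a → f a * c) ≈ ΣL xs f * c
    ΣL-*ʳ xs c f = trans (ΣL-cong xs (λ i → *-comm _ _)) (trans (ΣL-*ˡ xs c f) (*-comm _ _))

    ΣL-Σ< : ∀ xs n (f : A → ℕ → Carrier) →
            ΣL xs (λ a → Σ< n (f a)) ≈ Σ< n (λ i → ΣL xs (λ a → f a i))
    ΣL-Σ< []       n f = sym (Σ<-0 n)
    ΣL-Σ< (a ∷ xs) n f = trans (+-congˡ (ΣL-Σ< xs n f)) (sym (Σ<-+ n _ _))

  -- A convolution sum over `k + j = n`, by recursion along the diagonal so that no truncated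
  -- subtraction `n ∸ k` occurs.
  Σ⟨_⟩ : ℕ → (ℕ → ℕ → Carrier) → Carrier
  Σ⟨ zero  ⟩ c = c 0 0
  Σ⟨ suc n ⟩ c = c 0 (suc n) + Σ⟨ n ⟩ (c ∘ suc)

  Σ⟨⟩-cong : ∀ n {c d} → (∀ k j → k ℕ.+ j ≡ n → c k j ≈ d k j) → Σ⟨ n ⟩ c ≈ Σ⟨ n ⟩ d
  Σ⟨⟩-cong zero    p = p 0 0 ≡.refl
  Σ⟨⟩-cong (suc n) p =
    +-cong (p 0 (suc n) ≡.refl) (Σ⟨⟩-cong n (λ k j q → p (suc k) j (≡.cong suc q)))

  Σ⟨⟩-+ : ∀ n c d → Σ⟨ n ⟩ (λ k j → c k j + d k j) ≈ Σ⟨ n ⟩ c + Σ⟨ n ⟩ d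
  Σ⟨⟩-+ zero    c d = refl
  Σ⟨⟩-+ (suc n) c d = trans (+-congˡ (Σ⟨⟩-+ n (c ∘ suc) (d ∘ suc))) (interchange _ _ _ _)

  Σ⟨⟩-*ˡ : ∀ n a c → Σ⟨ n ⟩ (λ k j → a * c k j) ≈ a * Σ⟨ n ⟩ c
  Σ⟨⟩-*ˡ zero    a c = refl
  Σ⟨⟩-*ˡ (suc n) a c = trans (+-congˡ (Σ⟨⟩-*ˡ n a (c ∘ suc))) (sym (distribˡ a _ _))

  Σ⟨⟩-last : ∀ n c → Σ⟨ suc n ⟩ c ≈ Σ⟨ n ⟩ (λ k j → c k (suc j)) + c (suc n) 0
  Σ⟨⟩-last zero    c = refl
  Σ⟨⟩-last (suc n) c = trans (+-congˡ (Σ⟨⟩-last n (c ∘ suc))) (sym (+-assoc _ _ _))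

  Σ⟨⟩-weighted : ∀ n c → Σ⟨ n ⟩ (λ k j → ⌜ k ℕ.+ j ⌝ * c k j) ≈ ⌜ n ⌝ * Σ⟨ n ⟩ c
  Σ⟨⟩-weighted n c =
    trans (Σ⟨⟩-cong n (λ k j k+j≡n → *-congʳ (reflexive (≡.cong ⌜_⌝ k+j≡n)))) (Σ⟨⟩-*ˡ n _ c)

  -- The two kinds of steps to level n + 1 add up to the weight k + j there.
  Σ⟨⟩-steps : ∀ n c →
    Σ⟨ n ⟩ (λ k j → ⌜ suc k ⌝ * c (suc k) j) + Σ⟨ n ⟩ (λ k j → ⌜ suc j ⌝ * c k (suc j))
    ≈ ⌜ suc n ⌝ * Σ⟨ suc n ⟩ c
  Σ⟨⟩-steps n c = begin
    Σ⟨ n ⟩ (λ k j → ⌜ suc k ⌝ * c (suc k) j) + Σ⟨ n ⟩ (λ k j → ⌜ suc j ⌝ * c k (suc j))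
      ≈⟨ +-cong (+-identityˡ _) (+-identityʳ _) ⟨
    (0# + Σ⟨ n ⟩ (λ k j → ⌜ suc k ⌝ * c (suc k) j))
      + (Σ⟨ n ⟩ (λ k j → ⌜ suc j ⌝ * c k (suc j)) + 0#)
      ≈⟨ +-cong (+-congʳ (zeroˡ _)) (+-congˡ (zeroˡ _)) ⟨
    Σ⟨ suc n ⟩ (λ k j → ⌜ k ⌝ * c k j)
      + (Σ⟨ n ⟩ (λ k j → ⌜ suc j ⌝ * c k (suc j)) + ⌜ 0 ⌝ * c (suc n) 0)
      ≈⟨ +-congˡ (Σ⟨⟩-last n (λ k j → ⌜ j ⌝ * c k j)) ⟨
    Σ⟨ suc n ⟩ (λ k j → ⌜ k ⌝ * c k j) + Σ⟨ suc n ⟩ (λ k j → ⌜ j ⌝ * c k j)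
      ≈⟨ Σ⟨⟩-+ (suc n) (λ k j → ⌜ k ⌝ * c k j) (λ k j → ⌜ j ⌝ * c k j) ⟨
    Σ⟨ suc n ⟩ (λ k j → ⌜ k ⌝ * c k j + ⌜ j ⌝ * c k j)
      ≈⟨ Σ⟨⟩-cong (suc n) (λ k j _ → trans (*-congʳ (⌜⌝-+ k j)) (distribʳ (c k j) _ _)) ⟨
    Σ⟨ suc n ⟩ (λ k j → ⌜ k ℕ.+ j ⌝ * c k j)
      ≈⟨ Σ⟨⟩-weighted (suc n) c ⟩
    ⌜ suc n ⌝ * Σ⟨ suc n ⟩ c ∎

  -- ∑_{k+j=n} (n choose k) h k j, by the recursion of Pascal's triangle.
  binomial : ℕ → (ℕ → ℕ → Carrier) → Carrier
  binomial zero    h = h 0 0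
  binomial (suc n) h = binomial n (h ∘ suc) + binomial n (λ k j → h k (suc j))

  binomial-cong : ∀ n {c d} → (∀ k j → k ℕ.+ j ≡ n → c k j ≈ d k j) →
                  binomial n c ≈ binomial n d
  binomial-cong zero    p = p 0 0 ≡.refl
  binomial-cong (suc n) p = +-cong
    (binomial-cong n (λ k j q → p (suc k) j (≡.cong suc q)))
    (binomial-cong n (λ k j q → p k (suc j) (≡.trans (ℕₚ.+-suc k j) (≡.cong suc q))))

  binomial-+ : ∀ n c d → binomial n (λ k j → c k j + d k j) ≈ binomial n c + binomial n d
  binomial-+ zero    c d = refl
  binomial-+ (suc n) c d =
    trans (+-cong (binomial-+ n _ _) (binomial-+ n _ _)) (interchange _ _ _ _)

  -- The factorial formula for binomial coefficients without division. Each half of Pascal's rule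
  -- splits off a factor `suc k` or `suc j`, and these add up to `suc n`.
  binomial-! : ∀ n c → binomial n (λ k j → ⌜ k ! ⌝ * ⌜ j ! ⌝ * c k j) ≈ ⌜ n ! ⌝ * Σ⟨ n ⟩ c
  binomial-! zero    c =
    *-congʳ (trans (*-congˡ (+-identityʳ 1#)) (*-identityʳ _))
  binomial-! (suc n) c = begin
    binomial n (λ k j → ⌜ suc k ! ⌝ * ⌜ j ! ⌝ * c (suc k) j)
      + binomial n (λ k j → ⌜ k ! ⌝ * ⌜ suc j ! ⌝ * c k (suc j))
      ≈⟨ +-cong (binomial-cong n (λ k j _ → left k j)) (binomial-cong n (λ k j _ → right k j)) ⟩
    binomial n (λ k j → ⌜ k ! ⌝ * ⌜ j ! ⌝ * (⌜ suc k ⌝ * c (suc k) j))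
      + binomial n (λ k j → ⌜ k ! ⌝ * ⌜ j ! ⌝ * (⌜ suc j ⌝ * c k (suc j)))
      ≈⟨ +-cong (binomial-! n _) (binomial-! n _) ⟩
    ⌜ n ! ⌝ * Σ⟨ n ⟩ (λ k j → ⌜ suc k ⌝ * c (suc k) j)
      + ⌜ n ! ⌝ * Σ⟨ n ⟩ (λ k j → ⌜ suc j ⌝ * c k (suc j))
      ≈⟨ distribˡ _ _ _ ⟨
    ⌜ n ! ⌝ * (Σ⟨ n ⟩ (λ k j → ⌜ suc k ⌝ * c (suc k) j)
      + Σ⟨ n ⟩ (λ k j → ⌜ suc j ⌝ * c k (suc j)))
      ≈⟨ *-congˡ (Σ⟨⟩-steps n c) ⟩
    ⌜ n ! ⌝ * (⌜ suc n ⌝ * Σ⟨ suc n ⟩ c)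
      ≈⟨ x*yz≈y*xz _ _ _ ⟩
    ⌜ suc n ⌝ * (⌜ n ! ⌝ * Σ⟨ suc n ⟩ c)
      ≈⟨ *-assoc _ _ _ ⟨
    ⌜ suc n ⌝ * ⌜ n ! ⌝ * Σ⟨ suc n ⟩ c
      ≈⟨ *-congʳ (⌜⌝-* (suc n) (n !)) ⟨
    ⌜ suc n ! ⌝ * Σ⟨ suc n ⟩ c ∎
    where
    left : ∀ k j → ⌜ suc k ! ⌝ * ⌜ j ! ⌝ * c (suc k) j
                 ≈ ⌜ k ! ⌝ * ⌜ j ! ⌝ * (⌜ suc k ⌝ * c (suc k) j)
    left k j = trans (*-congʳ (*-congʳ (⌜⌝-* (suc k) (k !))))
      (solve 4 (λ s a b d → s :* a :* b :* d := a :* b :* (s :* d)) refl _ _ _ _)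
    right : ∀ k j → ⌜ k ! ⌝ * ⌜ suc j ! ⌝ * c k (suc j)
                  ≈ ⌜ k ! ⌝ * ⌜ j ! ⌝ * (⌜ suc j ⌝ * c k (suc j))
    right k j = trans (*-congʳ (*-congˡ (⌜⌝-* (suc j) (j !))))
      (solve 4 (λ s a b d → a :* (s :* b) :* d := a :* b :* (s :* d)) refl _ _ _ _)

  when : Bool → Carrier → Carrier
  when b c = if b then c else 0#

  when-cong : ∀ {b b′ c c′} → b ≡ b′ → c ≈ c′ → when b c ≈ when b′ c′
  when-cong {true}  ≡.refl e = e
  when-cong {false} ≡.refl e = refl

  when-*ˡ : ∀ b c d → when b (c * d) ≈ c * when b d
  when-*ˡ true  c d = refl
  when-*ˡ false c d = sym (zeroʳ c)

  ΣL-filter : ∀ {A : Set} {P : A → Set} (P? : Decidable P) as f →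
              ΣL (filter P? as) f ≈ ΣL as (λ a → when (does (P? a)) (f a))
  ΣL-filter P? []       f = refl
  ΣL-filter P? (a ∷ as) f with does (P? a)
  ... | true  = +-congˡ (ΣL-filter P? as f)
  ... | false = trans (ΣL-filter P? as f) (sym (+-identityˡ _))

  ΣL-++ : ∀ {A : Set} (as bs : List A) f → ΣL (as ++ bs) f ≈ ΣL as f + ΣL bs f
  ΣL-++ []       bs f = sym (+-identityˡ _)
  ΣL-++ (a ∷ as) bs f = trans (+-congˡ (ΣL-++ as bs f)) (sym (+-assoc _ _ _))

  ΣL-map : ∀ {A B : Set} (h : A → B) as f → ΣL (map h as) f ≈ ΣL as (f ∘ h)
  ΣL-map h []       f = refl
  ΣL-map h (a ∷ as) f = +-congˡ (ΣL-map h as f)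

  ΣL-cartesianProductWith : ∀ {A B C : Set} (h : A → B → C) as bs f →
    ΣL (cartesianProductWith h as bs) f ≈ ΣL as (λ a → ΣL bs (λ b → f (h a b)))
  ΣL-cartesianProductWith h []       bs f = refl
  ΣL-cartesianProductWith h (a ∷ as) bs f = trans (ΣL-++ (map (h a) bs) _ f)
    (+-cong (ΣL-map (h a) bs f) (ΣL-cartesianProductWith h as bs f))

  ΣL-tabulate : ∀ {A : Set} {n} (h : Fin n → A) f g → (∀ i → f (h i) ≈ g (toℕ i)) →
                ΣL (tabulate h) f ≈ Σ< n g
  ΣL-tabulate {n = zero}  h f g p = refl
  ΣL-tabulate {n = suc n} h f g p =
    +-cong (p Fin.zero) (ΣL-tabulate (h ∘ Fin.suc) f (g ∘ suc) (p ∘ Fin.suc))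

  -- Meant for a sum over letters: `m` small ones, then `n` large ones renumbered from 0.
  Σ<-if : ∀ m n f g → Σ< (m ℕ.+ n) (λ i → if i <ᵇ m then f i else g (i ∸ m)) ≈ Σ< m f + Σ< n g
  Σ<-if zero    n f g = sym (+-identityˡ _)
  Σ<-if (suc m) n f g = trans (+-congˡ (Σ<-if m n (f ∘ suc) g)) (sym (+-assoc _ _ _))

  ΣL-cong-local : ∀ {A : Set} {as : List A} {f g} → All (λ a → f a ≈ g a) as → ΣL as f ≈ ΣL as g
  ΣL-cong-local []       = refl
  ΣL-cong-local (p ∷ ps) = +-cong p (ΣL-cong-local ps)

  ΣL-ΣL : ∀ {A B : Set} (as : List A) (bs : List B) (f : A → B → Carrier) →
          ΣL as (λ a → ΣL bs (f a)) ≈ ΣL bs (λ b → ΣL as (λ a → f a b))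
  ΣL-ΣL []       bs f = sym (ΣL-0 bs)
  ΣL-ΣL (a ∷ as) bs f = trans (+-congˡ (ΣL-ΣL as bs f)) (sym (ΣL-+ bs _ _))

  ΣL-when-length : ∀ {A : Set} {P : A → Set} (P? : Decidable P) as c →
    ΣL as (λ a → when (does (P? a)) c) ≈ ⌜ length (filter P? as) ⌝ * c
  ΣL-when-length P? []       c = sym (zeroˡ c)
  ΣL-when-length P? (a ∷ as) c with does (P? a)
  ... | true  = trans (+-cong (sym (*-identityˡ c)) (ΣL-when-length P? as c))
                  (sym (distribʳ c _ _))
  ... | false = trans (+-identityˡ _) (ΣL-when-length P? as c)

  -- For fixed `r` the summand is a product of a function of `a` and one of `b`. This separates the
  -- two symmetric groups in the theorem.
  ΣL-ΣL-Σ< : ∀ {A B : Set} (as : List A) (bs : List B) M (p : A → Carrier) (q : B → Carrier)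
              (w : ℕ → Carrier) (f : ℕ → A → Carrier) (g : ℕ → B → Carrier) →
    ΣL as (λ a → ΣL bs (λ b → p a * q b * Σ< M (λ r → w r * (f r a * g r b))))
    ≈ Σ< M (λ r → w r * (ΣL as (λ a → p a * f r a) * ΣL bs (λ b → q b * g r b)))
  ΣL-ΣL-Σ< as bs M p q w f g = begin
    ΣL as (λ a → ΣL bs (λ b → p a * q b * Σ< M (λ r → w r * (f r a * g r b))))
      ≈⟨ ΣL-cong as (λ a → ΣL-cong bs (λ b → trans (sym (Σ<-*ˡ M _ _)) (Σ<-cong M (λ r →
           solve 5 (λ p q w f g → p :* q :* (w :* (f :* g)) := w :* (p :* f) :* (q :* g))
             refl (p a) (q b) (w r) (f r a) (g r b))))) ⟩
    ΣL as (λ a → ΣL bs (λ b → Σ< M (λ r → w r * (p a * f r a) * (q b * g r b))))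
      ≈⟨ ΣL-cong as (λ a → trans (ΣL-Σ< bs M _) (Σ<-cong M (λ r → ΣL-*ˡ bs _ _))) ⟩
    ΣL as (λ a → Σ< M (λ r → w r * (p a * f r a) * ΣL bs (λ b → q b * g r b)))
      ≈⟨ trans (ΣL-Σ< as M _) (Σ<-cong M (λ r → trans (ΣL-*ʳ as _ _)
           (trans (*-congʳ (ΣL-*ˡ as _ _)) (*-assoc _ _ _)))) ⟩
    Σ< M (λ r → w r * (ΣL as (λ a → p a * f r a) * ΣL bs (λ b → q b * g r b))) ∎

-- Words, blocks and runs

module BlockWords (R : CommutativeSemiring 0ℓ 0ℓ) (x : CommutativeSemiring.Carrier R) where

  open CommutativeSemiring R hiding (zero)
  open import Algebra.Properties.Semiring.Exp semiring using (_^_)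
  open import Algebra.Solver.Ring.NaturalCoefficients.Default R
    using (solve; _:=_; _:+_; _:*_; con)
  open import Relation.Binary.Reasoning.Setoid setoid
  open Sums R

  -- The weight of the step from the letter `j` to its successor `i`; note the order of the
  -- arguments.
  wt : ℕ → ℕ → Carrier
  wt i j = if i <ᵇ j then x else 1#

  -- A r m enumerates, by descents inside the blocks, the ways to arrange m letters
  -- in a row of r nonempty blocks; in a r m j the first letter is the j-th smallest.
  a : ℕ → ℕ → ℕ → Carrier
  A : ℕ → ℕ → Carrier
  a zero    m       j = 0#
  a (suc r) zero    j = 0#
  -- Delete the first letter: it was a block of its own, or its successor in the block has rank `i`
  -- among the remaining letters and is smaller exactly when `i < j`.
  a (suc r) (suc m) j = A r m + Σ< m (λ i → wt i j * a (suc r) m i)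
  A zero    zero    = 1#
  A (suc r) zero    = 0#
  A r       (suc m) = Σ< (suc m) (a r (suc m))

  Σ<-combination : ∀ n p q (f g h : ℕ → Carrier) →
    Σ< n (λ i → p * (f i + g i) + q * (x * (g i + h i)))
    ≈ p * (Σ< n f + Σ< n g) + q * (x * (Σ< n g + Σ< n h))
  Σ<-combination n p q f g h =
    trans (Σ<-+ n (λ i → p * (f i + g i)) (λ i → q * (x * (g i + h i))))
      (+-cong (trans (Σ<-*ˡ n p _) (*-congˡ (Σ<-+ n f g)))
        (trans (Σ<-*ˡ n q _) (*-congˡ (trans (Σ<-*ˡ n x _) (*-congˡ (Σ<-+ n g h))))))

  Σ<-a : ∀ r m → Σ< m (a (suc r) m) ≈ A (suc r) m
  Σ<-a r zero    = refl
  Σ<-a r (suc m) = refl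

  Σ<-wt-0 : ∀ r m → Σ< m (λ i → wt i 0 * a (suc r) m i) ≈ A (suc r) m
  Σ<-wt-0 r m = trans (Σ<-cong m (λ _ → *-identityˡ _)) (Σ<-a r m)

  A-0 : ∀ m → A 0 (suc m) ≈ 0#
  A-0 m = Σ<-0 (suc m)

  -- The factor `⌜ r ⌝` extends the recursion to `r = 0`, where the bracket need not vanish and
  -- `pred r` has no meaning as a number of blocks.
  ⌜⌝*a : ∀ r m j →
    ⌜ r ⌝ * a r (suc m) j ≈ ⌜ r ⌝ * (A (pred r) m + Σ< m (λ i → wt i j * a r m i))
  ⌜⌝*a zero    m j = trans (zeroˡ _) (sym (zeroˡ _))
  ⌜⌝*a (suc r) m j = refl

  -- Insert a new smallest letter into a word of blocks: as a block of its own, at the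
  -- front of a block, at its end (a descent), or between two blocks (a descent), which it joins.
  -- In a-insert the new letter must not come first.
  a-insert : ∀ r m j →
    a (suc r) (suc (suc m)) (suc j)
    ≈ ⌜ r ⌝ * (a r (suc m) j + a (suc r) (suc m) j)
      + ⌜ suc r ⌝ * (x * (a (suc r) (suc m) j + a (suc (suc r)) (suc m) j))
  A-insert : ∀ r m →
    A r (suc m) ≈ ⌜ r ⌝ * (A (pred r) m + (1# + x) * A r m + x * A (suc r) m)

  -- The part of `a-insert` in which the second letter is in the first block and is not the new one.
  -- Raising both ranks by one does not change `wt`.
  Σ<-wt-insert : ∀ r m j →
    Σ< m (λ i → wt i j * a (suc r) (suc m) (suc i))
    ≈ ⌜ r ⌝ * (Σ< m (λ i → wt i j * a r m i) + Σ< m (λ i → wt i j * a (suc r) m i))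
      + ⌜ suc r ⌝ * (x * (Σ< m (λ i → wt i j * a (suc r) m i)
                          + Σ< m (λ i → wt i j * a (suc (suc r)) m i)))
  Σ<-wt-insert r zero    j =
    solve 3 (λ p q y → con 0 := p :* (con 0 :+ con 0) :+ q :* (y :* (con 0 :+ con 0)))
      refl ⌜ r ⌝ ⌜ suc r ⌝ x
  Σ<-wt-insert r (suc m) j = begin
    Σ< n (λ i → wt i j * a (suc r) (suc n) (suc i))
      ≈⟨ Σ<-cong n (λ i → trans (*-congˡ (a-insert r m i)) (expand (wt i j) _ _ _)) ⟩
    Σ< n (λ i → ⌜ r ⌝ * (L r i + L (suc r) i)
                + ⌜ suc r ⌝ * (x * (L (suc r) i + L (suc (suc r)) i)))
      ≈⟨ Σ<-combination n _ _ (L r) (L (suc r)) (L (suc (suc r))) ⟩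
    ⌜ r ⌝ * (Σ< n (L r) + Σ< n (L (suc r)))
      + ⌜ suc r ⌝ * (x * (Σ< n (L (suc r)) + Σ< n (L (suc (suc r))))) ∎
    where
    n = suc m
    L : ℕ → ℕ → Carrier
    L s i = wt i j * a s n i
    expand : ∀ w u v t →
      w * (⌜ r ⌝ * (u + v) + ⌜ suc r ⌝ * (x * (v + t)))
      ≈ ⌜ r ⌝ * (w * u + w * v) + ⌜ suc r ⌝ * (x * (w * v + w * t))
    expand w u v t = solve 7 (λ p q y w u v t →
      w :* (p :* (u :+ v) :+ q :* (y :* (v :+ t)))
      := p :* (w :* u :+ w :* v) :+ q :* (y :* (w :* v :+ w :* t)))
      refl ⌜ r ⌝ ⌜ suc r ⌝ x w u v t

  a-insert r m j = begin
    -- The first letter is a block of its own, or is followed in its block by the new smallest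
    -- letter (a descent), or by another letter.
    A r (suc m) + (x * (A r m + Σ< m (λ i → wt i 0 * a (suc r) m i))
                   + Σ< m (λ i → wt i j * a (suc r) (suc m) (suc i)))
      ≈⟨ +-cong (A-insert r m)
           (+-cong (*-congˡ (+-congˡ (Σ<-wt-0 r m))) (Σ<-wt-insert r m j)) ⟩
    ⌜ r ⌝ * (A (pred r) m + (1# + x) * A r m + x * A (suc r) m)
      + (x * (A r m + A (suc r) m)
         + (⌜ r ⌝ * (L r + L (suc r)) + ⌜ suc r ⌝ * (x * (L (suc r) + L (suc (suc r))))))
      ≈⟨ solve 8 (λ p y b₀ b₁ b₂ l₀ l₁ l₂ →
           p :* (b₀ :+ (con 1 :+ y) :* b₁ :+ y :* b₂)
             :+ (y :* (b₁ :+ b₂)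
                 :+ (p :* (l₀ :+ l₁) :+ (con 1 :+ p) :* (y :* (l₁ :+ l₂))))
           := p :* (b₀ :+ l₀) :+ (p :* (b₁ :+ l₁)
                :+ (con 1 :+ p) :* (y :* ((b₁ :+ l₁) :+ (b₂ :+ l₂)))))
           refl ⌜ r ⌝ x (A (pred r) m) (A r m) (A (suc r) m) (L r) (L (suc r)) (L (suc (suc r))) ⟩
    ⌜ r ⌝ * (A (pred r) m + L r) + (⌜ r ⌝ * (A r m + L (suc r))
      + ⌜ suc r ⌝ * (x * ((A r m + L (suc r)) + (A (suc r) m + L (suc (suc r))))))
      ≈⟨ +-congʳ (⌜⌝*a r m j) ⟨
    ⌜ r ⌝ * a r (suc m) j + (⌜ r ⌝ * a (suc r) (suc m) j
      + ⌜ suc r ⌝ * (x * (a (suc r) (suc m) j + a (suc (suc r)) (suc m) j)))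
      ≈⟨ trans (sym (+-assoc _ _ _)) (+-congʳ (sym (distribˡ _ _ _))) ⟩
    ⌜ r ⌝ * (a r (suc m) j + a (suc r) (suc m) j)
      + ⌜ suc r ⌝ * (x * (a (suc r) (suc m) j + a (suc (suc r)) (suc m) j)) ∎
    where
    L : ℕ → Carrier
    L s = Σ< m (λ i → wt i j * a s m i)

  A-insert zero    m       = trans (A-0 m) (sym (zeroˡ _))
  A-insert (suc r) zero    = begin
    A r 0 + 0# + 0#
      ≈⟨ solve 2 (λ b y → b :+ con 0 :+ con 0
           := con 1 :* (b :+ (con 1 :+ y) :* con 0 :+ y :* con 0)) refl (A r 0) x ⟩
    1# * (A r 0 + (1# + x) * 0# + x * 0#)
      ≈⟨ ⌜1+r⌝*A r ⟩
    ⌜ suc r ⌝ * (A r 0 + (1# + x) * 0# + x * 0#) ∎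
    where
    -- `A r 0` is nonzero only at `r = 0`, where the factor is 1 anyway.
    ⌜1+r⌝*A : ∀ r → 1# * (A r 0 + (1# + x) * 0# + x * 0#)
                    ≈ ⌜ suc r ⌝ * (A r 0 + (1# + x) * 0# + x * 0#)
    ⌜1+r⌝*A zero    = *-congʳ (sym (+-identityʳ 1#))
    ⌜1+r⌝*A (suc r) = solve 2 (λ q y →
      con 1 :* (con 0 :+ (con 1 :+ y) :* con 0 :+ y :* con 0)
      := q :* (con 0 :+ (con 1 :+ y) :* con 0 :+ y :* con 0)) refl ⌜ suc (suc r) ⌝ x
  A-insert (suc r) (suc m) = begin
    A r n + Σ< n (λ i → wt i 0 * a (suc r) n i) + Σ< n (λ i → a (suc r) (suc n) (suc i))
      ≈⟨ +-cong (+-congˡ (Σ<-wt-0 r n)) (begin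
           Σ< n (λ i → a (suc r) (suc n) (suc i))
             ≈⟨ Σ<-cong n (λ i → a-insert r m i) ⟩
           Σ< n (λ i → ⌜ r ⌝ * (a r n i + a (suc r) n i)
                       + ⌜ suc r ⌝ * (x * (a (suc r) n i + a (suc (suc r)) n i)))
             ≈⟨ Σ<-combination n _ _ (a r n) (a (suc r) n) (a (suc (suc r)) n) ⟩
           ⌜ r ⌝ * (Σ< n (a r n) + A (suc r) n)
             + ⌜ suc r ⌝ * (x * (A (suc r) n + A (suc (suc r)) n)) ∎) ⟩
    A r n + A (suc r) n
      + (⌜ r ⌝ * (Σ< n (a r n) + A (suc r) n)
         + ⌜ suc r ⌝ * (x * (A (suc r) n + A (suc (suc r)) n)))
      ≈⟨ +-congˡ (+-congʳ (*-congˡ (+-congʳ (Σ<-a′ r)))) ⟩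
    A r n + A (suc r) n
      + (⌜ r ⌝ * (A r n + A (suc r) n) + ⌜ suc r ⌝ * (x * (A (suc r) n + A (suc (suc r)) n)))
      ≈⟨ solve 5 (λ p y b₀ b₁ b₂ →
           b₀ :+ b₁ :+ (p :* (b₀ :+ b₁) :+ (con 1 :+ p) :* (y :* (b₁ :+ b₂)))
           := (con 1 :+ p) :* (b₀ :+ (con 1 :+ y) :* b₁ :+ y :* b₂))
           refl ⌜ r ⌝ x (A r n) (A (suc r) n) (A (suc (suc r)) n) ⟩
    ⌜ suc r ⌝ * (A r n + (1# + x) * A (suc r) n + x * A (suc (suc r)) n) ∎
    where
    n = suc m
    Σ<-a′ : ∀ r → Σ< n (a r n) ≈ A r n
    Σ<-a′ zero    = refl
    Σ<-a′ (suc r) = refl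

  -- Blocks are nonempty, so there are at most as many as letters; this justifies cutting off sums
  -- over the number of runs.
  a-vanish : ∀ {r m} → m < r → ∀ j → a r m j ≈ 0#
  A-vanish : ∀ {r m} → m < r → A r m ≈ 0#
  a-vanish {suc r} {zero}  _           j = refl
  a-vanish {suc r} {suc m} (s≤s m<r) j = begin
    A r m + Σ< m (λ i → wt i j * a (suc r) m i)
      ≈⟨ +-cong (A-vanish m<r)
           (Σ<-cong m (λ i → trans (*-congˡ (a-vanish (ℕₚ.m<n⇒m<1+n m<r) i)) (zeroʳ _))) ⟩
    0# + Σ< m (λ _ → 0#)   ≈⟨ trans (+-identityˡ _) (Σ<-0 m) ⟩
    0# ∎
  A-vanish {suc r} {zero}  _   = refl
  A-vanish {suc r} {suc m} m<r = trans (Σ<-cong (suc m) (a-vanish m<r)) (Σ<-0 (suc m))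

  -- M bounds the number of runs of small letters.
  module _ (M : ℕ) where

    bothRuns : ℕ → ℕ → Carrier
    bothRuns m n = Σ< M (λ r → x ^ r * (A (suc r) m * A (suc r) n))

    -- Words that end in a large letter and start with the small, respectively large, letter of rank
    -- `j`. In both cases `r` counts the steps from large to small, so there are `suc r` runs of
    -- large letters, preceded or merely separated by runs of small ones: `suc r` of these in the
    -- first case, `r` in the second.
    smallFirst largeFirst : ℕ → ℕ → ℕ → Carrier
    smallFirst m n j = Σ< M (λ r → x ^ r * (a (suc r) m j * A (suc r) n))
    largeFirst m n j = Σ< M (λ r → x ^ r * (a (suc r) n j * A r m))

    private
      Σ<-Σ< : ∀ n (w : ℕ → Carrier) (f : ℕ → ℕ → Carrier) (g : ℕ → Carrier) →
        Σ< n (λ i → w i * Σ< M (λ r → x ^ r * (f r i * g r)))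
        ≈ Σ< M (λ r → x ^ r * (Σ< n (λ i → w i * f r i) * g r))
      Σ<-Σ< zero    w f g =
        sym (trans (Σ<-cong M (λ r → trans (*-congˡ (zeroˡ _)) (zeroʳ _))) (Σ<-0 M))
      Σ<-Σ< (suc n) w f g = begin
        w 0 * Σ< M (λ r → x ^ r * (f r 0 * g r))
          + Σ< n (λ i → w (suc i) * Σ< M (λ r → x ^ r * (f r (suc i) * g r)))
          ≈⟨ +-cong (sym (Σ<-*ˡ M _ _)) (Σ<-Σ< n (w ∘ suc) (λ r → f r ∘ suc) g) ⟩
        Σ< M (λ r → w 0 * (x ^ r * (f r 0 * g r)))
          + Σ< M (λ r → x ^ r * (Σ< n (λ i → w (suc i) * f r (suc i)) * g r))
          ≈⟨ Σ<-+ M _ _ ⟨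
        Σ< M (λ r → w 0 * (x ^ r * (f r 0 * g r))
          + x ^ r * (Σ< n (λ i → w (suc i) * f r (suc i)) * g r))
          ≈⟨ Σ<-cong M (λ r → solve 5 (λ w y f g s →
               w :* (y :* (f :* g)) :+ y :* (s :* g) := y :* ((w :* f :+ s) :* g))
               refl (w 0) (x ^ r) (f r 0) (g r) _) ⟩
        Σ< M (λ r → x ^ r * ((w 0 * f r 0 + Σ< n (λ i → w (suc i) * f r (suc i))) * g r)) ∎

      Σ<-1* : ∀ n f → Σ< n f ≈ Σ< n (λ i → 1# * f i)
      Σ<-1* n f = Σ<-cong n (λ i → sym (*-identityˡ _))

    Σ<-smallFirst : ∀ m n → Σ< m (smallFirst m n) ≈ bothRuns m n
    Σ<-smallFirst m n = trans (Σ<-1* m _)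
      (trans (Σ<-Σ< m (λ _ → 1#) (λ r i → a (suc r) m i) (λ r → A (suc r) n))
        (Σ<-cong M (λ r → *-congˡ (*-congʳ (trans (sym (Σ<-1* m _)) (Σ<-a r m))))))

    Σ<-largeFirst : ∀ m n →
      Σ< n (largeFirst m n) ≈ Σ< M (λ r → x ^ r * (A (suc r) n * A r m))
    Σ<-largeFirst m n = trans (Σ<-1* n _)
      (trans (Σ<-Σ< n (λ _ → 1#) (λ r i → a (suc r) n i) (λ r → A r m))
        (Σ<-cong M (λ r → *-congˡ (*-congʳ (trans (sym (Σ<-1* n _)) (Σ<-a r n))))))

    -- Delete the first letter: either the next letter is small, or the first run was a single
    -- letter and the next letter is large, which is an ascent.
    smallFirst-suc : ∀ m n j →
      smallFirst (suc m) n j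
      ≈ Σ< m (λ i → wt i j * smallFirst m n i) + Σ< n (largeFirst m n)
    smallFirst-suc m n j = begin
      Σ< M (λ r → x ^ r * ((A r m + Σ< m (λ i → wt i j * a (suc r) m i)) * A (suc r) n))
        ≈⟨ Σ<-cong M (λ r → solve 4 (λ y b l c →
             y :* ((b :+ l) :* c) := y :* (l :* c) :+ y :* (c :* b))
             refl (x ^ r) (A r m) _ (A (suc r) n)) ⟩
      Σ< M (λ r → x ^ r * (Σ< m (λ i → wt i j * a (suc r) m i) * A (suc r) n)
                  + x ^ r * (A (suc r) n * A r m))
        ≈⟨ Σ<-+ M _ _ ⟩
      Σ< M (λ r → x ^ r * (Σ< m (λ i → wt i j * a (suc r) m i) * A (suc r) n))
        + Σ< M (λ r → x ^ r * (A (suc r) n * A r m))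
        ≈⟨ +-cong (Σ<-Σ< m (λ i → wt i j) (λ r i → a (suc r) m i) (λ r → A (suc r) n))
             (Σ<-largeFirst m n) ⟨
      Σ< m (λ i → wt i j * smallFirst m n i) + Σ< n (largeFirst m n) ∎

    -- The same deletion for a large letter. When a run of large letters disappears, so does one
    -- step from large to small, and `r` has to be shifted: `m < M` removes the top term, and
    -- `0 < m + n` removes the term `r = 0`, which would count the empty word.
    largeFirst-suc : ∀ m n j → m < M → 0 < m ℕ.+ n →
      largeFirst m (suc n) j
      ≈ x * Σ< m (smallFirst m n) + Σ< n (λ i → wt i j * largeFirst m n i)
    largeFirst-suc m n j m<M 0<m+n = begin
      Σ< M (λ r → x ^ r * ((A r n + Σ< n (λ i → wt i j * a (suc r) n i)) * A r m))
        ≈⟨ Σ<-cong M (λ r → solve 4 (λ y b l c →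
             y :* ((b :+ l) :* c) := y :* (c :* b) :+ y :* (l :* c))
             refl (x ^ r) (A r n) _ (A r m)) ⟩
      Σ< M (λ r → runs r + x ^ r * (Σ< n (λ i → wt i j * a (suc r) n i) * A r m))
        ≈⟨ Σ<-+ M _ _ ⟩
      Σ< M runs + Σ< M (λ r → x ^ r * (Σ< n (λ i → wt i j * a (suc r) n i) * A r m))
        ≈⟨ +-cong (Σ<-shift M runs runs-0 runs-M)
             (sym (Σ<-Σ< n (λ i → wt i j) (λ r i → a (suc r) n i) (λ r → A r m))) ⟩
      Σ< M (runs ∘ suc) + Σ< n (λ i → wt i j * largeFirst m n i)
        ≈⟨ +-congʳ (trans (Σ<-cong M (λ r → *-assoc _ _ _)) (Σ<-*ˡ M x _)) ⟩
      x * bothRuns m n + Σ< n (λ i → wt i j * largeFirst m n i)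
        ≈⟨ +-congʳ (*-congˡ (Σ<-smallFirst m n)) ⟨
      x * Σ< m (smallFirst m n) + Σ< n (λ i → wt i j * largeFirst m n i) ∎
      where
      runs : ℕ → Carrier
      runs r = x ^ r * (A r m * A r n)
      runs-0 : runs 0 ≈ 0#
      runs-0 = trans (*-identityˡ _) (A₀A₀≈0 m n 0<m+n)
        where
        A₀A₀≈0 : ∀ m n → 0 < m ℕ.+ n → A 0 m * A 0 n ≈ 0#
        A₀A₀≈0 (suc m) n       _ = trans (*-congʳ (A-0 m)) (zeroˡ _)
        A₀A₀≈0 zero    (suc n) _ = trans (*-congˡ (A-0 n)) (zeroʳ _)
      runs-M : runs M ≈ 0#
      runs-M = trans (*-congˡ (trans (*-congʳ (A-vanish m<M)) (zeroˡ _))) (zeroʳ _)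

    smallFirst-0 : ∀ m j → smallFirst m 0 j ≈ 0#
    smallFirst-0 m j =
      trans (Σ<-cong M (λ r → trans (*-congˡ (zeroʳ _)) (zeroʳ _))) (Σ<-0 M)

    largeFirst-0-1 : ∀ j → 0 < M → largeFirst 0 1 j ≈ 1#
    largeFirst-0-1 j (s≤s {n = M} _) = begin
      1# * ((1# + 0#) * 1#) + Σ< M (λ r → x ^ suc r * ((A (suc r) 0 + 0#) * A (suc r) 0))
        ≈⟨ +-cong (solve 0 (con 1 :* ((con 1 :+ con 0) :* con 1) := con 1) refl)
             (trans (Σ<-cong M (λ r → trans (*-congˡ (zeroʳ _)) (zeroʳ _))) (Σ<-0 M)) ⟩
      1# + 0# ≈⟨ +-identityʳ 1# ⟩
      1# ∎

-- Walks and cycle types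

module Walks (R : CommutativeSemiring 0ℓ 0ℓ) (x : CommutativeSemiring.Carrier R) where

  open CommutativeSemiring R hiding (zero)
  open import Algebra.Properties.Semiring.Exp semiring using (_^_)
  open import Algebra.Solver.Ring.NaturalCoefficients.Default R
    using (solve; _:=_; _:+_; _:*_; con)
  open import Relation.Binary.Reasoning.Setoid setoid
  open Sums R

  -- Walks from 0 to r in n steps that stay positive after the start; a step
  -- up, level or down has weight 1, 1 + x or x.
  ν : ℕ → ℕ → Carrier
  ν zero    zero    = 1#
  ν zero    (suc n) = 0#
  ν (suc r) zero    = 0#
  ν (suc r) (suc n) = ν r n + (1# + x) * ν (suc r) n + x * ν (suc (suc r)) n

  ν-vanish : ∀ {r n} → n < r → ν r n ≈ 0#
  ν-vanish {suc r} {zero}  _         = refl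
  ν-vanish {suc r} {suc n} (s≤s n<r) = begin
    ν r n + (1# + x) * ν (suc r) n + x * ν (suc (suc r)) n
      ≈⟨ +-cong (+-cong (ν-vanish n<r) (*-congˡ (ν-vanish (ℕₚ.m<n⇒m<1+n n<r))))
           (*-congˡ (ν-vanish (ℕₚ.m<n⇒m<1+n (ℕₚ.m<n⇒m<1+n n<r)))) ⟩
    0# + (1# + x) * 0# + x * 0#
      ≈⟨ solve 1 (λ y → con 0 :+ (con 1 :+ y) :* con 0 :+ y :* con 0 := con 0) refl x ⟩
    0# ∎

  ν-1 : ∀ r → ν (suc (suc r)) 1 ≈ 0#
  ν-1 r = ν-vanish {suc (suc r)} {1} (s≤s (s≤s z≤n))

  -- The transfer matrix of positive walks is self-adjoint for the weights xʳ⁻¹, so a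
  -- step can be moved from one factor to the other.
  module _ (M : ℕ) where

    pairing : ℕ → ℕ → Carrier
    pairing n k = Σ< M (λ r → x ^ r * (ν (suc r) n * ν (suc r) k))

    private
      ups : ℕ → ℕ → ℕ → Carrier
      ups n k r = x ^ r * (ν r n * ν (suc r) k)

      expand : ∀ n k → pairing (suc n) k
        ≈ Σ< M (ups n k) + ((1# + x) * pairing n k + Σ< M (ups k n ∘ suc))
      expand n k = begin
        Σ< M (λ r → x ^ r * (ν (suc r) (suc n) * ν (suc r) k))
          ≈⟨ Σ<-cong M (λ r → solve 6 (λ y z b c d e →
               z :* ((b :+ (con 1 :+ y) :* c :+ y :* d) :* e)
               := z :* (b :* e) :+ ((con 1 :+ y) :* (z :* (c :* e)) :+ (y :* z) :* (e :* d)))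
               refl x (x ^ r) (ν r n) (ν (suc r) n) (ν (suc (suc r)) n) (ν (suc r) k)) ⟩
        Σ< M (λ r → ups n k r + ((1# + x) * (x ^ r * (ν (suc r) n * ν (suc r) k))
                                 + ups k n (suc r)))
          ≈⟨ trans (Σ<-+ M (ups n k) _) (+-congˡ (trans (Σ<-+ M _ (ups k n ∘ suc))
               (+-congʳ (Σ<-*ˡ M (1# + x) _)))) ⟩
        Σ< M (ups n k) + ((1# + x) * pairing n k + Σ< M (ups k n ∘ suc)) ∎

      ups-shift : ∀ n k → k ≤ M → Σ< M (ups (suc n) k) ≈ Σ< M (ups (suc n) k ∘ suc)
      ups-shift n k k≤M = Σ<-shift M (ups (suc n) k)
        (trans (*-congˡ (zeroˡ _)) (zeroʳ _))
        (trans (*-congˡ (trans (*-congˡ (ν-vanish (s≤s k≤M))) (zeroʳ _))) (zeroʳ _))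

      pairing-comm : ∀ n k → pairing n k ≈ pairing k n
      pairing-comm n k = Σ<-cong M (λ r → *-congˡ (*-comm _ _))

    -- A step down in one factor brings a factor `x`, which turns `x ^ r` into `x ^ suc r`; this is
    -- the weight of a step up in the other factor between the same two heights. Both lengths are
    -- positive, so nothing is at height 0, and the bounds leave nothing above the cut-off.
    pairing-adjoint : ∀ n k → suc n ≤ M → suc k ≤ M →
      pairing (suc (suc n)) (suc k) ≈ pairing (suc n) (suc (suc k))
    pairing-adjoint n k n<M k<M = begin
      pairing (suc n₁) k₁
        ≈⟨ expand n₁ k₁ ⟩
      Σ< M (ups n₁ k₁) + ((1# + x) * pairing n₁ k₁ + Σ< M (ups k₁ n₁ ∘ suc))
        ≈⟨ +-cong (ups-shift n k₁ k<M)
             (+-cong (*-congˡ (pairing-comm n₁ k₁)) (sym (ups-shift k n₁ n<M))) ⟩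
      Σ< M (ups n₁ k₁ ∘ suc) + ((1# + x) * pairing k₁ n₁ + Σ< M (ups k₁ n₁))
        ≈⟨ solve 3 (λ b c d → b :+ (c :+ d) := d :+ (c :+ b)) refl _ _ _ ⟩
      Σ< M (ups k₁ n₁) + ((1# + x) * pairing k₁ n₁ + Σ< M (ups n₁ k₁ ∘ suc))
        ≈⟨ expand k₁ n₁ ⟨
      pairing (suc k₁) n₁
        ≈⟨ pairing-comm (suc k₁) n₁ ⟩
      pairing n₁ (suc k₁) ∎
      where
      n₁ = suc n
      k₁ = suc k

    -- Steps are moved until the first walk has a single step. It then ends at height 1 with weight
    -- 1, so only `r = 0` survives.
    pairing-ν : ∀ n k → n ℕ.+ k < M → pairing (suc n) (suc k) ≈ ν 1 (suc (n ℕ.+ k))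
    pairing-ν zero    k k<M = pairing-1 k<M
      where
      pairing-1 : k < M → pairing 1 (suc k) ≈ ν 1 (suc k)
      pairing-1 (s≤s {n = M′} _) = begin
        1# * (ν 1 1 * ν 1 (suc k))
          + Σ< M′ (λ r → x ^ suc r * (ν (suc (suc r)) 1 * ν (suc (suc r)) (suc k)))
          ≈⟨ +-cong
               (solve 2 (λ y z → con 1 :* ((con 1 :+ (con 1 :+ y) :* con 0 :+ y :* con 0) :* z) := z)
                 refl x (ν 1 (suc k)))
               (trans (Σ<-cong M′ (λ r →
                 trans (*-congˡ (trans (*-congʳ (ν-1 r)) (zeroˡ _))) (zeroʳ _))) (Σ<-0 M′)) ⟩
        ν 1 (suc k) + 0#
          ≈⟨ +-identityʳ _ ⟩
        ν 1 (suc k) ∎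
    pairing-ν (suc n) k n+k<M = begin
      pairing (suc (suc n)) (suc k)
        ≈⟨ pairing-adjoint n k (ℕₚ.≤-trans (s≤s (ℕₚ.m≤m+n n k)) (ℕₚ.<⇒≤ n+k<M))
             (ℕₚ.≤-trans (s≤s (ℕₚ.m≤n+m k n)) (ℕₚ.<⇒≤ n+k<M)) ⟩
      pairing (suc n) (suc (suc k))
        ≈⟨ pairing-ν n (suc k) (≡.subst (_< M) (≡.sym (ℕₚ.+-suc n k)) n+k<M) ⟩
      ν 1 (suc (n ℕ.+ suc k))
        ≈⟨ reflexive (≡.cong (ν 1 ∘ suc) (ℕₚ.+-suc n k)) ⟩
      ν 1 (suc (suc n ℕ.+ k)) ∎

  -- For unrestricted walks κ, split at the last visit to 0.
  module _ (κ : ℕ → ℕ → Carrier)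
           (κ-0 : ∀ r → κ (suc r) 0 ≈ 0#)
           (κ-suc : ∀ r n → κ (suc r) (suc n)
                            ≈ κ r n + (1# + x) * κ (suc r) n + x * κ (suc (suc r)) n) where

    κ-lastVisit : ∀ r n → κ r n ≈ Σ⟨ n ⟩ (λ k j → κ 0 k * ν r j)
    κ-lastVisit zero    zero    = sym (*-identityʳ _)
    -- On the axis only `j = 0` contributes, as `ν 0 (suc j)` is zero. Off the axis both sides obey
    -- `κ-suc`, with the values of `κ 0` as boundary data.
    κ-lastVisit zero    (suc n) = sym (begin
      Σ⟨ suc n ⟩ (λ k j → κ 0 k * ν 0 j)
        ≈⟨ Σ⟨⟩-last n (λ k j → κ 0 k * ν 0 j) ⟩
      Σ⟨ n ⟩ (λ k j → κ 0 k * 0#) + κ 0 (suc n) * 1#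
        ≈⟨ +-cong (trans (Σ⟨⟩-cong n (λ k j _ → *-comm _ _))
             (trans (Σ⟨⟩-*ˡ n 0# _) (zeroˡ _))) (*-identityʳ _) ⟩
      0# + κ 0 (suc n)
        ≈⟨ +-identityˡ _ ⟩
      κ 0 (suc n) ∎)
    κ-lastVisit (suc r) zero    = trans (κ-0 r) (sym (zeroʳ _))
    κ-lastVisit (suc r) (suc n) = sym (begin
      Σ⟨ suc n ⟩ (λ k j → κ 0 k * ν (suc r) j)
        ≈⟨ Σ⟨⟩-last n (λ k j → κ 0 k * ν (suc r) j) ⟩
      Σ⟨ n ⟩ (λ k j → κ 0 k * ν (suc r) (suc j)) + κ 0 (suc n) * 0#
        ≈⟨ trans (+-congˡ (zeroʳ _)) (+-identityʳ _) ⟩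
      Σ⟨ n ⟩ (λ k j → κ 0 k * ν (suc r) (suc j))
        ≈⟨ Σ⟨⟩-cong n (λ k j _ → solve 5 (λ y c b d e →
             c :* (b :+ (con 1 :+ y) :* d :+ y :* e)
             := c :* b :+ ((con 1 :+ y) :* (c :* d) :+ y :* (c :* e)))
             refl x (κ 0 k) (ν r j) (ν (suc r) j) (ν (suc (suc r)) j)) ⟩
      Σ⟨ n ⟩ (λ k j → κ 0 k * ν r j + ((1# + x) * (κ 0 k * ν (suc r) j)
                                        + x * (κ 0 k * ν (suc (suc r)) j)))
        ≈⟨ trans (Σ⟨⟩-+ n _ _) (+-congˡ (trans (Σ⟨⟩-+ n _ _)
             (+-cong (Σ⟨⟩-*ˡ n (1# + x) _) (Σ⟨⟩-*ˡ n x _)))) ⟩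
      Σ⟨ n ⟩ (λ k j → κ 0 k * ν r j) + ((1# + x) * Σ⟨ n ⟩ (λ k j → κ 0 k * ν (suc r) j)
        + x * Σ⟨ n ⟩ (λ k j → κ 0 k * ν (suc (suc r)) j))
        ≈⟨ +-cong (κ-lastVisit r n) (+-cong (*-congˡ (κ-lastVisit (suc r) n))
             (*-congˡ (κ-lastVisit (suc (suc r)) n))) ⟨
      κ r n + ((1# + x) * κ (suc r) n + x * κ (suc (suc r)) n)
        ≈⟨ +-assoc _ _ _ ⟨
      κ r n + (1# + x) * κ (suc r) n + x * κ (suc (suc r)) n
        ≈⟨ κ-suc r n ⟨
      κ (suc r) (suc n) ∎)

-- Growing cycle types by one element at a time

module CycleTypes (R : CommutativeSemiring 0ℓ 0ℓ) where

  open CommutativeSemiring R hiding (zero)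
  open import Algebra.Solver.Ring.NaturalCoefficients.Default R
    using (solve; _:=_; _:+_; _:*_)
  open import Relation.Binary.Reasoning.Setoid setoid
  open Sums R

  -- grow Φ λs adds up Φ over the cycle types that arise from λs by putting a new
  -- element into one of the cycles (at ⌜ b ⌝ places in a cycle of length b), or
  -- into a new cycle.
  grow : (List ℕ → Carrier) → List ℕ → Carrier
  grow Φ []       = Φ (1 ∷ [])
  grow Φ (b ∷ λs) = ⌜ b ⌝ * Φ (suc b ∷ λs) + grow (Φ ∘ (b ∷_)) λs

  grow^ : ℕ → (List ℕ → Carrier) → List ℕ → Carrier
  grow^ zero    Φ = Φ
  grow^ (suc n) Φ = grow^ n (grow Φ)

  grow-cong : ∀ {Φ Ψ} → (∀ λs → Φ λs ≈ Ψ λs) → ∀ λs → grow Φ λs ≈ grow Ψ λs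
  grow-cong p []       = p (1 ∷ [])
  grow-cong p (b ∷ λs) = +-cong (*-congˡ (p (suc b ∷ λs))) (grow-cong (p ∘ (b ∷_)) λs)

  grow^-cong : ∀ n {Φ Ψ} → (∀ λs → Φ λs ≈ Ψ λs) → ∀ λs → grow^ n Φ λs ≈ grow^ n Ψ λs
  grow^-cong zero    p = p
  grow^-cong (suc n) p = grow^-cong n (grow-cong p)

  grow-+ : ∀ Φ Ψ λs → grow (λ μs → Φ μs + Ψ μs) λs ≈ grow Φ λs + grow Ψ λs
  grow-+ Φ Ψ []       = refl
  grow-+ Φ Ψ (b ∷ λs) =
    trans (+-cong (distribˡ _ _ _) (grow-+ (Φ ∘ (b ∷_)) (Ψ ∘ (b ∷_)) λs)) (interchange _ _ _ _)

  grow-*ˡ : ∀ c Φ λs → grow (λ μs → c * Φ μs) λs ≈ c * grow Φ λs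
  grow-*ˡ c Φ []       = refl
  grow-*ˡ c Φ (b ∷ λs) =
    trans (+-cong (x*yz≈y*xz _ _ _) (grow-*ˡ c (Φ ∘ (b ∷_)) λs)) (sym (distribˡ _ _ _))

  grow^-+ : ∀ n Φ Ψ λs → grow^ n (λ μs → Φ μs + Ψ μs) λs ≈ grow^ n Φ λs + grow^ n Ψ λs
  grow^-+ zero    Φ Ψ λs = refl
  grow^-+ (suc n) Φ Ψ λs = trans (grow^-cong n (grow-+ Φ Ψ) λs) (grow^-+ n _ _ λs)

  grow^-*ˡ : ∀ n c Φ λs → grow^ n (λ μs → c * Φ μs) λs ≈ c * grow^ n Φ λs
  grow^-*ˡ zero    c Φ λs = refl
  grow^-*ˡ (suc n) c Φ λs = trans (grow^-cong n (grow-*ˡ c Φ) λs) (grow^-*ˡ n c _ λs)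

  -- `grow` enlarges a cycle in place and appends a new one at the end, while `cycleType` of an
  -- extended permutation lists the cycle of the new element first. Functions that ignore the order
  -- do not see the difference.
  Symmetric : (List ℕ → Carrier) → Set
  Symmetric Φ = ∀ {λs μs} → λs ↭ μs → Φ λs ≈ Φ μs

  grow-symmetric : ∀ {Φ} → Symmetric Φ → Symmetric (grow Φ)
  grow-symmetric Φ-sym ↭.refl          = refl
  grow-symmetric Φ-sym (↭.prep b p)    =
    +-cong (*-congˡ (Φ-sym (↭.prep _ p))) (grow-symmetric (Φ-sym ∘ ↭.prep b) p)
  grow-symmetric {Φ} Φ-sym (↭.swap {xs} {ys} b c p) = begin
    ⌜ b ⌝ * Φ (suc b ∷ c ∷ xs) + (⌜ c ⌝ * Φ (b ∷ suc c ∷ xs) + grow (λ λs → Φ (b ∷ c ∷ λs)) xs)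
      ≈⟨ +-cong (*-congˡ (Φ-sym (↭.swap _ _ p))) (+-cong (*-congˡ (Φ-sym (↭.swap _ _ p)))
           (trans (grow-symmetric (Φ-sym ∘ ↭.prep b ∘ ↭.prep c) p)
             (grow-cong (λ _ → Φ-sym (↭.swap b c ↭-refl)) ys))) ⟩
    ⌜ b ⌝ * Φ (c ∷ suc b ∷ ys) + (⌜ c ⌝ * Φ (suc c ∷ b ∷ ys) + grow (λ λs → Φ (c ∷ b ∷ λs)) ys)
      ≈⟨ solve 3 (λ p q r → p :+ (q :+ r) := q :+ (p :+ r)) refl _ _ _ ⟩
    ⌜ c ⌝ * Φ (suc c ∷ b ∷ ys) + (⌜ b ⌝ * Φ (c ∷ suc b ∷ ys) + grow (λ λs → Φ (c ∷ b ∷ λs)) ys) ∎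
  grow-symmetric Φ-sym (↭.trans p q)   =
    trans (grow-symmetric Φ-sym p) (grow-symmetric Φ-sym q)

  -- Of n new elements, k join the cycle in front; they can do so in
  -- (b + 1) (b + 2) ⋯ (b + k) ways.
  grow^-∷ : ∀ n Φ b λs →
    ⌜ b ! ⌝ * grow^ n Φ (suc b ∷ λs)
    ≈ binomial n (λ k j → ⌜ (b ℕ.+ k) ! ⌝ * grow^ j (Φ ∘ (suc (b ℕ.+ k) ∷_)) λs)
  grow^-∷ zero    Φ b λs rewrite ℕₚ.+-identityʳ b = refl
  grow^-∷ (suc n) Φ b λs = begin
    ⌜ b ! ⌝ * grow^ n (grow Φ) (suc b ∷ λs)
      ≈⟨ grow^-∷ n (grow Φ) b λs ⟩
    binomial n (λ k j → ⌜ (b ℕ.+ k) ! ⌝ * grow^ j (grow Φ ∘ (suc (b ℕ.+ k) ∷_)) λs)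
      ≈⟨ binomial-cong n (λ k j _ → split k j) ⟩
    binomial n (λ k j → h (suc k) j + h k (suc j))
      ≈⟨ binomial-+ n _ _ ⟩
    binomial (suc n) h ∎
    where
    h : ℕ → ℕ → Carrier
    h k j = ⌜ (b ℕ.+ k) ! ⌝ * grow^ j (Φ ∘ (suc (b ℕ.+ k) ∷_)) λs
    split : ∀ k j → ⌜ (b ℕ.+ k) ! ⌝ * grow^ j (grow Φ ∘ (suc (b ℕ.+ k) ∷_)) λs
                    ≈ h (suc k) j + h k (suc j)
    split k j rewrite ℕₚ.+-suc b k = begin
      ⌜ i ! ⌝ * grow^ j (λ μs → ⌜ suc i ⌝ * Φ (suc (suc i) ∷ μs) + grow (Φ ∘ (suc i ∷_)) μs) λs
        ≈⟨ *-congˡ (trans (grow^-+ j _ _ λs) (+-congʳ (grow^-*ˡ j ⌜ suc i ⌝ _ λs))) ⟩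
      ⌜ i ! ⌝ * (⌜ suc i ⌝ * grow^ j (Φ ∘ (suc (suc i) ∷_)) λs + grow^ (suc j) (Φ ∘ (suc i ∷_)) λs)
        ≈⟨ solve 4 (λ p q r s → p :* (q :* r :+ s) := q :* p :* r :+ p :* s) refl _ _ _ _ ⟩
      ⌜ suc i ⌝ * ⌜ i ! ⌝ * grow^ j (Φ ∘ (suc (suc i) ∷_)) λs
        + ⌜ i ! ⌝ * grow^ (suc j) (Φ ∘ (suc i ∷_)) λs
        ≈⟨ +-congʳ (*-congʳ (⌜⌝-* (suc i) (i !))) ⟨
      ⌜ suc i ! ⌝ * grow^ j (Φ ∘ (suc (suc i) ∷_)) λs
        + ⌜ i ! ⌝ * grow^ (suc j) (Φ ∘ (suc i ∷_)) λs ∎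
      where i = b ℕ.+ k

  -- The first element has to open a cycle. Of the other `n` elements, `k` join it in `k !` ways,
  -- and the remaining `j` form a permutation of their own.
  grow^-suc : ∀ n Φ →
    grow^ (suc n) Φ [] ≈ binomial n (λ k j → ⌜ k ! ⌝ * grow^ j (Φ ∘ (suc k ∷_)) [])
  grow^-suc n Φ = begin
    grow^ n (grow Φ) []
      ≈⟨ grow^-grow n Φ ⟩
    grow^ n Φ (1 ∷ [])
      ≈⟨ trans (*-congʳ (+-identityʳ 1#)) (*-identityˡ _) ⟨
    ⌜ 0 ! ⌝ * grow^ n Φ (1 ∷ [])
      ≈⟨ grow^-∷ n Φ 0 [] ⟩
    binomial n (λ k j → ⌜ k ! ⌝ * grow^ j (Φ ∘ (suc k ∷_)) []) ∎
    where
    grow^-grow : ∀ n Φ → grow^ n (grow Φ) [] ≈ grow^ n Φ (1 ∷ [])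
    grow^-grow zero    Φ = refl
    grow^-grow (suc n) Φ = grow^-grow n (grow Φ)

-- The cycle-weighted sum of block enumerators

module CycleSum (R : CommutativeSemiring 0ℓ 0ℓ) (x : CommutativeSemiring.Carrier R)
                (b : ℕ → CommutativeSemiring.Carrier R) where

  open CommutativeSemiring R hiding (zero)
  open import Relation.Binary.Reasoning.Setoid setoid
  open import Algebra.Solver.Ring.NaturalCoefficients.Default R
    using (solve; _:=_; _:+_; _:*_; con)
  open Sums R
  open BlockWords R x
  open Walks R x
  open CycleTypes R

  prod : List ℕ → Carrier
  prod λs = foldr _*_ 1# (map b λs)

  weight : ℕ → List ℕ → Carrier
  weight r λs = prod λs * A r (length λs)

  weight-∷ : ∀ r k λs → weight r (k ∷ λs)
    ≈ b k * (⌜ r ⌝ * (weight (pred r) λs + (1# + x) * weight r λs + x * weight (suc r) λs))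
  weight-∷ r k λs = begin
    b k * prod λs * A r (suc (length λs))
      ≈⟨ *-congˡ (A-insert r (length λs)) ⟩
    b k * prod λs * (⌜ r ⌝ * (A (pred r) (length λs) + (1# + x) * A r (length λs)
                              + x * A (suc r) (length λs)))
      ≈⟨ solve 7 (λ y b p r c d e →
           b :* p :* (r :* (c :+ (con 1 :+ y) :* d :+ y :* e))
           := b :* (r :* (p :* c :+ (con 1 :+ y) :* (p :* d) :+ y :* (p :* e))))
           refl x (b k) (prod λs) ⌜ r ⌝ (A (pred r) (length λs)) (A r (length λs))
           (A (suc r) (length λs)) ⟩
    b k * (⌜ r ⌝ * (weight (pred r) λs + (1# + x) * weight r λs + x * weight (suc r) λs)) ∎

  weight-symmetric : ∀ r → Symmetric (weight r)
  weight-symmetric r p = *-cong (prod-↭ p) (reflexive (≡.cong (A r) (↭-length p)))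
    where
    open import Data.List.Relation.Binary.Permutation.Propositional.Properties using (↭-length)
    prod-↭ : ∀ {λs μs} → λs ↭ μs → prod λs ≈ prod μs
    prod-↭ ↭.refl         = refl
    prod-↭ (↭.prep _ p)   = *-congˡ (prod-↭ p)
    prod-↭ (↭.swap _ _ p) = trans (*-congˡ (*-congˡ (prod-↭ p))) (x*yz≈y*xz _ _ _)
    prod-↭ (↭.trans p q)  = trans (prod-↭ p) (prod-↭ q)

  module _ (κ : ℕ → ℕ → Carrier)
           (κ-0 : ∀ r → κ (suc r) 0 ≈ 0#)
           (κ-suc : ∀ r n → κ (suc r) (suc n)
                            ≈ κ r n + (1# + x) * κ (suc r) n + x * κ (suc (suc r)) n)
           (b-κ : ∀ k → b (suc k) ≈ κ 0 k)
           (κ-ν : ∀ r n → ⌜ n ⌝ * ν r n ≈ ⌜ r ⌝ * κ r n) where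

    -- Take off the cycle of the first element, of length `suc k`. It contributes `κ 0 k`, and
    -- `weight-∷` with the induction hypothesis turns the rest into `r * ν r (suc j)`. The
    -- convolution over `k + j = n` is `r * κ r (suc n)` by the last visit to 0, and `κ-ν` exchanges
    -- the factor `r` for the factor `suc n` that completes the factorial. All `j ≤ n` occur, hence
    -- strong induction.
    grow^-weight : ∀ n r → grow^ n (weight r) [] ≈ ⌜ n ! ⌝ * ν r n
    grow^-weight = <-rec _ step
      where
      base : ∀ r → weight r [] ≈ ⌜ 1 ⌝ * ν r 0
      base zero    = *-congʳ (sym (+-identityʳ 1#))
      base (suc r) = trans (zeroʳ _) (sym (zeroʳ _))

      ⌜⌝*ν : ∀ r j → ⌜ r ⌝ * (ν (pred r) j + (1# + x) * ν r j + x * ν (suc r) j)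
                     ≈ ⌜ r ⌝ * ν r (suc j)
      ⌜⌝*ν zero    j = trans (zeroˡ _) (sym (zeroˡ _))
      ⌜⌝*ν (suc r) j = refl

      step : ∀ n → (∀ {j} → j < n → ∀ r → grow^ j (weight r) [] ≈ ⌜ j ! ⌝ * ν r j) →
             ∀ r → grow^ n (weight r) [] ≈ ⌜ n ! ⌝ * ν r n
      step zero    _   r = base r
      step (suc n) rec r = begin
        grow^ (suc n) (weight r) []
          ≈⟨ grow^-suc n (weight r) ⟩
        binomial n (λ k j → ⌜ k ! ⌝ * grow^ j (weight r ∘ (suc k ∷_)) [])
          ≈⟨ binomial-cong n term ⟩
        binomial n (λ k j → ⌜ k ! ⌝ * ⌜ j ! ⌝ * (⌜ r ⌝ * (κ 0 k * ν r (suc j))))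
          ≈⟨ binomial-! n _ ⟩
        ⌜ n ! ⌝ * Σ⟨ n ⟩ (λ k j → ⌜ r ⌝ * (κ 0 k * ν r (suc j)))
          ≈⟨ *-congˡ (trans (Σ⟨⟩-*ˡ n _ _) (⌜⌝*κ r)) ⟩
        ⌜ n ! ⌝ * (⌜ r ⌝ * κ r (suc n))
          ≈⟨ *-congˡ (κ-ν r (suc n)) ⟨
        ⌜ n ! ⌝ * (⌜ suc n ⌝ * ν r (suc n))
          ≈⟨ solve 3 (λ p q s → p :* (q :* s) := q :* p :* s) refl _ _ _ ⟩
        ⌜ suc n ⌝ * ⌜ n ! ⌝ * ν r (suc n)
          ≈⟨ *-congʳ (⌜⌝-* (suc n) (n !)) ⟨
        ⌜ suc n ! ⌝ * ν r (suc n) ∎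
        where
        ⌜⌝*κ : ∀ r → ⌜ r ⌝ * Σ⟨ n ⟩ (λ k j → κ 0 k * ν r (suc j)) ≈ ⌜ r ⌝ * κ r (suc n)
        ⌜⌝*κ zero    = trans (zeroˡ _) (sym (zeroˡ _))
        ⌜⌝*κ (suc r) = *-congˡ (sym (begin
          κ (suc r) (suc n)
            ≈⟨ κ-lastVisit κ κ-0 κ-suc (suc r) (suc n) ⟩
          Σ⟨ suc n ⟩ (λ k j → κ 0 k * ν (suc r) j)
            ≈⟨ Σ⟨⟩-last n (λ k j → κ 0 k * ν (suc r) j) ⟩
          -- The term `j = 0` is zero: without a step no positive height is reached.
          Σ⟨ n ⟩ (λ k j → κ 0 k * ν (suc r) (suc j)) + κ 0 (suc n) * 0#
            ≈⟨ trans (+-congˡ (zeroʳ _)) (+-identityʳ _) ⟩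
          Σ⟨ n ⟩ (λ k j → κ 0 k * ν (suc r) (suc j)) ∎))

        term : ∀ k j → k ℕ.+ j ≡ n →
          ⌜ k ! ⌝ * grow^ j (weight r ∘ (suc k ∷_)) []
          ≈ ⌜ k ! ⌝ * ⌜ j ! ⌝ * (⌜ r ⌝ * (κ 0 k * ν r (suc j)))
        term k j k+j≡n = begin
          ⌜ k ! ⌝ * grow^ j (weight r ∘ (suc k ∷_)) []
            ≈⟨ *-congˡ (grow^-cong j (weight-∷ r (suc k)) []) ⟩
          ⌜ k ! ⌝ * grow^ j (λ μs → b (suc k) * (⌜ r ⌝ * (weight (pred r) μs
                        + (1# + x) * weight r μs + x * weight (suc r) μs))) []
            ≈⟨ *-congˡ (trans (grow^-*ˡ j _ _ []) (*-cong (b-κ k) (trans (grow^-*ˡ j _ _ [])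
                 (*-congˡ (trans (grow^-+ j _ _ []) (+-cong
                   (trans (grow^-+ j _ _ []) (+-cong (rec j<1+n (pred r))
                     (trans (grow^-*ˡ j _ _ []) (*-congˡ (rec j<1+n r)))))
                   (trans (grow^-*ˡ j _ _ []) (*-congˡ (rec j<1+n (suc r)))))))))) ⟩
          ⌜ k ! ⌝ * (κ 0 k * (⌜ r ⌝ * (⌜ j ! ⌝ * ν (pred r) j
                        + (1# + x) * (⌜ j ! ⌝ * ν r j) + x * (⌜ j ! ⌝ * ν (suc r) j))))
            ≈⟨ solve 8 (λ y p q r s c d e →
                 p :* (s :* (r :* (q :* c :+ (con 1 :+ y) :* (q :* d) :+ y :* (q :* e))))
                 := p :* q :* (s :* (r :* (c :+ (con 1 :+ y) :* d :+ y :* e))))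
                 refl x ⌜ k ! ⌝ ⌜ j ! ⌝ ⌜ r ⌝ (κ 0 k) (ν (pred r) j) (ν r j) (ν (suc r) j) ⟩
          ⌜ k ! ⌝ * ⌜ j ! ⌝ * (κ 0 k * (⌜ r ⌝ * (ν (pred r) j + (1# + x) * ν r j + x * ν (suc r) j)))
            ≈⟨ *-congˡ (trans (*-congˡ (⌜⌝*ν r j)) (x*yz≈y*xz _ _ _)) ⟩
          ⌜ k ! ⌝ * ⌜ j ! ⌝ * (⌜ r ⌝ * (κ 0 k * ν r (suc j))) ∎
          where
          j<1+n : j < suc n
          j<1+n = s≤s (≡.subst (j ≤_) k+j≡n (ℕₚ.m≤n+m j k))

-- Permutations read from the left

<ᵇ-true : ∀ {m n} → m < n → (m <ᵇ n) ≡ true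
<ᵇ-true {m} {n} m<n = dec-true (m ℕₚ.<? n) m<n

<ᵇ-false : ∀ {m n} → n ≤ m → (m <ᵇ n) ≡ false
<ᵇ-false {m} {n} n≤m = dec-false (m ℕₚ.<? n) (ℕₚ.≤⇒≯ n≤m)

<ᵇ-suc : ∀ m n → (m <ᵇ suc n) ≡ (m ≤ᵇ n)
<ᵇ-suc zero    n = ≡.refl
<ᵇ-suc (suc m) n = ≡.refl

punchIn-<ᵇ : ∀ {n} (i : Fin (suc n)) (a b : Fin n) →
             (toℕ (punchIn i a) <ᵇ toℕ (punchIn i b)) ≡ (toℕ a <ᵇ toℕ b)
punchIn-<ᵇ Fin.zero    a           b           = ≡.refl
punchIn-<ᵇ (Fin.suc i) Fin.zero    Fin.zero    = ≡.refl
punchIn-<ᵇ (Fin.suc i) Fin.zero    (Fin.suc b) = ≡.refl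
punchIn-<ᵇ (Fin.suc i) (Fin.suc a) Fin.zero    = ≡.refl
punchIn-<ᵇ (Fin.suc i) (Fin.suc a) (Fin.suc b) = punchIn-<ᵇ i a b

-- This is why a descent after the deleted first letter can be read off from the rank of the next
-- letter among the remaining ones.
punchIn-<ᵇ-self : ∀ {n} (i : Fin (suc n)) (a : Fin n) →
                  (toℕ (punchIn i a) <ᵇ toℕ i) ≡ (toℕ a <ᵇ toℕ i)
punchIn-<ᵇ-self Fin.zero    a           = ≡.refl
punchIn-<ᵇ-self (Fin.suc i) Fin.zero    = ≡.refl
punchIn-<ᵇ-self (Fin.suc i) (Fin.suc a) = punchIn-<ᵇ-self i a

-- Deleting a small letter lowers the threshold between small and large letters by one; deleting a
-- large one, as in `punchIn-≤ᵇ-above`, keeps it.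
punchIn-≤ᵇ-below : ∀ {n} m (i : Fin (suc n)) (a : Fin n) → toℕ i ≤ m →
                   (suc m ≤ᵇ toℕ (punchIn i a)) ≡ (m ≤ᵇ toℕ a)
punchIn-≤ᵇ-below m       Fin.zero    a           i≤m       = <ᵇ-suc m (toℕ a)
punchIn-≤ᵇ-below (suc m) (Fin.suc i) Fin.zero    i≤m       = ≡.refl
punchIn-≤ᵇ-below (suc m) (Fin.suc i) (Fin.suc a) (s≤s i≤m) =
  ≡.trans (punchIn-≤ᵇ-below m i a i≤m) (≡.sym (<ᵇ-suc m (toℕ a)))

punchIn-≤ᵇ-above : ∀ {n} m (i : Fin (suc n)) (a : Fin n) → m ≤ toℕ i →
                   (m ≤ᵇ toℕ (punchIn i a)) ≡ (m ≤ᵇ toℕ a)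
punchIn-≤ᵇ-above zero    i           a           m≤i       = ≡.refl
punchIn-≤ᵇ-above (suc m) (Fin.suc i) Fin.zero    m≤i       = ≡.refl
punchIn-≤ᵇ-above (suc m) (Fin.suc i) (Fin.suc a) (s≤s m≤i) =
  ≡.trans (<ᵇ-suc m _) (≡.trans (punchIn-≤ᵇ-above m i a m≤i) (≡.sym (<ᵇ-suc m _)))

descents : ∀ {n} → List (Fin n) → ℕ
descents as = length (filter (λ (a , b) → b Finₚ.<? a) (zip as (drop 1 as)))

endsLarge : ∀ {n} → ℕ → List (Fin n) → Bool
endsLarge m as = does (Maybe.dec (λ a → m ℕₚ.≤? toℕ a) (last as))

startsSmall : ∀ {n} → ℕ → List (Fin n) → Bool
startsSmall m as = does (Maybe.dec (λ a → toℕ a ℕₚ.<? m) (head as))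

endsLarge-map : ∀ {n n′} m m′ (f : Fin n → Fin n′) →
                (∀ a → (m ≤ᵇ toℕ (f a)) ≡ (m′ ≤ᵇ toℕ a)) →
                ∀ as → endsLarge m (map f as) ≡ endsLarge m′ as
endsLarge-map m m′ f p []           = ≡.refl
endsLarge-map m m′ f p (a ∷ [])     = p a
endsLarge-map m m′ f p (a ∷ b ∷ as) = endsLarge-map m m′ f p (b ∷ as)

module FirstLetter (R : CommutativeSemiring 0ℓ 0ℓ) (x : CommutativeSemiring.Carrier R) where

  open CommutativeSemiring R hiding (zero)
  open import Algebra.Properties.Semiring.Exp semiring using () renaming (_^_ to _^ᴿ_)
  open import Relation.Binary.Reasoning.Setoid setoid
  open Sums R
  open BlockWords R x

  word : ∀ {n} → List (Fin n) → Carrier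
  word as = x ^ᴿ descents as

  word-∷ : ∀ {n} (a b : Fin n) as → word (a ∷ b ∷ as) ≈ wt (toℕ b) (toℕ a) * word (b ∷ as)
  word-∷ a b as with toℕ b <ᵇ toℕ a
  ... | true  = refl
  ... | false = sym (*-identityˡ _)

  word-map : ∀ {n n′} (f : Fin n → Fin n′) →
             (∀ a b → (toℕ (f a) <ᵇ toℕ (f b)) ≡ (toℕ a <ᵇ toℕ b)) →
             ∀ as → word (map f as) ≈ word as
  word-map f p []           = refl
  word-map f p (a ∷ [])     = refl
  word-map f p (a ∷ b ∷ as) = begin
    word (f a ∷ f b ∷ map f as)
      ≈⟨ word-∷ (f a) (f b) (map f as) ⟩
    wt (toℕ (f b)) (toℕ (f a)) * word (map f (b ∷ as))
      ≈⟨ *-cong (reflexive (≡.cong (λ c → if c then x else 1#) (p b a))) (word-map f p (b ∷ as)) ⟩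
    wt (toℕ b) (toℕ a) * word (b ∷ as)
      ≈⟨ word-∷ a b as ⟨
    word (a ∷ b ∷ as) ∎

  wordTo : ∀ {n} → ℕ → List (Fin n) → Carrier
  wordTo m as = when (endsLarge m as) (word as)

  wordTo-punchIn : ∀ {n} m m′ (j : Fin (suc n)) (b : Fin n) (as : List (Fin n)) →
    (∀ a → (m ≤ᵇ toℕ (punchIn j a)) ≡ (m′ ≤ᵇ toℕ a)) →
    wordTo m (j ∷ map (punchIn j) (b ∷ as)) ≈ wt (toℕ b) (toℕ j) * wordTo m′ (b ∷ as)
  wordTo-punchIn m m′ j b as p = trans
    (when-cong (endsLarge-map m m′ (punchIn j) p (b ∷ as)) (begin
      word (j ∷ punchIn j b ∷ map (punchIn j) as)
        ≈⟨ word-∷ j (punchIn j b) (map (punchIn j) as) ⟩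
      wt (toℕ (punchIn j b)) (toℕ j) * word (map (punchIn j) (b ∷ as))
        ≈⟨ *-cong (reflexive (≡.cong (λ c → if c then x else 1#) (punchIn-<ᵇ-self j b)))
             (word-map (punchIn j) (punchIn-<ᵇ j) (b ∷ as)) ⟩
      wt (toℕ b) (toℕ j) * word (b ∷ as) ∎))
    (when-*ˡ (endsLarge m′ (b ∷ as)) _ _)

  wordTo-insert : ∀ {n} m m′ (j : Fin (suc (suc n))) i (π : Permutation′ n) →
    (∀ a → (m ≤ᵇ toℕ (punchIn j a)) ≡ (m′ ≤ᵇ toℕ a)) →
    wordTo m (oneLine (insert Fin.zero j (insert Fin.zero i π)))
    ≈ wt (toℕ i) (toℕ j) * wordTo m′ (oneLine (insert Fin.zero i π))
  wordTo-insert m m′ j i π p = trans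
    (reflexive (≡.cong (λ as → wordTo m (j ∷ as))
      (≡.sym (map-tabulate (insert Fin.zero i π ⟨$⟩ʳ_) (punchIn j)))))
    (wordTo-punchIn m m′ j i _ p)

  module _ (M : ℕ) where

    from : ∀ {n} → ℕ → Fin (suc n) → Carrier
    from {n} m j = ΣL (𝔖 n) (λ π → wordTo m (oneLine (insert Fin.zero j π)))

    from-suc : ∀ {n} m m′ (j : Fin (suc (suc n))) →
      (∀ a → (m ≤ᵇ toℕ (punchIn j a)) ≡ (m′ ≤ᵇ toℕ a)) →
      from m j ≈ ΣL (allFin (suc n)) (λ i → wt (toℕ i) (toℕ j) * from m′ i)
    from-suc {n} m m′ j p = trans
      (ΣL-cartesianProductWith (insert Fin.zero) (allFin (suc n)) (𝔖 n) _)
      (ΣL-cong (allFin (suc n)) (λ i →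
        trans (ΣL-cong (𝔖 n) (λ π → wordTo-insert m m′ j i π p)) (ΣL-*ˡ (𝔖 n) _ _)))

    -- Simultaneous induction on the number of letters: `from-suc` deletes the first letter of a
    -- permutation, just as `smallFirst-suc` and `largeFirst-suc` do for block words.
    from-small : ∀ N m n → m ℕ.+ n ≡ suc N → m < M → (j : Fin (suc N)) → toℕ j < m →
                 from m j ≈ smallFirst M m n (toℕ j)
    from-large : ∀ N m n → m ℕ.+ n ≡ suc N → m < M → (j : Fin (suc N)) → m ≤ toℕ j →
                 from m j ≈ largeFirst M m n (toℕ j ∸ m)

    ΣL-from : ∀ N m n → m ℕ.+ n ≡ suc N → m < M → ∀ (w : ℕ → Carrier) f g →
      (∀ i → i < m → w i * smallFirst M m n i ≈ f i) →
      (∀ i → m ≤ i → w i * largeFirst M m n (i ∸ m) ≈ g (i ∸ m)) →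
      ΣL (allFin (suc N)) (λ i → w (toℕ i) * from m i) ≈ Σ< m f + Σ< n g
    ΣL-from N m n m+n≡1+N m<M w f g p q = begin
      ΣL (allFin (suc N)) (λ i → w (toℕ i) * from m i)
        ≈⟨ ΣL-tabulate id _ (λ i → if i <ᵇ m then f i else g (i ∸ m)) term ⟩
      Σ< (suc N) (λ i → if i <ᵇ m then f i else g (i ∸ m))
        ≈⟨ reflexive (≡.cong (λ k → Σ< k (λ i → if i <ᵇ m then f i else g (i ∸ m)))
             (≡.sym m+n≡1+N)) ⟩
      Σ< (m ℕ.+ n) (λ i → if i <ᵇ m then f i else g (i ∸ m))
        ≈⟨ Σ<-if m n f g ⟩
      Σ< m f + Σ< n g ∎
      where
      term : ∀ i → w (toℕ i) * from m i ≈ (if toℕ i <ᵇ m then f (toℕ i) else g (toℕ i ∸ m))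
      term i with toℕ i ℕₚ.<? m
      ... | yes i<m rewrite <ᵇ-true i<m =
        trans (*-congˡ (from-small N m n m+n≡1+N m<M i i<m)) (p (toℕ i) i<m)
      ... | no  i≮m rewrite <ᵇ-false (ℕₚ.≮⇒≥ i≮m) =
        trans (*-congˡ (from-large N m n m+n≡1+N m<M i (ℕₚ.≮⇒≥ i≮m))) (q (toℕ i) (ℕₚ.≮⇒≥ i≮m))

    -- A single small letter does not end in a large one, so both sides are zero.
    from-small zero    (suc zero) zero e m<M Fin.zero j<m =
      trans (+-identityʳ 0#) (sym (smallFirst-0 M 1 0))
    from-small zero    (suc (suc m)) n () m<M j j<m
    from-small zero    (suc zero) (suc n) () m<M j j<m
    from-small (suc N) (suc m) n e m<M j (s≤s j≤m) = begin
      from (suc m) j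
        ≈⟨ from-suc (suc m) m j (λ a → punchIn-≤ᵇ-below m j a j≤m) ⟩
      ΣL (allFin (suc N)) (λ i → wt (toℕ i) (toℕ j) * from m i)
        ≈⟨ ΣL-from N m n (ℕₚ.suc-injective e) (ℕₚ.<-trans (ℕₚ.n<1+n m) m<M)
             (λ i → wt i (toℕ j)) _ _ (λ i _ → refl) ascent ⟩
      Σ< m (λ i → wt i (toℕ j) * smallFirst M m n i) + Σ< n (largeFirst M m n)
        ≈⟨ smallFirst-suc M m n (toℕ j) ⟨
      smallFirst M (suc m) n (toℕ j) ∎
      where
      ascent : ∀ i → m ≤ i → wt i (toℕ j) * largeFirst M m n (i ∸ m) ≈ largeFirst M m n (i ∸ m)
      ascent i m≤i rewrite <ᵇ-false (ℕₚ.≤-trans j≤m m≤i) = *-identityˡ _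

    from-large zero    zero (suc zero) e m<M Fin.zero m≤j =
      trans (+-identityʳ 1#) (sym (largeFirst-0-1 M 0 m<M))
    from-large zero    (suc m) n e m<M Fin.zero ()
    from-large (suc N) m zero    e m<M j m≤j = contradiction
      (≡.subst (_≤ toℕ j) (≡.trans (≡.sym (ℕₚ.+-identityʳ m)) e) m≤j)
      (ℕₚ.<⇒≱ (Finₚ.toℕ<n j))
    from-large (suc N) m (suc n) e m<M j m≤j = begin
      from m j
        ≈⟨ from-suc m m j (λ a → punchIn-≤ᵇ-above m j a m≤j) ⟩
      ΣL (allFin (suc N)) (λ i → wt (toℕ i) (toℕ j) * from m i)
        ≈⟨ ΣL-from N m n m+n≡1+N m<M (λ i → wt i (toℕ j)) _ _ descent large ⟩
      Σ< m (λ i → x * smallFirst M m n i)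
        + Σ< n (λ i → wt i (toℕ j ∸ m) * largeFirst M m n i)
        ≈⟨ +-congʳ (Σ<-*ˡ m x _) ⟩
      x * Σ< m (smallFirst M m n) + Σ< n (λ i → wt i (toℕ j ∸ m) * largeFirst M m n i)
        ≈⟨ largeFirst-suc M m n (toℕ j ∸ m) m<M (≡.subst (0 <_) (≡.sym m+n≡1+N) (s≤s z≤n)) ⟨
      largeFirst M m (suc n) (toℕ j ∸ m) ∎
      where
      m+n≡1+N : m ℕ.+ n ≡ suc N
      m+n≡1+N = ℕₚ.suc-injective (≡.trans (≡.sym (ℕₚ.+-suc m n)) e)
      descent : ∀ i → i < m → wt i (toℕ j) * smallFirst M m n i ≈ x * smallFirst M m n i
      descent i i<m rewrite <ᵇ-true (ℕₚ.<-≤-trans i<m m≤j) = refl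
      ∸-<ᵇ : ∀ m i j → m ≤ i → m ≤ j → (i <ᵇ j) ≡ (i ∸ m <ᵇ j ∸ m)
      ∸-<ᵇ zero    i       j       m≤i       m≤j       = ≡.refl
      ∸-<ᵇ (suc m) (suc i) (suc j) (s≤s m≤i) (s≤s m≤j) = ∸-<ᵇ m i j m≤i m≤j
      large : ∀ i → m ≤ i → wt i (toℕ j) * largeFirst M m n (i ∸ m)
                            ≈ wt (i ∸ m) (toℕ j ∸ m) * largeFirst M m n (i ∸ m)
      large i m≤i = *-congʳ (reflexive (≡.cong (λ c → if c then x else 1#) (∸-<ᵇ m i (toℕ j) m≤i m≤j)))

    ΣL-admissible : ∀ N m n → m ℕ.+ n ≡ N → m < M →
      ΣL (𝔖 N) (λ w → when (startsSmall m (oneLine w) ∧ endsLarge m (oneLine w)) (word (oneLine w)))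
      ≈ bothRuns M m n
    -- The empty word has no first letter and is not admissible; on the other side every
    -- `A (suc r) 0` is zero.
    ΣL-admissible zero    zero zero e m<M = trans (+-identityʳ 0#)
      (sym (trans (Σ<-cong M (λ r → trans (*-congˡ (zeroʳ _)) (zeroʳ _))) (Σ<-0 M)))
    ΣL-admissible zero    zero (suc n) () m<M
    ΣL-admissible (suc N) m n e m<M = begin
      ΣL (𝔖 (suc N)) _
        ≈⟨ ΣL-cartesianProductWith (insert Fin.zero) (allFin (suc N)) (𝔖 N) _ ⟩
      ΣL (allFin (suc N)) _
        ≈⟨ ΣL-cong (allFin (suc N)) (λ j → trans
             (ΣL-cong (𝔖 N) (λ π → starts j (endsLarge m (oneLine (insert Fin.zero j π))) _))
             (ΣL-*ˡ (𝔖 N) _ _)) ⟩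
      ΣL (allFin (suc N)) (λ j → when (toℕ j <ᵇ m) 1# * from m j)
        ≈⟨ ΣL-from N m n e m<M (λ j → when (j <ᵇ m) 1#) (smallFirst M m n) (λ _ → 0#) small large ⟩
      Σ< m (smallFirst M m n) + Σ< n (λ _ → 0#)
        ≈⟨ trans (+-congˡ (Σ<-0 n)) (+-identityʳ _) ⟩
      Σ< m (smallFirst M m n)
        ≈⟨ Σ<-smallFirst M m n ⟩
      bothRuns M m n ∎
      where
      starts : ∀ (j : Fin (suc N)) b c →
        when ((toℕ j <ᵇ m) ∧ b) c ≈ when (toℕ j <ᵇ m) 1# * when b c
      starts j b c with toℕ j <ᵇ m
      ... | true  = sym (*-identityˡ _)
      ... | false = sym (zeroˡ _)
      small : ∀ j → j < m → when (j <ᵇ m) 1# * smallFirst M m n j ≈ smallFirst M m n j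
      small j j<m rewrite <ᵇ-true j<m = *-identityˡ _
      large : ∀ j → m ≤ j → when (j <ᵇ m) 1# * largeFirst M m n (j ∸ m) ≈ 0#
      large j m≤j rewrite <ᵇ-false m≤j = zeroˡ _

  ΣL-E : ∀ M m n → m < M →
    ΣL (filter (admissible? m n) (𝔖 (m ℕ.+ n))) (λ w → x ^ᴿ des w) ≈ bothRuns M m n
  ΣL-E M m n m<M = trans (ΣL-filter (admissible? m n) (𝔖 (m ℕ.+ n)) _)
    (ΣL-admissible M (m ℕ.+ n) m n ≡.refl m<M)

open import Data.Fin.Permutation using (_∘ₚ_; lift₀; transpose; remove)
import Data.Fin.Permutation.Components as PC
open import Data.List.Base using (deduplicate)
open import Data.List.Extrema.Nat using (argmin; argmin-all; f[argmin]≤f[xs])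
import Data.List.Membership.DecPropositional as DecMembership
open import Data.List.Membership.Propositional using (_∈_)
open import Data.List.Membership.Propositional.Properties
  using (∈-allFin; ∈-filter⁺; ∈-filter⁻; ∈-deduplicate⁺; ∈-deduplicate⁻)
open import Data.List.Membership.Propositional.Properties.WithK using (unique∧set⇒bag)
open import Data.List.Properties
  using (filter-≐; filter-accept; filter-reject; filter-all; filter-none;
         length-map; map-∘; map-cong; map-cong-local)
open import Data.List.Relation.Binary.BagAndSetEquality using (∼bag⇒↭)
import Data.List.Relation.Unary.All.Properties as Allₚ
open import Data.List.Relation.Unary.AllPairs using (AllPairs; []; _∷_)
open import Data.List.Relation.Unary.Any as Any using (Any; here; there; _─_)
import Data.List.Relation.Unary.Any.Properties as Anyₚ
open import Data.List.Relation.Unary.Unique.DecPropositional.Properties using (deduplicate-!)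
open import Data.List.Relation.Unary.Unique.Propositional using (Unique)
open import Data.List.Relation.Unary.Unique.Propositional.Properties as Uniqueₚ using (allFin⁺)
import Data.List.Relation.Unary.Unique.Setoid as UniqueS
import Data.List.Relation.Unary.Unique.Setoid.Properties as UniqueSₚ
open import Data.Nat.GeneralisedArithmetic using (iterate)
open import Data.Product.Base using (∃; _×_; proj₁; proj₂)
open import Defs using (𝔖-complete; 𝔖-unique; permSetoid; cycleOf; cycleReps; cycleType)
open import Function.Bundles using (mk⇔; Injection)
open import Function.Properties.Inverse using (↔⇒↣)
open import Relation.Binary.Bundles using (Setoid)
open import Relation.Binary.PropositionalEquality using (refl; sym; trans; cong; cong₂; subst)
open import Relation.Nullary.Decidable using (¬?; map′)

-- Permutations and their cycles

-- extend π j multiplies lift₀ π by the transposition of 0 and j: this puts 0 in front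
-- of j into the cycle of j, or leaves it alone if j = 0.
extend : ∀ {n} → Permutation′ n → Fin (suc n) → Permutation′ (suc n)
extend π j = lift₀ π ∘ₚ transpose Fin.zero j

-- The second enumeration of the symmetric group, under which cycle types change in a controlled
-- way.
extensions : ∀ n → List (Permutation′ (suc n))
extensions n = cartesianProductWith extend (𝔖 n) (allFin (suc n))

extend-injective : ∀ {n} {π ρ : Permutation′ n} {j k} →
                   extend π j Perm.≈ extend ρ k → π Perm.≈ ρ × j ≡ k
extend-injective {π = π} {ρ} {j} p with refl ← p Fin.zero =
  (λ i → Finₚ.suc-injective
    (Injection.injective (↔⇒↣ (transpose Fin.zero j)) (p (Fin.suc i)))) , refl

extensions-unique : ∀ n → UniqueS.Unique (permSetoid (suc n)) (extensions n)
extensions-unique n =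
  UniqueSₚ.cartesianProductWith⁺ (permSetoid n) (≡.setoid _) (permSetoid (suc n)) extend
    (λ {π} {ρ} → extend-injective {π = π} {ρ}) (𝔖-unique n) (allFin⁺ (suc n))

-- Following `π` by the transposition of 0 and `π 0` makes 0 a fixed point, which can be removed;
-- the same transposition undoes the change.
extend-surjective : ∀ {n} (π : Permutation′ (suc n)) →
  let j = π ⟨$⟩ʳ Fin.zero in
  extend (remove Fin.zero (π ∘ₚ transpose j Fin.zero)) j Perm.≈ π
extend-surjective π i = trans
  (cong (PC.transpose Fin.zero j) (Perm.lift₀-remove (π ∘ₚ transpose j Fin.zero) j↦0 i))
  (PC.transpose-inverse Fin.zero j)
  where
  j = π ⟨$⟩ʳ Fin.zero
  j↦0 : PC.transpose j Fin.zero j ≡ Fin.zero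
  j↦0 rewrite dec-true (j Finₚ.≟ j) refl = refl

extensions-complete : ∀ {n} (π : Permutation′ (suc n)) → Any (π Perm.≈_) (extensions n)
extensions-complete {n} π = Anyₚ.cartesianProductWith⁺ extend
  (λ { {ρ} q refl i → trans (sym (extend-surjective π i))
         (cong (PC.transpose Fin.zero (π ⟨$⟩ʳ Fin.zero)) (Perm.lift₀-cong _ ρ q i)) })
  (𝔖-complete (remove Fin.zero (π ∘ₚ transpose (π ⟨$⟩ʳ Fin.zero) Fin.zero)))
  (∈-allFin (π ⟨$⟩ʳ Fin.zero))

-- Comparing sums over two enumerations of a setoid

module Reordering (R : CommutativeSemiring 0ℓ 0ℓ) (S : Setoid 0ℓ 0ℓ) where

  private
    module R = CommutativeSemiring R
    module S = Setoid S
  open Setoid S using () renaming (Carrier to A; _≈_ to _≈ₛ_)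
  open Sums R
  open import Data.List.Membership.Setoid S using () renaming (_∈_ to _∈ₛ_)
  open import Relation.Binary.Reasoning.Setoid R.setoid

  private
    variable
      a b   : A
      as bs : List A

  ─-⊆ : (p : a ∈ₛ bs) → b ∈ₛ (bs ─ p) → b ∈ₛ bs
  ─-⊆ (here _)  q         = there q
  ─-⊆ (there p) (here q)  = here q
  ─-⊆ (there p) (there q) = there (─-⊆ p q)

  ∈-─ : (p : a ∈ₛ bs) → ¬ (a ≈ₛ b) → b ∈ₛ bs → b ∈ₛ (bs ─ p)
  ∈-─ (here a≈c) a≉b (here b≈c) = contradiction (S.trans a≈c (S.sym b≈c)) a≉b
  ∈-─ (here _)   a≉b (there q)  = q
  ∈-─ (there p)  a≉b (here b≈c) = here b≈c
  ∈-─ (there p)  a≉b (there q)  = there (∈-─ p a≉b q)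

  All-─ : ∀ {P : A → Set} (p : a ∈ₛ bs) → All P bs → All P (bs ─ p)
  All-─ (here _)  (_ ∷ qs) = qs
  All-─ (there p) (q ∷ qs) = q ∷ All-─ p qs

  unique-─ : (p : a ∈ₛ bs) → UniqueS.Unique S bs → UniqueS.Unique S (bs ─ p)
  unique-─ (here _)  (_ ∷ u)  = u
  unique-─ (there p) (qs ∷ u) = All-─ p qs ∷ unique-─ p u

  ∉-─ : (p : a ∈ₛ bs) → UniqueS.Unique S bs → ¬ (a ∈ₛ (bs ─ p))
  ∉-─ (here a≈c) (c≉bs ∷ u) q         = Allₚ.All¬⇒¬Any c≉bs (Any.map (S.trans (S.sym a≈c)) q)
  ∉-─ (there p)  (c≉bs ∷ u) (here a≈c) =
    Allₚ.All¬⇒¬Any c≉bs (Any.map (S.trans (S.sym a≈c)) p)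
  ∉-─ (there p)  (c≉bs ∷ u) (there q) = ∉-─ p u q

  module _ {f : A → R.Carrier} (f-cong : ∀ {a b} → a ≈ₛ b → f a R.≈ f b) where

    ΣL-─ : (p : a ∈ₛ bs) → ΣL bs f R.≈ f a R.+ ΣL (bs ─ p) f
    ΣL-─ (here a≈c)         = R.+-congʳ (R.sym (f-cong a≈c))
    ΣL-─ {a} {c ∷ bs} (there p) = begin
      f c R.+ ΣL bs f                    ≈⟨ R.+-congˡ (ΣL-─ p) ⟩
      f c R.+ (f a R.+ ΣL (bs ─ p) f)    ≈⟨ R.+-assoc _ _ _ ⟨
      f c R.+ f a R.+ ΣL (bs ─ p) f      ≈⟨ R.+-congʳ (R.+-comm _ _) ⟩
      f a R.+ f c R.+ ΣL (bs ─ p) f      ≈⟨ R.+-assoc _ _ _ ⟩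
      f a R.+ (f c R.+ ΣL (bs ─ p) f)    ∎

    -- The head of the first list is located in the second one and removed there; uniqueness keeps
    -- the remaining lists equal as sets. A setoid is needed because permutations are compared
    -- pointwise.
    ΣL-reorder : ∀ as bs → UniqueS.Unique S as → UniqueS.Unique S bs →
      (∀ {c} → c ∈ₛ as → c ∈ₛ bs) → (∀ {c} → c ∈ₛ bs → c ∈ₛ as) → ΣL as f R.≈ ΣL bs f
    ΣL-reorder []       []       u v as⊆bs bs⊆as = R.refl
    ΣL-reorder []       (b ∷ bs) u v as⊆bs bs⊆as with () ← bs⊆as (here S.refl)
    ΣL-reorder (a ∷ as) bs (a∉as ∷ u) v as⊆bs bs⊆as = R.trans
      (R.+-congˡ (ΣL-reorder as (bs ─ p) u (unique-─ p v) ⊆₁ ⊆₂)) (R.sym (ΣL-─ p))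
      where
      p = as⊆bs (here S.refl)
      ⊆₁ : ∀ {c} → c ∈ₛ as → c ∈ₛ (bs ─ p)
      ⊆₁ q = ∈-─ p (λ a≈c → Allₚ.All¬⇒¬Any a∉as (Any.map (S.trans a≈c) q)) (as⊆bs (there q))
      ⊆₂ : ∀ {c} → c ∈ₛ (bs ─ p) → c ∈ₛ as
      ⊆₂ q with bs⊆as (─-⊆ p q)
      ... | here c≈a = contradiction (Any.map (S.trans (S.sym c≈a)) q) (∉-─ p v)
      ... | there r  = r

-- Orbits of a permutation and their least elements

module Orbits {n} (π : Permutation′ n) where

  private
    f : Fin n → Fin n
    f = π ⟨$⟩ʳ_

  infix 4 _~_ _~?_
  _~_ : Fin n → Fin n → Set
  a ~ b = ∃ λ k → iterate f a k ≡ b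

  iterate-+ : ∀ a k l → iterate f a (k ℕ.+ l) ≡ iterate f (iterate f a k) l
  iterate-+ a zero    l = refl
  iterate-+ a (suc k) l = iterate-+ (f a) k l

  iterate-injective : ∀ k {a b} → iterate f a k ≡ iterate f b k → a ≡ b
  iterate-injective zero    p = p
  iterate-injective (suc k) p = Injection.injective (↔⇒↣ π) (iterate-injective k p)

  -- Two of the first `n + 1` iterates agree by the pigeonhole principle, and injectivity cancels
  -- their common initial part.
  period : ∀ a → ∃ λ p → p < n × iterate f a (suc p) ≡ a
  period a with Finₚ.pigeonhole (ℕₚ.n<1+n n) (λ k → iterate f a (toℕ k))
  ... | i , j , i<j , fⁱ≡fʲ with ℕₚ.m≤n⇒∃[o]m+o≡n i<j
  ... | p , 1+i+p≡j =
    p , ℕₚ.≤-trans (s≤s (ℕₚ.m≤n+m p (toℕ i))) (subst (_≤ n) (sym 1+i+p≡j) (ℕₚ.≤-pred (Finₚ.toℕ<n j)))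
      , iterate-injective (toℕ i) (begin
          iterate f (iterate f a (suc p)) (toℕ i) ≡⟨ iterate-+ a (suc p) (toℕ i) ⟨
          iterate f a (suc p ℕ.+ toℕ i)           ≡⟨ cong (iterate f a ∘ suc) (ℕₚ.+-comm p (toℕ i)) ⟩
          iterate f a (suc (toℕ i ℕ.+ p))         ≡⟨ cong (iterate f a) 1+i+p≡j ⟩
          iterate f a (toℕ j)                     ≡⟨ fⁱ≡fʲ ⟨
          iterate f a (toℕ i)                     ∎)
    where open ≡.≡-Reasoning

  ~-refl : ∀ {a} → a ~ a
  ~-refl = 0 , refl

  ~-trans : ∀ {a b c} → a ~ b → b ~ c → a ~ c
  ~-trans (k , refl) (l , refl) = k ℕ.+ l , iterate-+ _ k l

  ~-step : ∀ {a} → a ~ f a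
  ~-step = 1 , refl

  ~-sym : ∀ {a b} → a ~ b → b ~ a
  ~-sym {a} (k , refl) with period a
  -- Together with the `k` steps already made, `k * p` more steps complete `k` periods of length
  -- `suc p`.
  ... | p , _ , fᵖ≡id = k ℕ.* p , (begin
    iterate f (iterate f a k) (k ℕ.* p)  ≡⟨ iterate-+ a k (k ℕ.* p) ⟨
    iterate f a (k ℕ.+ k ℕ.* p)          ≡⟨ cong (iterate f a) (ℕₚ.*-suc k p) ⟨
    iterate f a (k ℕ.* suc p)            ≡⟨ periods k ⟩
    a                                    ∎)
    where
    open ≡.≡-Reasoning
    periods : ∀ k → iterate f a (k ℕ.* suc p) ≡ a
    periods zero    = refl
    periods (suc k) = trans (iterate-+ a (suc p) (k ℕ.* suc p))
      (trans (cong (λ b → iterate f b (k ℕ.* suc p)) fᵖ≡id) (periods k))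

  ~-bounded : ∀ {a b} → a ~ b → ∃ λ k → k < n × iterate f a k ≡ b
  ~-bounded {a} {b} (k , fᵏa≡b) = <-rec _ step k fᵏa≡b
    where
    Bounded : ℕ → Set
    Bounded k = iterate f a k ≡ b → ∃ λ k → k < n × iterate f a k ≡ b
    step : ∀ k → (∀ {j} → j < k → Bounded j) → Bounded k
    step k rec fᵏa≡b with k ℕₚ.<? n
    ... | yes k<n = k , k<n , fᵏa≡b
    ... | no  k≮n with period a
    ...   | p , p<n , fᵖ≡id with ℕₚ.m≤n⇒∃[o]m+o≡n (ℕₚ.≤-trans p<n (ℕₚ.≮⇒≥ k≮n))
    ...     | l , refl = rec (s≤s (ℕₚ.m≤n+m l p))
      (trans (cong (λ c → iterate f c l) (sym fᵖ≡id)) (trans (sym (iterate-+ a (suc p) l)) fᵏa≡b))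

  private
    ∈-iterate⁺ : ∀ {m} a k → k < m → iterate f a k ∈ List.iterate f a m
    ∈-iterate⁺ a zero    (s≤s _)   = here refl
    ∈-iterate⁺ a (suc k) (s≤s k<m) = there (∈-iterate⁺ (f a) k k<m)

    ∈-iterate⁻ : ∀ m {a b} → b ∈ List.iterate f a m → a ~ b
    ∈-iterate⁻ (suc m) (here refl) = ~-refl
    ∈-iterate⁻ (suc m) (there p)   = ~-trans ~-step (∈-iterate⁻ m p)

  ~⇒∈cycleOf : ∀ {a b} → a ~ b → b ∈ cycleOf π a
  ~⇒∈cycleOf a~b with k , k<n , refl ← ~-bounded a~b =
    ∈-deduplicate⁺ Finₚ._≟_ (∈-iterate⁺ _ k k<n)

  ∈cycleOf⇒~ : ∀ {a b} → b ∈ cycleOf π a → a ~ b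
  ∈cycleOf⇒~ p = ∈-iterate⁻ n (∈-deduplicate⁻ Finₚ._≟_ _ p)

  _~?_ : ∀ a b → Dec (a ~ b)
  a ~? b = map′ ∈cycleOf⇒~ ~⇒∈cycleOf (DecMembership._∈?_ Finₚ._≟_ b (cycleOf π a))

  cycleLength : Fin n → ℕ
  cycleLength a = length (cycleOf π a)

  -- The count depends on the orbit relation alone, so lengths can be compared for different
  -- starting points and for different permutations. Both lists are free of duplicates and have the
  -- same members.
  cycleLength-count : ∀ a → cycleLength a ≡ length (filter (a ~?_) (allFin n))
  cycleLength-count a = ↭-length (∼bag⇒↭ (unique∧set⇒bag
    (deduplicate-! Finₚ._≟_ _) (Uniqueₚ.filter⁺ (a ~?_) (allFin⁺ n))
    (mk⇔ (λ p → ∈-filter⁺ (a ~?_) (∈-allFin _) (∈cycleOf⇒~ p))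
         (λ p → ~⇒∈cycleOf (proj₂ (∈-filter⁻ (a ~?_) {xs = allFin n} p))))))

  ~⇒cycleLength : ∀ {a b} → a ~ b → cycleLength a ≡ cycleLength b
  ~⇒cycleLength {a} {b} a~b = trans (cycleLength-count a) (trans
    (cong length (filter-≐ (a ~?_) (b ~?_) (~-trans (~-sym a~b) , ~-trans a~b) (allFin n)))
    (sym (cycleLength-count b)))

  Least : Fin n → Set
  Least a = ∀ {b} → a ~ b → a Fin.≤ b

  least? : ∀ a → Dec (Least a)
  least? a = map′ (λ all a~b → All.lookup all (~⇒∈cycleOf a~b))
                  (λ a≤ → All.tabulate (λ p → a≤ (∈cycleOf⇒~ p)))
                  (All.all? (a Finₚ.≤?_) (cycleOf π a))

  cycleReps-least : cycleReps π ≡ filter least? (allFin n)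
  cycleReps-least = filter-≐ (λ a → All.all? (a Finₚ.≤?_) (cycleOf π a)) least?
    ((λ all a~b → All.lookup all (~⇒∈cycleOf a~b)) ,
     (λ a≤ → All.tabulate (λ p → a≤ (∈cycleOf⇒~ p)))) (allFin n)

  ∈cycleReps⁻ : ∀ {a} → a ∈ cycleReps π → Least a
  ∈cycleReps⁻ p = proj₂ (∈-filter⁻ least? {xs = allFin n} (subst (_ ∈_) cycleReps-least p))

  representative : ∀ a → ∃ λ r → r ∈ cycleReps π × r ~ a
  representative a = r , subst (r ∈_) (sym cycleReps-least) (∈-filter⁺ least? (∈-allFin r) r-least)
                       , ~-sym a~r
    where
    r = argmin toℕ a (cycleOf π a)
    a~r : a ~ r
    a~r = argmin-all toℕ {P = a ~_} ~-refl (All.tabulate ∈cycleOf⇒~)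
    r-least : Least r
    r-least r~b = All.lookup (f[argmin]≤f[xs] {f = toℕ} a (cycleOf π a)) (~⇒∈cycleOf (~-trans a~r r~b))

  cycleReps-inequivalent : AllPairs (λ a b → ¬ (a ~ b)) (cycleReps π)
  cycleReps-inequivalent = separate (cycleReps π)
    (Uniqueₚ.filter⁺ _ (allFin⁺ n)) (All.tabulate ∈cycleReps⁻)
    where
    separate : ∀ as → Unique as → All Least as → AllPairs (λ a b → ¬ (a ~ b)) as
    separate []       []       []       = []
    separate (a ∷ as) (a∉as ∷ u) (a≤ ∷ ls) = All.zipWith
      (λ (a≢b , b≤) a~b → a≢b (Finₚ.≤-antisym (a≤ a~b) (b≤ (~-sym a~b)))) (a∉as , ls)
      ∷ separate as u ls

module _ {A : Set} where

  filter-map : ∀ {B : Set} {P : A → Set} (P? : Decidable P) (h : B → A) bs →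
               filter P? (map h bs) ≡ map h (filter (P? ∘ h) bs)
  filter-map P? h []       = refl
  filter-map P? h (b ∷ bs) with does (P? (h b))
  ... | true  = cong (h b ∷_) (filter-map P? h bs)
  ... | false = filter-map P? h bs

  filter-filter : ∀ {P Q S : A → Set} (P? : Decidable P) (Q? : Decidable Q) (S? : Decidable S) →
                  (∀ {a} → S a → P a × Q a) → (∀ {a} → P a → Q a → S a) →
                  ∀ as → filter S? as ≡ filter P? (filter Q? as)
  filter-filter P? Q? S? to from []       = refl
  filter-filter P? Q? S? to from (a ∷ as) with Q? a
  ... | no ¬q = trans (filter-reject S? (¬q ∘ proj₂ ∘ to)) (filter-filter P? Q? S? to from as)
  ... | yes q with P? a
  ...   | yes p = trans (filter-accept S? (from p q)) (cong (a ∷_) (filter-filter P? Q? S? to from as))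
  ...   | no ¬p = trans (filter-reject S? (¬p ∘ proj₁ ∘ to)) (filter-filter P? Q? S? to from as)

allFin-suc : ∀ n → allFin (suc n) ≡ Fin.zero ∷ map Fin.suc (allFin n)
allFin-suc n = cong (Fin.zero ∷_) (sym (map-tabulate id Fin.suc))

-- π′ arises from π by putting 0 into the cycle of the elements satisfying P, which may be
-- none.
module JoinCycle {n} (π : Permutation′ n) (π′ : Permutation′ (suc n))
  {P : Fin n → Set} (P? : Decidable P)
  (suc~⁻ : ∀ {a b} → Orbits._~_ π′ (Fin.suc a) (Fin.suc b) → Orbits._~_ π a b)
  (suc~⁺ : ∀ {a b} → Orbits._~_ π a b → Orbits._~_ π′ (Fin.suc a) (Fin.suc b))
  (zero~⁻ : ∀ {b} → Orbits._~_ π′ Fin.zero (Fin.suc b) → P b)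
  (zero~⁺ : ∀ {b} → P b → Orbits._~_ π′ Fin.zero (Fin.suc b))
  where

  open Orbits

  private
    ~-sym′ = Orbits.~-sym π′
    _~?′_  = Orbits._~?_ π′
    rest   = filter (¬? ∘ P?) (cycleReps π)

  cycleLength-zero : cycleLength π′ Fin.zero ≡ suc (length (filter P? (allFin n)))
  cycleLength-zero = begin
    cycleLength π′ Fin.zero
      ≡⟨ cycleLength-count π′ Fin.zero ⟩
    length (filter (Fin.zero ~?′_) (allFin (suc n)))
      ≡⟨ cong (length ∘ filter (Fin.zero ~?′_)) (allFin-suc n) ⟩
    length (filter (Fin.zero ~?′_) (Fin.zero ∷ map Fin.suc (allFin n)))
      ≡⟨ cong length (filter-accept (Fin.zero ~?′_) {xs = map Fin.suc (allFin n)} (~-refl π′)) ⟩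
    suc (length (filter (Fin.zero ~?′_) (map Fin.suc (allFin n))))
      ≡⟨ cong (suc ∘ length) (filter-map (Fin.zero ~?′_) Fin.suc (allFin n)) ⟩
    suc (length (map Fin.suc (filter (λ b → Fin.zero ~?′ Fin.suc b) (allFin n))))
      ≡⟨ cong suc (length-map Fin.suc (filter (λ b → Fin.zero ~?′ Fin.suc b) (allFin n))) ⟩
    suc (length (filter (λ b → Fin.zero ~?′ Fin.suc b) (allFin n)))
      ≡⟨ cong (suc ∘ length) (filter-≐ _ P? (zero~⁻ , zero~⁺) (allFin n)) ⟩
    suc (length (filter P? (allFin n))) ∎
    where open ≡.≡-Reasoning

  cycleLength-suc : ∀ a → ¬ P a → cycleLength π′ (Fin.suc a) ≡ cycleLength π a
  cycleLength-suc a ¬Pa = begin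
    cycleLength π′ (Fin.suc a)
      ≡⟨ cycleLength-count π′ (Fin.suc a) ⟩
    length (filter (Fin.suc a ~?′_) (allFin (suc n)))
      ≡⟨ cong (length ∘ filter (Fin.suc a ~?′_)) (allFin-suc n) ⟩
    length (filter (Fin.suc a ~?′_) (Fin.zero ∷ map Fin.suc (allFin n)))
      ≡⟨ cong length (filter-reject (Fin.suc a ~?′_) {xs = map Fin.suc (allFin n)}
           (¬Pa ∘ zero~⁻ ∘ ~-sym′)) ⟩
    length (filter (Fin.suc a ~?′_) (map Fin.suc (allFin n)))
      ≡⟨ cong length (filter-map (Fin.suc a ~?′_) Fin.suc (allFin n)) ⟩
    length (map Fin.suc (filter (λ b → Fin.suc a ~?′ Fin.suc b) (allFin n)))
      ≡⟨ length-map Fin.suc (filter (λ b → Fin.suc a ~?′ Fin.suc b) (allFin n)) ⟩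
    length (filter (λ b → Fin.suc a ~?′ Fin.suc b) (allFin n))
      ≡⟨ cong length (filter-≐ _ (Orbits._~?_ π a) (suc~⁻ , suc~⁺) (allFin n)) ⟩
    length (filter (Orbits._~?_ π a) (allFin n))
      ≡⟨ cycleLength-count π a ⟨
    cycleLength π a ∎
    where open ≡.≡-Reasoning

  -- 0 is the least element of its cycle, so it replaces the representative of the cycle that it
  -- joins; `suc` preserves the order, so the other representatives remain.
  cycleReps-join : cycleReps π′ ≡ Fin.zero ∷ map Fin.suc rest
  cycleReps-join = begin
    cycleReps π′
      ≡⟨ cycleReps-least π′ ⟩
    filter (least? π′) (allFin (suc n))
      ≡⟨ cong (filter (least? π′)) (allFin-suc n) ⟩
    filter (least? π′) (Fin.zero ∷ map Fin.suc (allFin n))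
      ≡⟨ filter-accept (least? π′) {xs = map Fin.suc (allFin n)} (λ _ → z≤n) ⟩
    Fin.zero ∷ filter (least? π′) (map Fin.suc (allFin n))
      ≡⟨ cong (Fin.zero ∷_) (filter-map (least? π′) Fin.suc (allFin n)) ⟩
    Fin.zero ∷ map Fin.suc (filter (least? π′ ∘ Fin.suc) (allFin n))
      ≡⟨ cong (λ as → Fin.zero ∷ map Fin.suc as)
           (filter-filter (¬? ∘ P?) (least? π) (least? π′ ∘ Fin.suc) to from (allFin n)) ⟩
    Fin.zero ∷ map Fin.suc (filter (¬? ∘ P?) (filter (least? π) (allFin n)))
      ≡⟨ cong (λ as → Fin.zero ∷ map Fin.suc (filter (¬? ∘ P?) as)) (cycleReps-least π) ⟨
    Fin.zero ∷ map Fin.suc rest ∎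
    where
    open ≡.≡-Reasoning
    to : ∀ {a} → Least π′ (Fin.suc a) → ¬ P a × Least π a
    to a≤ = (λ Pa → contradiction (a≤ (~-sym′ (zero~⁺ Pa))) λ ()) ,
            (λ a~b → ℕₚ.≤-pred (a≤ (suc~⁺ a~b)))
    from : ∀ {a} → ¬ P a → Least π a → Least π′ (Fin.suc a)
    from ¬Pa a≤ {Fin.zero}  a~0 = contradiction (zero~⁻ (~-sym′ a~0)) ¬Pa
    from ¬Pa a≤ {Fin.suc b} a~b = s≤s (a≤ (suc~⁻ a~b))

  cycleType-join : cycleType π′ ≡ suc (length (filter P? (allFin n))) ∷ map (cycleLength π) rest
  cycleType-join = begin
    map (cycleLength π′) (cycleReps π′)
      ≡⟨ cong (map (cycleLength π′)) cycleReps-join ⟩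
    cycleLength π′ Fin.zero ∷ map (cycleLength π′) (map Fin.suc rest)
      ≡⟨ cong₂ _∷_ cycleLength-zero (trans (sym (map-∘ rest))
           (map-cong-local (All.map (cycleLength-suc _) (Allₚ.all-filter (¬? ∘ P?) (cycleReps π))))) ⟩
    suc (length (filter P? (allFin n))) ∷ map (cycleLength π) rest ∎
    where open ≡.≡-Reasoning

module _ {n} (π : Permutation′ n) where

  open Orbits

  private
    π₀ = extend π Fin.zero
    πₛ = λ i → extend π (Fin.suc i)

    extend-zero-iterate : ∀ k → iterate (π₀ ⟨$⟩ʳ_) Fin.zero k ≡ Fin.zero
    extend-zero-iterate zero    = refl
    extend-zero-iterate (suc k) = extend-zero-iterate k

    extend-zero-iterate-suc : ∀ k a →
      iterate (π₀ ⟨$⟩ʳ_) (Fin.suc a) k ≡ Fin.suc (iterate (π ⟨$⟩ʳ_) a k)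
    extend-zero-iterate-suc zero    a = refl
    extend-zero-iterate-suc (suc k) a = extend-zero-iterate-suc k (π ⟨$⟩ʳ a)

  cycleType-extend-zero : cycleType (extend π Fin.zero) ≡ 1 ∷ cycleType π
  cycleType-extend-zero = trans
    -- 0 becomes a fixed point: it joins no element, and `P` is the empty predicate.
    (JoinCycle.cycleType-join π π₀ (λ _ → no id)
      (λ { {a} (k , p) → k , Finₚ.suc-injective (trans (sym (extend-zero-iterate-suc k a)) p) })
      (λ { {a} (k , p) → k , trans (extend-zero-iterate-suc k a) (cong Fin.suc p) })
      (λ { (k , p) → contradiction (trans (sym (extend-zero-iterate k)) p) λ () })
      λ ())
    (cong₂ (λ as bs → suc (length as) ∷ map (cycleLength π) bs)
      (filter-none (λ _ → no id) (All.tabulate {xs = allFin n} (λ _ → id)))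
      (filter-all (λ _ → ¬? (no id)) (All.tabulate {xs = cycleReps π} (λ _ → id))))
    where open import Data.List.Properties using (filter-none)

  module _ (i : Fin n) where

    private
      -- Contracts 0 onto `i`. A step out of 0 then becomes no step at all, and a step into 0
      -- becomes the step of `π` into `i`.
      project : Fin (suc n) → Fin n
      project Fin.zero    = i
      project (Fin.suc a) = a

      project-step : ∀ y → _~_ π (project y) (project (πₛ i ⟨$⟩ʳ y))
      project-step Fin.zero    = ~-refl π
      project-step (Fin.suc a) with π ⟨$⟩ʳ a Finₚ.≟ i
      ... | yes πa≡i = 1 , πa≡i
      ... | no  _    = 1 , refl

      project-~ : ∀ {y z} → _~_ (πₛ i) y z → _~_ π (project y) (project z)
      project-~ (zero  , refl) = ~-refl π
      project-~ {y} (suc k , p) = ~-trans π (project-step y) (project-~ {πₛ i ⟨$⟩ʳ y} (k , p))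

      suc-step : ∀ a → _~_ (πₛ i) (Fin.suc a) (Fin.suc (π ⟨$⟩ʳ a))
      suc-step a with π ⟨$⟩ʳ a Finₚ.≟ i in eq
      -- The predecessor of `i` now reaches it by way of 0.
      ... | yes refl = 2 , cong (πₛ i ⟨$⟩ʳ_) step
        where
        step : πₛ i ⟨$⟩ʳ Fin.suc a ≡ Fin.zero
        step rewrite eq = refl
      ... | no  _    = 1 , step
        where
        step : πₛ i ⟨$⟩ʳ Fin.suc a ≡ Fin.suc (π ⟨$⟩ʳ a)
        step rewrite eq = refl

      suc-~ : ∀ {a b} → _~_ π a b → _~_ (πₛ i) (Fin.suc a) (Fin.suc b)
      suc-~ (zero  , refl) = ~-refl (πₛ i)
      suc-~ (suc k , p)    = ~-trans (πₛ i) (suc-step _) (suc-~ (k , p))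

    cycleType-extend-suc : cycleType (extend π (Fin.suc i))
      ≡ suc (cycleLength π i)
        ∷ map (cycleLength π) (filter (λ r → ¬? (_~?_ π i r)) (cycleReps π))
    cycleType-extend-suc = trans
      (JoinCycle.cycleType-join π (πₛ i) (_~?_ π i) project-~ suc-~ project-~
        (λ i~b → ~-trans (πₛ i) (~-step (πₛ i)) (suc-~ i~b)))
      (cong (λ l → suc l ∷ map (cycleLength π) (filter (λ r → ¬? (_~?_ π i r)) (cycleReps π)))
        (sym (cycleLength-count π i)))

cycleType-cong : ∀ {n} {π ρ : Permutation′ n} → π Perm.≈ ρ → cycleType π ≡ cycleType ρ
cycleType-cong {n} {π} {ρ} π≈ρ = begin
  map (length ∘ cycleOf π) (cycleReps π)
    ≡⟨ map-cong (λ a → cong length (cycleOf-cong a)) (cycleReps π) ⟩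
  map (length ∘ cycleOf ρ) (cycleReps π)
    ≡⟨ cong (map (length ∘ cycleOf ρ)) (filter-≐ _ _
         ((λ {a} → subst (All (a Fin.≤_)) (cycleOf-cong a)) ,
          (λ {a} → subst (All (a Fin.≤_)) (sym (cycleOf-cong a)))) (allFin n)) ⟩
  map (length ∘ cycleOf ρ) (cycleReps ρ) ∎
  where
  open ≡.≡-Reasoning
  iterate-cong : ∀ k a → List.iterate (π ⟨$⟩ʳ_) a k ≡ List.iterate (ρ ⟨$⟩ʳ_) a k
  iterate-cong zero    a = refl
  iterate-cong (suc k) a = cong (a ∷_)
    (trans (cong (λ b → List.iterate (π ⟨$⟩ʳ_) b k) (π≈ρ a)) (iterate-cong k (ρ ⟨$⟩ʳ a)))
  cycleOf-cong : ∀ a → cycleOf π a ≡ cycleOf ρ a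
  cycleOf-cong a = cong (deduplicate Finₚ._≟_) (iterate-cong n a)

-- Sums over permutations by cycle type

module CycleTypeSum (R : CommutativeSemiring 0ℓ 0ℓ) where

  open CommutativeSemiring R hiding (zero)
    renaming (refl to ≈-refl; sym to ≈-sym; trans to ≈-trans; reflexive to ≈-reflexive)
  open import Relation.Binary.Reasoning.Setoid setoid
  open Sums R
  open CycleTypes R

  module _ {n} (π : Permutation′ n) where

    open Orbits π

    others : Fin n → List (Fin n) → List ℕ
    others i as = map cycleLength (filter (λ r → ¬? (i ~? r)) as)

    ΣL-representative : ∀ {as a} {g : Fin n → Carrier} → AllPairs (λ a b → ¬ (a ~ b)) as →
      (∀ {a b} → a ~ b → g a ≈ g b) → ∀ {r} → r ∈ as → r ~ a →
      ΣL as (λ r → when (does (r ~? a)) (g r)) ≈ g a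
    ΣL-representative {r ∷ as} {a} {g} (r≁as ∷ _) g-cong (here refl) r~a = begin
      when (does (r ~? a)) (g r) + ΣL as (λ r → when (does (r ~? a)) (g r))
        ≈⟨ +-cong (≈-trans (when-cong (dec-true (r ~? a) r~a) ≈-refl) (g-cong r~a))
             (ΣL-cong-local (All.map (λ {s} r≁s → when-cong
               (dec-false (s ~? a) (λ s~a → r≁s (~-trans r~a (~-sym s~a)))) ≈-refl) r≁as)) ⟩
      g a + ΣL as (λ _ → 0#)
        ≈⟨ ≈-trans (+-congˡ (ΣL-0 as)) (+-identityʳ _) ⟩
      g a ∎
    ΣL-representative {s ∷ as} {a} {g} (s≁as ∷ u) g-cong (there p) r~a = ≈-trans
      (+-cong (when-cong (dec-false (s ~? a) (λ s~a →
        All.lookup s≁as p (~-trans s~a (~-sym r~a)))) ≈-refl)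
        (ΣL-representative u g-cong p r~a))
      (+-identityˡ _)

    -- Double counting of the pairs of an element and an equivalent representative: each element has
    -- exactly one, and each representative has as many as its cycle is long.
    ΣL-classes : ∀ (g : Fin n → Carrier) → (∀ {a b} → a ~ b → g a ≈ g b) →
      ΣL (allFin n) g ≈ ΣL (cycleReps π) (λ r → ⌜ cycleLength r ⌝ * g r)
    ΣL-classes g g-cong = begin
      ΣL (allFin n) g
        ≈⟨ ΣL-cong (allFin n) (λ a → let r , r∈reps , r~a = representative a in
             ΣL-representative cycleReps-inequivalent g-cong r∈reps r~a) ⟨
      ΣL (allFin n) (λ a → ΣL (cycleReps π) (λ r → when (does (r ~? a)) (g r)))
        ≈⟨ ΣL-ΣL (allFin n) (cycleReps π) (λ a r → when (does (r ~? a)) (g r)) ⟩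
      ΣL (cycleReps π) (λ r → ΣL (allFin n) (λ a → when (does (r ~? a)) (g r)))
        ≈⟨ ΣL-cong (cycleReps π) (λ r → ≈-trans (ΣL-when-length (r ~?_) (allFin n) (g r))
             (*-congʳ (≈-reflexive (cong ⌜_⌝ (sym (cycleLength-count r)))))) ⟩
      ΣL (cycleReps π) (λ r → ⌜ cycleLength r ⌝ * g r) ∎

    -- The left side puts the enlarged cycle in front, whereas `grow` enlarges it in place.
    -- Induction peels off the first cycle, which symmetry lets pass the enlarged one.
    grow-representatives : ∀ Φ → Symmetric Φ → ∀ as → AllPairs (λ a b → ¬ (a ~ b)) as →
      Φ (1 ∷ map cycleLength as)
        + ΣL as (λ r → ⌜ cycleLength r ⌝ * Φ (suc (cycleLength r) ∷ others r as))
      ≈ grow Φ (map cycleLength as)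
    grow-representatives Φ Φ-sym []       []         = +-identityʳ _
    grow-representatives Φ Φ-sym (a ∷ as) (a≁as ∷ u) = begin
      Φ (1 ∷ l ∷ ls) + (⌜ l ⌝ * Φ (suc l ∷ others a (a ∷ as))
        + ΣL as (λ r → ⌜ cycleLength r ⌝ * Φ (suc (cycleLength r) ∷ others r (a ∷ as))))
        ≈⟨ +-cong (Φ-sym (↭.swap 1 l ↭-refl)) (+-cong
             (*-congˡ (≈-reflexive (cong (λ bs → Φ (suc l ∷ map cycleLength bs)) drop-a)))
             (ΣL-cong-local (All.map (λ {r} a≁r → *-congˡ (≈-trans
               (≈-reflexive (cong (λ bs → Φ (suc (cycleLength r) ∷ map cycleLength bs))
                 (keep-a a≁r)))
               (Φ-sym (↭.swap _ _ ↭-refl)))) a≁as))) ⟩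
      Φ (l ∷ 1 ∷ ls) + (⌜ l ⌝ * Φ (suc l ∷ ls)
        + ΣL as (λ r → ⌜ cycleLength r ⌝ * Φ (l ∷ suc (cycleLength r) ∷ others r as)))
        ≈⟨ ≈-trans (≈-sym (+-assoc _ _ _)) (≈-trans (+-congʳ (+-comm _ _)) (+-assoc _ _ _)) ⟩
      ⌜ l ⌝ * Φ (suc l ∷ ls) + (Φ (l ∷ 1 ∷ ls)
        + ΣL as (λ r → ⌜ cycleLength r ⌝ * Φ (l ∷ suc (cycleLength r) ∷ others r as)))
        ≈⟨ +-congˡ (grow-representatives (Φ ∘ (l ∷_)) (Φ-sym ∘ ↭.prep l) as u) ⟩
      ⌜ l ⌝ * Φ (suc l ∷ ls) + grow (Φ ∘ (l ∷_)) ls ∎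
      where
      l  = cycleLength a
      ls = map cycleLength as
      drop-a : filter (λ r → ¬? (a ~? r)) (a ∷ as) ≡ as
      drop-a = trans (filter-reject (λ r → ¬? (a ~? r)) {xs = as} (λ a≁a → a≁a ~-refl))
        (filter-all (λ r → ¬? (a ~? r)) a≁as)
      keep-a : ∀ {r} → ¬ (a ~ r) →
               filter (λ s → ¬? (r ~? s)) (a ∷ as) ≡ a ∷ filter (λ s → ¬? (r ~? s)) as
      keep-a {r} a≁r = filter-accept (λ s → ¬? (r ~? s)) {xs = as} (a≁r ∘ ~-sym)

    -- The cycle type of the extension at `suc i` depends only on the cycle of `i`; so a cycle of
    -- length `b` accounts for the multiplicity `⌜ b ⌝` in `grow`.
    ΣL-extend : ∀ Φ → Symmetric Φ →
      ΣL (allFin (suc n)) (λ j → Φ (cycleType (extend π j))) ≈ grow Φ (cycleType π)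
    ΣL-extend Φ Φ-sym = begin
      ΣL (allFin (suc n)) (λ j → Φ (cycleType (extend π j)))
        ≈⟨ ≈-reflexive (cong (λ js → ΣL js (λ j → Φ (cycleType (extend π j)))) (allFin-suc n)) ⟩
      Φ (cycleType (extend π Fin.zero))
        + ΣL (map Fin.suc (allFin n)) (λ j → Φ (cycleType (extend π j)))
        ≈⟨ +-cong (≈-reflexive (cong Φ (cycleType-extend-zero π)))
             (≈-trans (ΣL-map Fin.suc (allFin n) _)
               (ΣL-cong (allFin n) (λ i → ≈-reflexive (cong Φ (cycleType-extend-suc π i))))) ⟩
      Φ (1 ∷ cycleType π) + ΣL (allFin n) (λ i → Φ (suc (cycleLength i) ∷ others i (cycleReps π)))
        ≈⟨ +-congˡ (ΣL-classes _ (λ {i} {j} i~j → ≈-reflexive (cong₂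
             (λ l bs → Φ (suc l ∷ map cycleLength bs))
             (~⇒cycleLength i~j) (filter-≐ _ _
               ((λ i≁r j~r → i≁r (~-trans i~j j~r)) , (λ j≁r i~r → j≁r (~-trans (~-sym i~j) i~r)))
               (cycleReps π))))) ⟩
      Φ (1 ∷ cycleType π)
        + ΣL (cycleReps π) (λ r → ⌜ cycleLength r ⌝
                                  * Φ (suc (cycleLength r) ∷ others r (cycleReps π)))
        ≈⟨ grow-representatives Φ Φ-sym (cycleReps π) cycleReps-inequivalent ⟩
      grow Φ (cycleType π) ∎

  ΣL-cycleType : ∀ n Φ → Symmetric Φ → ΣL (𝔖 n) (Φ ∘ cycleType) ≈ grow^ n Φ []
  ΣL-cycleType zero    Φ Φ-sym = +-identityʳ _
  ΣL-cycleType (suc n) Φ Φ-sym = begin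
    ΣL (𝔖 (suc n)) (Φ ∘ cycleType)
      ≈⟨ Reordering.ΣL-reorder R (permSetoid (suc n))
           (λ {π} {ρ} π≈ρ → ≈-reflexive (cong Φ (cycleType-cong {π = π} {ρ} π≈ρ)))
           (𝔖 (suc n)) (extensions n) (𝔖-unique (suc n)) (extensions-unique n)
           (λ {π} _ → extensions-complete π) (λ {π} _ → 𝔖-complete π) ⟩
    ΣL (extensions n) (Φ ∘ cycleType)
      ≈⟨ ΣL-cartesianProductWith extend (𝔖 n) (allFin (suc n)) (Φ ∘ cycleType) ⟩
    ΣL (𝔖 n) (λ π → ΣL (allFin (suc n)) (λ j → Φ (cycleType (extend π j))))
      ≈⟨ ΣL-cong (𝔖 n) (λ π → ΣL-extend π Φ Φ-sym) ⟩
    ΣL (𝔖 n) (grow Φ ∘ cycleType)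
      ≈⟨ ΣL-cycleType n (grow Φ) (grow-symmetric Φ-sym) ⟩
    grow^ n (grow Φ) [] ∎

open import Defs
open import Data.Integer.Base as ℤ using (+_)
import Data.Integer.Properties as ℤₚ
open import Data.List.Base using (applyUpTo)
open import Data.List.Properties using (length-filter; length-tabulate)
open import Data.Nat.Base using (_^_)
open import Data.Nat.Combinatorics using (_C_; nCk+nC[k+1]≡[n+1]C[k+1]; k>n⇒nCk≡0; nC1≡n)
open import Data.Nat.Solver using (module +-*-Solver)
open import Data.Rational.Base as ℚ using (ℚ; 0ℚ; 1ℚ)
import Data.Rational.Properties as ℚₚ
open import Data.Rational.Unnormalised.Base as ℚᵘ using (mkℚᵘ)
import Data.Rational.Unnormalised.Properties as ℚᵘₚ
open import Relation.Binary.Structures using (IsEquivalence)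

-- The semiring of polynomials

-- A record, so that the two polynomials can be inferred from a proof.
infix 4 _≋_
record _≋_ (p q : Poly) : Set where
  constructor pointwise
  field at : p ≈ q
open _≋_

private
  variable
    p q r s : Poly

≋-isEquivalence : IsEquivalence _≋_
≋-isEquivalence = record
  { refl  = pointwise λ _ → refl
  ; sym   = λ e → pointwise λ i → sym (at e i)
  ; trans = λ e f → pointwise λ i → trans (at e i) (at f i)
  }

open IsEquivalence ≋-isEquivalence
  renaming (refl to ≋-refl; sym to ≋-sym; trans to ≋-trans) using ()

coeff-⊕ : ∀ p q i → coeff (p ⊕ q) i ≡ coeff p i ℚ.+ coeff q i
coeff-⊕ []      q       i       = sym (ℚₚ.+-identityˡ _)
coeff-⊕ (a ∷ p) []      i       = sym (ℚₚ.+-identityʳ _)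
coeff-⊕ (a ∷ p) (b ∷ q) zero    = refl
coeff-⊕ (a ∷ p) (b ∷ q) (suc i) = coeff-⊕ p q i

coeff-· : ∀ c p i → coeff (c · p) i ≡ c ℚ.* coeff p i
coeff-· c []      i       = sym (ℚₚ.*-zeroʳ c)
coeff-· c (a ∷ p) zero    = refl
coeff-· c (a ∷ p) (suc i) = coeff-· c p i

∷-cong : ∀ {a b} → a ≡ b → p ≋ q → a ∷ p ≋ b ∷ q
∷-cong e f = pointwise λ { zero → e ; (suc i) → at f i }

0∷[] : 0ℚ ∷ [] ≋ []
0∷[] = pointwise λ { zero → refl ; (suc i) → refl }

⊕-cong : p ≋ q → r ≋ s → p ⊕ r ≋ q ⊕ s
⊕-cong {p} {q} {r} {s} e f = pointwise λ i →
  trans (coeff-⊕ p r i) (trans (cong₂ ℚ._+_ (at e i) (at f i)) (sym (coeff-⊕ q s i)))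

⊕-comm : ∀ p q → p ⊕ q ≋ q ⊕ p
⊕-comm p q = pointwise λ i →
  trans (coeff-⊕ p q i) (trans (ℚₚ.+-comm (coeff p i) _) (sym (coeff-⊕ q p i)))

⊕-assoc : ∀ p q r → (p ⊕ q) ⊕ r ≋ p ⊕ (q ⊕ r)
⊕-assoc p q r = pointwise λ i → begin
  coeff ((p ⊕ q) ⊕ r) i                   ≡⟨ coeff-⊕ (p ⊕ q) r i ⟩
  coeff (p ⊕ q) i ℚ.+ coeff r i           ≡⟨ cong (ℚ._+ coeff r i) (coeff-⊕ p q i) ⟩
  coeff p i ℚ.+ coeff q i ℚ.+ coeff r i   ≡⟨ ℚₚ.+-assoc (coeff p i) _ _ ⟩
  coeff p i ℚ.+ (coeff q i ℚ.+ coeff r i) ≡⟨ cong (coeff p i ℚ.+_) (coeff-⊕ q r i) ⟨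
  coeff p i ℚ.+ coeff (q ⊕ r) i           ≡⟨ coeff-⊕ p (q ⊕ r) i ⟨
  coeff (p ⊕ (q ⊕ r)) i                   ∎
  where open ≡.≡-Reasoning

⊕-identityʳ : ∀ p → p ⊕ [] ≋ p
⊕-identityʳ p = ⊕-comm p []

⊕-interchange : ∀ p q r s → (p ⊕ q) ⊕ (r ⊕ s) ≋ (p ⊕ r) ⊕ (q ⊕ s)
⊕-interchange p q r s =
  ≋-trans (⊕-assoc p q (r ⊕ s)) (≋-trans (⊕-cong (≋-refl {p}) (≋-trans (≋-sym (⊕-assoc q r s))
    (≋-trans (⊕-cong (⊕-comm q r) (≋-refl {s})) (⊕-assoc r q s)))) (≋-sym (⊕-assoc p r (q ⊕ s))))

·-congˡ : ∀ c → p ≋ q → c · p ≋ c · q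
·-congˡ {p} {q} c e = pointwise λ i →
  trans (coeff-· c p i) (trans (cong (c ℚ.*_) (at e i)) (sym (coeff-· c q i)))

·-distribˡ : ∀ c p q → c · (p ⊕ q) ≋ c · p ⊕ c · q
·-distribˡ c p q = pointwise λ i → begin
  coeff (c · (p ⊕ q)) i                         ≡⟨ coeff-· c (p ⊕ q) i ⟩
  c ℚ.* coeff (p ⊕ q) i                         ≡⟨ cong (c ℚ.*_) (coeff-⊕ p q i) ⟩
  c ℚ.* (coeff p i ℚ.+ coeff q i)               ≡⟨ ℚₚ.*-distribˡ-+ c _ _ ⟩
  c ℚ.* coeff p i ℚ.+ c ℚ.* coeff q i           ≡⟨ cong₂ ℚ._+_ (coeff-· c p i) (coeff-· c q i) ⟨
  coeff (c · p) i ℚ.+ coeff (c · q) i           ≡⟨ coeff-⊕ (c · p) (c · q) i ⟨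
  coeff (c · p ⊕ c · q) i                       ∎
  where open ≡.≡-Reasoning

·-assoc : ∀ c d p → c · (d · p) ≋ (c ℚ.* d) · p
·-assoc c d p = pointwise λ i → trans (coeff-· c (d · p) i)
  (trans (cong (c ℚ.*_) (coeff-· d p i)) (trans (sym (ℚₚ.*-assoc c d _)) (sym (coeff-· (c ℚ.* d) p i))))

0· : ∀ p → 0ℚ · p ≋ []
0· p = pointwise λ i → trans (coeff-· 0ℚ p i) (ℚₚ.*-zeroˡ (coeff p i))

1· : ∀ p → 1ℚ · p ≋ p
1· p = pointwise λ i → trans (coeff-· 1ℚ p i) (ℚₚ.*-identityˡ (coeff p i))

·-0∷ : ∀ c p → c · (0ℚ ∷ p) ≋ 0ℚ ∷ (c · p)
·-0∷ c p = ∷-cong (ℚₚ.*-zeroʳ c) ≋-refl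

⊗-congˡ : ∀ p → q ≋ r → p ⊗ q ≋ p ⊗ r
⊗-congˡ []      e = ≋-refl
⊗-congˡ (a ∷ p) e = ⊕-cong (·-congˡ a e) (∷-cong refl (⊗-congˡ p e))

⊗-zeroʳ : ∀ p → p ⊗ [] ≋ []
⊗-zeroʳ []      = ≋-refl
⊗-zeroʳ (a ∷ p) = ≋-trans (∷-cong refl (⊗-zeroʳ p)) 0∷[]

-- The mirror image of the defining clause of `_⊗_`, from which commutativity follows by induction.
⊗-∷ : ∀ p b q → p ⊗ (b ∷ q) ≋ b · p ⊕ (0ℚ ∷ p ⊗ q)
⊗-∷ []      b q = ≋-sym 0∷[]
⊗-∷ (a ∷ p) b q = ∷-cong
  (trans (ℚₚ.+-identityʳ _) (trans (ℚₚ.*-comm a b) (sym (ℚₚ.+-identityʳ _))))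
  (≋-trans (⊕-cong (≋-refl {a · q}) (⊗-∷ p b q))
    (≋-trans (≋-sym (⊕-assoc (a · q) (b · p) _))
      (≋-trans (⊕-cong (⊕-comm (a · q) (b · p)) ≋-refl) (⊕-assoc (b · p) (a · q) _))))

⊗-comm : ∀ p q → p ⊗ q ≋ q ⊗ p
⊗-comm []      q = ≋-sym (⊗-zeroʳ q)
⊗-comm (a ∷ p) q =
  ≋-trans (⊕-cong (≋-refl {a · q}) (∷-cong refl (⊗-comm p q))) (≋-sym (⊗-∷ q a p))

-- `_⊗_` recurses on its left list, and equal polynomials may be lists of different lengths;
-- congruence on the left therefore goes through commutativity.
⊗-cong : p ≋ q → r ≋ s → p ⊗ r ≋ q ⊗ s
⊗-cong {p} {q} {r} {s} e f = ≋-trans (⊗-congˡ p f)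
  (≋-trans (⊗-comm p s) (≋-trans (⊗-congˡ s e) (⊗-comm s q)))

⊗-distribˡ : ∀ p q r → p ⊗ (q ⊕ r) ≋ p ⊗ q ⊕ p ⊗ r
⊗-distribˡ []      q r = ≋-refl
⊗-distribˡ (a ∷ p) q r =
  ≋-trans (⊕-cong (·-distribˡ a q r) (∷-cong refl (⊗-distribˡ p q r)))
    (⊕-interchange (a · q) (a · r) (0ℚ ∷ p ⊗ q) (0ℚ ∷ p ⊗ r))

⊗-distribʳ : ∀ p q r → (q ⊕ r) ⊗ p ≋ q ⊗ p ⊕ r ⊗ p
⊗-distribʳ p q r = ≋-trans (⊗-comm (q ⊕ r) p)
  (≋-trans (⊗-distribˡ p q r) (⊕-cong (⊗-comm p q) (⊗-comm p r)))

·-⊗ : ∀ c p q → (c · p) ⊗ q ≋ c · (p ⊗ q)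
·-⊗ c []      q = ≋-refl
·-⊗ c (a ∷ p) q = ≋-trans
  (⊕-cong (≋-sym (·-assoc c a q)) (≋-trans (∷-cong refl (·-⊗ c p q)) (≋-sym (·-0∷ c _))))
  (≋-sym (·-distribˡ c (a · q) (0ℚ ∷ p ⊗ q)))

0∷-⊗ : ∀ p q → (0ℚ ∷ p) ⊗ q ≋ 0ℚ ∷ (p ⊗ q)
0∷-⊗ p q = ⊕-cong (0· q) ≋-refl

⊗-assoc : ∀ p q r → (p ⊗ q) ⊗ r ≋ p ⊗ (q ⊗ r)
⊗-assoc []      q r = ≋-refl
⊗-assoc (a ∷ p) q r = ≋-trans (⊗-distribʳ r (a · q) (0ℚ ∷ p ⊗ q))
  (⊕-cong (·-⊗ a q r) (≋-trans (0∷-⊗ (p ⊗ q) r) (∷-cong refl (⊗-assoc p q r))))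

⊗-identityˡ : ∀ p → (1ℚ ∷ []) ⊗ p ≋ p
⊗-identityˡ p = ≋-trans (⊕-cong (1· p) 0∷[]) (⊕-identityʳ p)

polySemiring : CommutativeSemiring 0ℓ 0ℓ
polySemiring = record
  { Carrier = Poly
  ; _≈_ = _≋_
  ; _+_ = _⊕_
  ; _*_ = _⊗_
  ; 0# = []
  ; 1# = 1ℚ ∷ []
  ; isCommutativeSemiring = record
    { isSemiring = record
      { isSemiringWithoutAnnihilatingZero = record
        { +-isCommutativeMonoid = record
          { isMonoid = record
            { isSemigroup = record
              { isMagma = record { isEquivalence = ≋-isEquivalence ; ∙-cong = ⊕-cong }
              ; assoc = ⊕-assoc
              }
            ; identity = (λ _ → ≋-refl) , ⊕-identityʳ
            }
          ; comm = ⊕-comm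
          }
        ; *-cong = ⊗-cong
        ; *-assoc = ⊗-assoc
        ; *-identity = ⊗-identityˡ , λ p → ≋-trans (⊗-comm p _) (⊗-identityˡ p)
        ; distrib = ⊗-distribˡ , ⊗-distribʳ
        }
      ; zero = (λ _ → ≋-refl) , ⊗-zeroʳ
      }
    ; *-comm = ⊗-comm
    }
  }

-- Narayana polynomials as walk polynomials

-- The binomial coefficient with lower index `j - 1`, zero at `j = 0`, so that Pascal's rule holds
-- for every `j`.
C⁻ : ℕ → ℕ → ℕ
C⁻ n zero    = 0
C⁻ n (suc j) = n C j

pascal : ∀ n j → suc n C j ≡ n C j ℕ.+ C⁻ n j
pascal n zero    = refl
pascal n (suc j) = trans (sym (nCk+nC[k+1]≡[n+1]C[k+1] n j)) (ℕₚ.+-comm (n C j) _)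

absorption : ∀ n k → suc n ℕ.* (n C k) ≡ suc k ℕ.* (suc n C suc k)
absorption zero    zero    = refl
absorption zero    (suc k) = sym (ℕₚ.*-zeroʳ (suc (suc k)))
absorption (suc n) zero    =
  trans (ℕₚ.*-identityʳ _) (sym (trans (ℕₚ.*-identityˡ _) (nC1≡n (suc (suc n)))))
absorption (suc n) (suc k) = begin
  c ℕ.+ suc n ℕ.* c
    ≡⟨ cong (λ u → c ℕ.+ suc n ℕ.* u) (pascal n (suc k)) ⟩
  c ℕ.+ suc n ℕ.* (n C suc k ℕ.+ n C k)
    ≡⟨ cong (c ℕ.+_) (trans (ℕₚ.*-distribˡ-+ (suc n) (n C suc k) (n C k))
         (cong₂ ℕ._+_ (absorption n (suc k)) (absorption n k))) ⟩
  c ℕ.+ (suc (suc k) ℕ.* d ℕ.+ suc k ℕ.* c)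
    ≡⟨ solve 3 (λ c d k → c :+ ((con 2 :+ k) :* d :+ (con 1 :+ k) :* c)
         := (con 2 :+ k) :* (d :+ c)) refl c d k ⟩
  suc (suc k) ℕ.* (d ℕ.+ c)
    ≡⟨ cong (suc (suc k) ℕ.*_) (pascal (suc n) (suc (suc k))) ⟨
  suc (suc k) ℕ.* (suc (suc n) C suc (suc k)) ∎
  where
  open ≡.≡-Reasoning
  open +-*-Solver
  c = suc n C suc k
  d = suc n C suc (suc k)

absorption⁻ : ∀ n j → suc n ℕ.* C⁻ n j ≡ j ℕ.* (suc n C j)
absorption⁻ n zero    = ℕₚ.*-zeroʳ (suc n)
absorption⁻ n (suc j) = absorption n j

-- The coefficient of `xʲ` in `ν r n`; the clauses are the recursion of `ν` read off at `xʲ`.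
νᶜ : ℕ → ℕ → ℕ → ℕ
νᶜ zero    zero    zero    = 1
νᶜ zero    zero    (suc j) = 0
νᶜ zero    (suc n) j       = 0
νᶜ (suc r) zero    j       = 0
νᶜ (suc r) (suc n) zero    = νᶜ r n zero ℕ.+ νᶜ (suc r) n zero
νᶜ (suc r) (suc n) (suc j) =
  νᶜ r n (suc j) ℕ.+ (νᶜ (suc r) n (suc j) ℕ.+ νᶜ (suc r) n j) ℕ.+ νᶜ (suc (suc r)) n j

-- The reflection principle: these walks correspond to pairs of non-intersecting lattice paths,
-- and the identity is the 2 × 2 determinant that counts those.
νᶜ-det : ∀ r n j → νᶜ (suc r) (suc n) j ℕ.+ (n C (j ℕ.+ suc r)) ℕ.* C⁻ n j
                   ≡ (n C j) ℕ.* (n C (j ℕ.+ r))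
-- The instance needed for a last step up. At height 0 no walk is left, and the two products of the
-- determinant coincide.
νᶜ-det-pred : ∀ r n j →
  νᶜ r (suc n) (suc j) ℕ.+ (n C suc (j ℕ.+ r)) ℕ.* (n C j)
  ≡ (n C suc j) ℕ.* (n C (j ℕ.+ r))

νᶜ-det zero    zero    zero    = refl
νᶜ-det (suc r) zero    zero    = refl
νᶜ-det zero    zero    (suc j) = refl
νᶜ-det (suc r) zero    (suc j) = refl
νᶜ-det zero    (suc n) zero    = trans (cong (ℕ._+ (suc n C 1) ℕ.* 0)
  (trans (sym (ℕₚ.+-identityʳ _))
    (trans (cong (νᶜ 1 (suc n) 0 ℕ.+_) (sym (ℕₚ.*-zeroʳ (n C 1)))) (νᶜ-det zero n zero))))
  (cong (1 ℕ.+_) (ℕₚ.*-zeroʳ (suc n C 1)))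
νᶜ-det (suc r) (suc n) zero    = begin
  νᶜ (suc r) (suc n) 0 ℕ.+ νᶜ (suc (suc r)) (suc n) 0 ℕ.+ u ℕ.* 0
    ≡⟨ solve 5 (λ a b u v w → a :+ b :+ u :* con 0
         := (a :+ v :* con 0) :+ (b :+ w :* con 0)) refl
         (νᶜ (suc r) (suc n) 0) (νᶜ (suc (suc r)) (suc n) 0) u (n C suc r) (n C suc (suc r)) ⟩
  (νᶜ (suc r) (suc n) 0 ℕ.+ (n C suc r) ℕ.* 0)
    ℕ.+ (νᶜ (suc (suc r)) (suc n) 0 ℕ.+ (n C suc (suc r)) ℕ.* 0)
    ≡⟨ cong₂ ℕ._+_ (νᶜ-det r n zero) (νᶜ-det (suc r) n zero) ⟩
  1 ℕ.* (n C r) ℕ.+ 1 ℕ.* (n C suc r)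
    ≡⟨ cong₂ ℕ._+_ (ℕₚ.*-identityˡ (n C r)) (ℕₚ.*-identityˡ (n C suc r)) ⟩
  (n C r) ℕ.+ (n C suc r)
    ≡⟨ nCk+nC[k+1]≡[n+1]C[k+1] n r ⟩
  suc n C suc r
    ≡⟨ ℕₚ.*-identityˡ _ ⟨
  1 ℕ.* (suc n C suc r) ∎
  where
  open ≡.≡-Reasoning
  open +-*-Solver
  u = suc n C suc (suc r)
νᶜ-det r       (suc n) (suc j) rewrite ℕₚ.+-suc j r = begin
  w₁ ℕ.+ (w₂ ℕ.+ w₃) ℕ.+ w₄ ℕ.+ (suc n C suc (suc (j ℕ.+ r))) ℕ.* (suc n C j)
    ≡⟨ cong₂ (λ p q → w₁ ℕ.+ (w₂ ℕ.+ w₃) ℕ.+ w₄ ℕ.+ p ℕ.* q)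
         (pascal n (suc (suc (j ℕ.+ r)))) (pascal n j) ⟩
  w₁ ℕ.+ (w₂ ℕ.+ w₃) ℕ.+ w₄ ℕ.+ (v₂ ℕ.+ v₁) ℕ.* (a₀ ℕ.+ a₋)
    -- Each of the four products from Pascal's rule is matched with one of the four terms of the
    -- walk recursion, so that every bracket is an instance of the determinant identity.
    ≡⟨ solve 8 (λ w₁ w₂ w₃ w₄ v₁ v₂ a₀ a₋ →
         w₁ :+ (w₂ :+ w₃) :+ w₄ :+ (v₂ :+ v₁) :* (a₀ :+ a₋)
         := (w₁ :+ v₁ :* a₀) :+ (w₂ :+ v₂ :* a₀) :+ (w₃ :+ v₁ :* a₋) :+ (w₄ :+ v₂ :* a₋))
         refl w₁ w₂ w₃ w₄ v₁ v₂ a₀ a₋ ⟩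
  (w₁ ℕ.+ v₁ ℕ.* a₀) ℕ.+ (w₂ ℕ.+ v₂ ℕ.* a₀) ℕ.+ (w₃ ℕ.+ v₁ ℕ.* a₋) ℕ.+ (w₄ ℕ.+ v₂ ℕ.* a₋)
    ≡⟨ cong₂ ℕ._+_ (cong₂ ℕ._+_ (cong₂ ℕ._+_ (νᶜ-det-pred r n j) det₂) det₃) det₄ ⟩
  a₁ ℕ.* v₀ ℕ.+ a₁ ℕ.* v₁ ℕ.+ a₀ ℕ.* v₀ ℕ.+ a₀ ℕ.* v₁
    ≡⟨ solve 4 (λ a₀ a₁ v₀ v₁ → a₁ :* v₀ :+ a₁ :* v₁ :+ a₀ :* v₀ :+ a₀ :* v₁
         := (a₁ :+ a₀) :* (v₁ :+ v₀)) refl a₀ a₁ v₀ v₁ ⟩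
  (a₁ ℕ.+ a₀) ℕ.* (v₁ ℕ.+ v₀)
    ≡⟨ cong₂ ℕ._*_ (pascal n (suc j)) (pascal n (suc (j ℕ.+ r))) ⟨
  (suc n C suc j) ℕ.* (suc n C suc (j ℕ.+ r)) ∎
  where
  open ≡.≡-Reasoning
  open +-*-Solver
  w₁ = νᶜ r (suc n) (suc j)
  w₂ = νᶜ (suc r) (suc n) (suc j)
  w₃ = νᶜ (suc r) (suc n) j
  w₄ = νᶜ (suc (suc r)) (suc n) j
  a₋ = C⁻ n j
  a₀ = n C j
  a₁ = n C suc j
  v₀ = n C (j ℕ.+ r)
  v₁ = n C suc (j ℕ.+ r)
  v₂ = n C suc (suc (j ℕ.+ r))
  det₂ : w₂ ℕ.+ v₂ ℕ.* a₀ ≡ a₁ ℕ.* v₁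
  det₂ = ≡.subst (λ i → w₂ ℕ.+ (n C suc i) ℕ.* a₀ ≡ a₁ ℕ.* v₁) (ℕₚ.+-suc j r) (νᶜ-det r n (suc j))
  det₃ : w₃ ℕ.+ v₁ ℕ.* a₋ ≡ a₀ ℕ.* v₀
  det₃ = ≡.subst (λ i → w₃ ℕ.+ (n C i) ℕ.* a₋ ≡ a₀ ℕ.* v₀) (ℕₚ.+-suc j r) (νᶜ-det r n j)
  det₄ : w₄ ℕ.+ v₂ ℕ.* a₋ ≡ a₀ ℕ.* v₁
  det₄ = ≡.subst₂ (λ i i′ → w₄ ℕ.+ (n C i) ℕ.* a₋ ≡ a₀ ℕ.* (n C i′))
    (trans (ℕₚ.+-suc j (suc r)) (cong suc (ℕₚ.+-suc j r))) (ℕₚ.+-suc j r) (νᶜ-det (suc r) n j)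

νᶜ-det-pred zero    n j rewrite ℕₚ.+-identityʳ j = refl
νᶜ-det-pred (suc r) n j =
  trans (νᶜ-det r n (suc j)) (cong (λ i → (n C suc j) ℕ.* (n C i)) (sym (ℕₚ.+-suc j r)))

-- A ballot-type formula; `r = 1` gives the Narayana numbers. In the notation of the last case,
-- absorption makes `suc n` times the determinant the difference of `(j + suc r) * (b * d)` and
-- `j * b * d`; the latter is added to both sides and cancelled.
νᶜ-closed : ∀ r n j → n ℕ.* νᶜ r n j ≡ r ℕ.* ((n C j) ℕ.* (n C (j ℕ.+ r)))
νᶜ-closed zero    zero    j = refl
νᶜ-closed (suc r) zero    j rewrite ℕₚ.+-suc j r =
  sym (trans (cong (suc r ℕ.*_) (ℕₚ.*-zeroʳ (0 C j))) (ℕₚ.*-zeroʳ (suc r)))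
νᶜ-closed zero    (suc n) j = ℕₚ.*-zeroʳ n
νᶜ-closed (suc r) (suc n) j = ℕₚ.+-cancelʳ-≡ (j ℕ.* b ℕ.* d) _ _ (begin
  suc n ℕ.* w ℕ.+ j ℕ.* b ℕ.* d
    ≡⟨ cong (λ p → suc n ℕ.* w ℕ.+ p ℕ.* d) (absorption⁻ n j) ⟨
  suc n ℕ.* w ℕ.+ suc n ℕ.* c ℕ.* d
    ≡⟨ cong (λ p → suc n ℕ.* w ℕ.+ suc n ℕ.* c ℕ.* p) d≡v+u ⟩
  suc n ℕ.* w ℕ.+ suc n ℕ.* c ℕ.* (v ℕ.+ u)
    ≡⟨ solve 5 (λ n w c v u → n :* w :+ n :* c :* (v :+ u)
         := n :* (w :+ v :* c) :+ c :* (n :* u)) refl (suc n) w c v u ⟩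
  suc n ℕ.* (w ℕ.+ v ℕ.* c) ℕ.+ c ℕ.* (suc n ℕ.* u)
    ≡⟨ cong (λ p → suc n ℕ.* p ℕ.+ c ℕ.* (suc n ℕ.* u)) (νᶜ-det r n j) ⟩
  suc n ℕ.* (a ℕ.* u) ℕ.+ c ℕ.* (suc n ℕ.* u)
    ≡⟨ solve 4 (λ n a c u → n :* (a :* u) :+ c :* (n :* u) := (a :+ c) :* (n :* u))
         refl (suc n) a c u ⟩
  (a ℕ.+ c) ℕ.* (suc n ℕ.* u)
    ≡⟨ cong₂ ℕ._*_ (sym (pascal n j)) (trans (absorption n (j ℕ.+ r))
         (cong (λ i → i ℕ.* (suc n C i)) (sym (ℕₚ.+-suc j r)))) ⟩
  b ℕ.* ((j ℕ.+ suc r) ℕ.* d)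
    ≡⟨ solve 4 (λ b j s d → b :* ((j :+ s) :* d) := s :* (b :* d) :+ j :* b :* d)
         refl b j (suc r) d ⟩
  suc r ℕ.* (b ℕ.* d) ℕ.+ j ℕ.* b ℕ.* d ∎)
  where
  open ≡.≡-Reasoning
  open +-*-Solver
  w = νᶜ (suc r) (suc n) j
  a = n C j
  c = C⁻ n j
  u = n C (j ℕ.+ r)
  v = n C (j ℕ.+ suc r)
  b = suc n C j
  d = suc n C (j ℕ.+ suc r)
  d≡v+u : d ≡ v ℕ.+ u
  d≡v+u = trans (pascal n (j ℕ.+ suc r)) (cong (λ i → v ℕ.+ C⁻ n i) (ℕₚ.+-suc j r))

-- From natural numbers to rational coefficients

ℕ→ℚ-+ : ∀ m n → ℕ→ℚ (m ℕ.+ n) ≡ ℕ→ℚ m ℚ.+ ℕ→ℚ n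
ℕ→ℚ-+ m n = ℚₚ.toℚᵘ-injective (begin
  ℚ.toℚᵘ (ℕ→ℚ (m ℕ.+ n))                    ≈⟨ ℚₚ.toℚᵘ-fromℚᵘ (mkℚᵘ (+ (m ℕ.+ n)) 0) ⟩
  mkℚᵘ (+ (m ℕ.+ n)) 0                      ≈⟨ ℚᵘ.*≡* (cong (ℤ._* + 1) (cong₂ ℤ._+_
                                                 (sym (ℤₚ.*-identityʳ (+ m))) (sym (ℤₚ.*-identityʳ (+ n))))) ⟩
  mkℚᵘ (+ m) 0 ℚᵘ.+ mkℚᵘ (+ n) 0            ≈⟨ ℚᵘₚ.+-cong (ℚₚ.toℚᵘ-fromℚᵘ (mkℚᵘ (+ m) 0))
                                                 (ℚₚ.toℚᵘ-fromℚᵘ (mkℚᵘ (+ n) 0)) ⟨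
  ℚ.toℚᵘ (ℕ→ℚ m) ℚᵘ.+ ℚ.toℚᵘ (ℕ→ℚ n)        ≈⟨ ℚₚ.toℚᵘ-homo-+ (ℕ→ℚ m) (ℕ→ℚ n) ⟨
  ℚ.toℚᵘ (ℕ→ℚ m ℚ.+ ℕ→ℚ n)                  ∎)
  where open ℚᵘₚ.≃-Reasoning

ℕ→ℚ-* : ∀ m n → ℕ→ℚ (m ℕ.* n) ≡ ℕ→ℚ m ℚ.* ℕ→ℚ n
ℕ→ℚ-* m n = ℚₚ.toℚᵘ-injective (begin
  ℚ.toℚᵘ (ℕ→ℚ (m ℕ.* n))                    ≈⟨ ℚₚ.toℚᵘ-fromℚᵘ (mkℚᵘ (+ (m ℕ.* n)) 0) ⟩
  mkℚᵘ (+ (m ℕ.* n)) 0                      ≈⟨ ℚᵘ.*≡* (cong (ℤ._* + 1) (ℤₚ.pos-* m n)) ⟩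
  mkℚᵘ (+ m) 0 ℚᵘ.* mkℚᵘ (+ n) 0            ≈⟨ ℚᵘₚ.*-cong (ℚₚ.toℚᵘ-fromℚᵘ (mkℚᵘ (+ m) 0))
                                                 (ℚₚ.toℚᵘ-fromℚᵘ (mkℚᵘ (+ n) 0)) ⟨
  ℚ.toℚᵘ (ℕ→ℚ m) ℚᵘ.* ℚ.toℚᵘ (ℕ→ℚ n)        ≈⟨ ℚₚ.toℚᵘ-homo-* (ℕ→ℚ m) (ℕ→ℚ n) ⟨
  ℚ.toℚᵘ (ℕ→ℚ m ℚ.* ℕ→ℚ n)                  ∎)
  where open ℚᵘₚ.≃-Reasoning

1/n*n : ∀ n .{{_ : ℕ.NonZero n}} → (+ 1 ℚ./ n) ℚ.* ℕ→ℚ n ≡ 1ℚ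
1/n*n n@(suc m) = ℚₚ.toℚᵘ-injective (begin
  ℚ.toℚᵘ ((+ 1 ℚ./ n) ℚ.* ℕ→ℚ n)            ≈⟨ ℚₚ.toℚᵘ-homo-* (+ 1 ℚ./ n) (ℕ→ℚ n) ⟩
  ℚ.toℚᵘ (+ 1 ℚ./ n) ℚᵘ.* ℚ.toℚᵘ (ℕ→ℚ n)    ≈⟨ ℚᵘₚ.*-cong (ℚₚ.toℚᵘ-fromℚᵘ (mkℚᵘ (+ 1) m))
                                                 (ℚₚ.toℚᵘ-fromℚᵘ (mkℚᵘ (+ n) 0)) ⟩
  mkℚᵘ (+ 1) m ℚᵘ.* mkℚᵘ (+ n) 0            ≈⟨ ℚᵘ.*≡* (trans (ℤₚ.*-identityʳ (+ 1 ℤ.* + n))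
                                                 (cong (λ k → + 1 ℤ.* + suc k) (sym (ℕₚ.*-identityʳ m)))) ⟩
  ℚ.toℚᵘ 1ℚ                                 ∎)
  where open ℚᵘₚ.≃-Reasoning

open Sums polySemiring using (⌜_⌝)

⌜⌝≋ : ∀ n → ⌜ n ⌝ ≋ ℕ→ℚ n ∷ []
⌜⌝≋ zero    = ≋-sym 0∷[]
⌜⌝≋ (suc n) = ≋-trans (⊕-cong (≋-refl {1ℚ ∷ []}) (⌜⌝≋ n)) (∷-cong (sym (ℕ→ℚ-+ 1 n)) ≋-refl)

⌜⌝-⊗ : ∀ n p → ⌜ n ⌝ ⊗ p ≋ ℕ→ℚ n · p
⌜⌝-⊗ n p = ≋-trans (⊗-cong (⌜⌝≋ n) (≋-refl {p}))
  (≋-trans (⊕-cong (≋-refl {ℕ→ℚ n · p}) 0∷[]) (⊕-identityʳ (ℕ→ℚ n · p)))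

X : Poly
X = 0ℚ ∷ 1ℚ ∷ []

X-⊗ : ∀ p → X ⊗ p ≋ 0ℚ ∷ p
X-⊗ p = ≋-trans (0∷-⊗ (1ℚ ∷ []) p) (∷-cong refl (⊗-identityˡ p))

open import Algebra.Properties.Semiring.Exp (CommutativeSemiring.semiring polySemiring)
  using () renaming (_^_ to _^ₚ_)

X^≋ : ∀ k → X^ k ≋ X ^ₚ k
X^≋ zero    = ≋-refl
X^≋ (suc k) = ≋-trans (∷-cong refl (X^≋ k)) (≋-sym (X-⊗ (X ^ₚ k)))

-- Reduces identities between polynomials with natural coefficients to identities in ℕ.
record HasCoeffs (p : Poly) (f : ℕ → ℕ) : Set where
  constructor coeffs
  field coeffAt : ∀ i → coeff p i ≡ ℕ→ℚ (f i)
open HasCoeffs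

HasCoeffs-resp : ∀ {p q f g} → p ≋ q → (∀ i → f i ≡ g i) → HasCoeffs p f → HasCoeffs q g
HasCoeffs-resp e f≡g P = coeffs λ i →
  trans (sym (at e i)) (trans (coeffAt P i) (cong ℕ→ℚ (f≡g i)))

HasCoeffs-⊕ : ∀ {p q f g} → HasCoeffs p f → HasCoeffs q g → HasCoeffs (p ⊕ q) (λ i → f i ℕ.+ g i)
HasCoeffs-⊕ {p} {q} {f} {g} P Q = coeffs λ i → trans (coeff-⊕ p q i)
  (trans (cong₂ ℚ._+_ (coeffAt P i) (coeffAt Q i)) (sym (ℕ→ℚ-+ (f i) (g i))))

shift : (ℕ → ℕ) → ℕ → ℕ
shift f zero    = 0
shift f (suc i) = f i

HasCoeffs-X : ∀ {p f} → HasCoeffs p f → HasCoeffs (X ⊗ p) (shift f)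
HasCoeffs-X {p} P = HasCoeffs-resp (≋-sym (X-⊗ p)) (λ _ → refl)
  (coeffs λ { zero → refl ; (suc i) → coeffAt P i })

HasCoeffs-1+X : ∀ {p f} → HasCoeffs p f →
                HasCoeffs (((1ℚ ∷ []) ⊕ X) ⊗ p) (λ i → f i ℕ.+ shift f i)
HasCoeffs-1+X {p} P = HasCoeffs-resp
  (≋-sym (≋-trans (⊗-distribʳ p (1ℚ ∷ []) X) (⊕-cong (⊗-identityˡ p) (≋-refl {X ⊗ p}))))
  (λ _ → refl) (HasCoeffs-⊕ P (HasCoeffs-X P))

HasCoeffs-step : ∀ {p q r f g h} → HasCoeffs p f → HasCoeffs q g → HasCoeffs r h →
  HasCoeffs (p ⊕ ((1ℚ ∷ []) ⊕ X) ⊗ q ⊕ X ⊗ r)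
            (λ i → f i ℕ.+ (g i ℕ.+ shift g i) ℕ.+ shift h i)
HasCoeffs-step P Q R = HasCoeffs-⊕ (HasCoeffs-⊕ P (HasCoeffs-1+X Q)) (HasCoeffs-X R)

HasCoeffs-≋ : ∀ {p q f g} → HasCoeffs p f → HasCoeffs q g → (∀ i → f i ≡ g i) → p ≋ q
HasCoeffs-≋ P Q e = pointwise λ i → trans (coeffAt P i) (trans (cong ℕ→ℚ (e i)) (sym (coeffAt Q i)))

coeff-applyUpTo : ∀ (f : ℕ → ℚ) n → (∀ i → n ≤ i → f i ≡ 0ℚ) →
                  ∀ i → coeff (applyUpTo f n) i ≡ f i
coeff-applyUpTo f zero    v i       = sym (v i z≤n)
coeff-applyUpTo f (suc n) v zero    = refl
coeff-applyUpTo f (suc n) v (suc i) =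
  coeff-applyUpTo (f ∘ suc) n (λ j n≤j → v (suc j) (s≤s n≤j)) i

open Walks polySemiring X

ν-coeffs : ∀ r n → HasCoeffs (ν r n) (νᶜ r n)
ν-coeffs zero    zero    = coeffs λ { zero → refl ; (suc j) → refl }
ν-coeffs zero    (suc n) = coeffs λ _ → refl
ν-coeffs (suc r) zero    = coeffs λ _ → refl
ν-coeffs (suc r) (suc n) = HasCoeffs-resp ≋-refl νᶜ-suc
  (HasCoeffs-step (ν-coeffs r n) (ν-coeffs (suc r) n) (ν-coeffs (suc (suc r)) n))
  where
  νᶜ-suc : ∀ j → νᶜ r n j ℕ.+ (νᶜ (suc r) n j ℕ.+ shift (νᶜ (suc r) n) j)
                 ℕ.+ shift (νᶜ (suc (suc r)) n) j ≡ νᶜ (suc r) (suc n) j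
  νᶜ-suc zero    = trans (ℕₚ.+-identityʳ _) (cong (νᶜ r n 0 ℕ.+_) (ℕₚ.+-identityʳ _))
  νᶜ-suc (suc j) = refl

-- The step weights factor as `y + (1 + x) + x/y = (1 + y)(1 + x/y)`, with `y` marking height. The
-- coefficient of `yʳ xʲ` in the `n`-th power is therefore a product of two binomial coefficients;
-- at `r = 0` it is the square in the definition of `B`.
κᶜ : ℕ → ℕ → ℕ → ℕ
κᶜ r n j = (n C j) ℕ.* (n C (j ℕ.+ r))

κ : ℕ → ℕ → Poly
κ r n = applyUpTo (λ j → ℕ→ℚ (κᶜ r n j)) (suc n)

κ-coeffs : ∀ r n → HasCoeffs (κ r n) (κᶜ r n)
κ-coeffs r n = coeffs (coeff-applyUpTo _ (suc n) λ j n<j →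
  cong (λ c → ℕ→ℚ (c ℕ.* (n C (j ℕ.+ r)))) (k>n⇒nCk≡0 n<j))

κ-0 : ∀ r → κ (suc r) 0 ≋ []
κ-0 r = 0∷[]

κ-suc : ∀ r n → κ (suc r) (suc n)
                ≋ κ r n ⊕ ((1ℚ ∷ []) ⊕ X) ⊗ κ (suc r) n ⊕ X ⊗ κ (suc (suc r)) n
κ-suc r n = HasCoeffs-≋ (κ-coeffs (suc r) (suc n))
  (HasCoeffs-step (κ-coeffs r n) (κ-coeffs (suc r) n) (κ-coeffs (suc (suc r)) n)) κᶜ-suc
  where
  open +-*-Solver
  κᶜ-suc : ∀ j → κᶜ (suc r) (suc n) j
    ≡ κᶜ r n j ℕ.+ (κᶜ (suc r) n j ℕ.+ shift (κᶜ (suc r) n) j) ℕ.+ shift (κᶜ (suc (suc r)) n) j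
  κᶜ-suc zero    = trans (cong (1 ℕ.*_) (pascal n (suc r)))
    (solve 2 (λ u v → con 1 :* (u :+ v)
      := con 1 :* v :+ (con 1 :* u :+ con 0) :+ con 0) refl (n C suc r) (n C r))
  κᶜ-suc (suc j) rewrite ℕₚ.+-suc j r | ℕₚ.+-suc j (suc r) | ℕₚ.+-suc j r =
    trans (cong₂ ℕ._*_ (pascal n (suc j)) (pascal n (suc (suc (j ℕ.+ r)))))
      (solve 4 (λ a b u v → (a :+ b) :* (u :+ v)
        := a :* v :+ (a :* u :+ b :* v) :+ b :* u) refl
        (n C suc j) (n C j) (n C suc (suc (j ℕ.+ r))) (n C suc (j ℕ.+ r)))

κ-B : ∀ k → B (suc k) ≋ κ 0 k
κ-B k = HasCoeffs-≋ B-coeffs (κ-coeffs 0 k)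
  (λ j → cong ((k C j) ℕ.*_) (trans (ℕₚ.*-identityʳ _) (cong (k C_) (sym (ℕₚ.+-identityʳ j)))))
  where
  B-coeffs : HasCoeffs (B (suc k)) (λ j → (k C j) ^ 2)
  B-coeffs = coeffs (coeff-applyUpTo _ (suc k) λ j k<j → cong (λ c → ℕ→ℚ (c ^ 2)) (k>n⇒nCk≡0 k<j))

-- The cycle lemma: for `r > 0`, exactly `r` of the `n` rotations of a walk that ends at height `r`
-- stay positive. It is obtained here from the closed form of the coefficients.
κ-ν : ∀ r n → ⌜ n ⌝ ⊗ ν r n ≋ ⌜ r ⌝ ⊗ κ r n
κ-ν r n = HasCoeffs-≋ (scale n (ν r n) (ν-coeffs r n)) (scale r (κ r n) (κ-coeffs r n))
  (νᶜ-closed r n)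
  where
  scale : ∀ m p {f} → HasCoeffs p f → HasCoeffs (⌜ m ⌝ ⊗ p) (λ i → m ℕ.* f i)
  scale m p {f} P = coeffs λ i → trans (at (⌜⌝-⊗ m p) i) (trans (coeff-· (ℕ→ℚ m) p i)
    (trans (cong (ℕ→ℚ m ℚ.*_) (coeffAt P i)) (sym (ℕ→ℚ-* m (f i)))))

N-ν : ∀ n → N (suc n) ≋ ν 1 (suc n)
N-ν n = pointwise λ j → trans (coeff-applyUpTo _ (suc n) vanish j) (begin
  c ℚ.* ℕ→ℚ (suc n C j) ℚ.* ℕ→ℚ (suc n C suc j)
    ≡⟨ ℚₚ.*-assoc c _ _ ⟩
  c ℚ.* (ℕ→ℚ (suc n C j) ℚ.* ℕ→ℚ (suc n C suc j))
    ≡⟨ cong (c ℚ.*_) (ℕ→ℚ-* (suc n C j) (suc n C suc j)) ⟨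
  c ℚ.* ℕ→ℚ ((suc n C j) ℕ.* (suc n C suc j))
    ≡⟨ cong (λ m → c ℚ.* ℕ→ℚ m) (trans (νᶜ-closed 1 (suc n) j)
         (trans (ℕₚ.*-identityˡ (κᶜ 1 (suc n) j))
           (cong (λ i → (suc n C j) ℕ.* (suc n C i)) (ℕₚ.+-comm j 1)))) ⟨
  c ℚ.* ℕ→ℚ (suc n ℕ.* νᶜ 1 (suc n) j)
    ≡⟨ cong (c ℚ.*_) (ℕ→ℚ-* (suc n) (νᶜ 1 (suc n) j)) ⟩
  c ℚ.* (ℕ→ℚ (suc n) ℚ.* ℕ→ℚ (νᶜ 1 (suc n) j))
    ≡⟨ ℚₚ.*-assoc c _ _ ⟨
  c ℚ.* ℕ→ℚ (suc n) ℚ.* ℕ→ℚ (νᶜ 1 (suc n) j)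
    ≡⟨ cong (ℚ._* ℕ→ℚ (νᶜ 1 (suc n) j)) (1/n*n (suc n)) ⟩
  1ℚ ℚ.* ℕ→ℚ (νᶜ 1 (suc n) j)
    ≡⟨ ℚₚ.*-identityˡ (ℕ→ℚ (νᶜ 1 (suc n) j)) ⟩
  ℕ→ℚ (νᶜ 1 (suc n) j)
    ≡⟨ coeffAt (ν-coeffs 1 (suc n)) j ⟨
  coeff (ν 1 (suc n)) j ∎)
  where
  open ≡.≡-Reasoning
  c = + 1 ℚ./ suc n
  vanish : ∀ j → suc n ≤ j → c ℚ.* ℕ→ℚ (suc n C j) ℚ.* ℕ→ℚ (suc n C suc j) ≡ 0ℚ
  vanish j n<j = trans (cong (λ m → c ℚ.* ℕ→ℚ (suc n C j) ℚ.* ℕ→ℚ m) (k>n⇒nCk≡0 (s≤s n<j)))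
    (ℚₚ.*-zeroʳ (c ℚ.* ℕ→ℚ (suc n C j)))

-- The double sum over both symmetric groups

open import Data.Nat.Base using (_+_; _∸_; _≥_)

open CommutativeSemiring polySemiring using (setoid; *-congˡ; *-cong)
open import Relation.Binary.Reasoning.Setoid setoid
open Sums polySemiring hiding (⌜_⌝)
open BlockWords polySemiring X
open CycleSum polySemiring X B
open CycleTypeSum polySemiring
open FirstLetter polySemiring X using (ΣL-E)
open import Algebra.Solver.Ring.NaturalCoefficients.Default polySemiring
  using (solve; _:=_; _:*_)

ℓ≤n : ∀ {n} (π : Permutation′ n) → ℓ π ≤ n
ℓ≤n {n} π = ℕₚ.≤-trans (ℕₚ.≤-reflexive (length-map _ (cycleReps π)))
  (ℕₚ.≤-trans (length-filter _ (allFin n)) (ℕₚ.≤-reflexive (length-tabulate {n = n} id)))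

E-bothRuns : ∀ M m n → m < M → E m n ≋ bothRuns M m n
E-bothRuns M m n m<M =
  ≋-trans (ΣL-cong (filter (admissible? m n) (𝔖 (m + n))) (λ w → X^≋ (des w)))
    (ΣL-E M m n m<M)

∑-cycleWeights : ∀ n r → ΣL (𝔖 n) (λ π → Bₚ π ⊗ A r (ℓ π)) ≋ ⌜ n ! ⌝ ⊗ ν r n
∑-cycleWeights n r = ≋-trans (ΣL-cycleType n (weight r) (weight-symmetric r))
  (grow^-weight κ κ-0 κ-suc κ-B κ-ν n r)

∑∑-E : ∀ n k →
  (∑[ π ∈ 𝔖 (suc n) ] ∑[ σ ∈ 𝔖 (suc k) ] Bₚ π ⊗ Bₚ σ ⊗ E (ℓ π) (ℓ σ))
  ≋ ⌜ suc n ! ℕ.* suc k ! ⌝ ⊗ N (suc (n + k))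
∑∑-E n k = begin
  (∑[ π ∈ 𝔖 n₁ ] ∑[ σ ∈ 𝔖 k₁ ] Bₚ π ⊗ Bₚ σ ⊗ E (ℓ π) (ℓ σ))
    ≈⟨ ΣL-cong (𝔖 n₁) (λ π → ΣL-cong (𝔖 k₁) (λ σ →
         *-congˡ {Bₚ π ⊗ Bₚ σ} (E-bothRuns M (ℓ π) (ℓ σ)
           (s≤s (ℕₚ.≤-trans (ℓ≤n π) (ℕₚ.m≤m+n n₁ k₁)))))) ⟩
  ΣL (𝔖 n₁) (λ π → ΣL (𝔖 k₁) (λ σ → Bₚ π ⊗ Bₚ σ ⊗ bothRuns M (ℓ π) (ℓ σ)))
    ≈⟨ ΣL-ΣL-Σ< (𝔖 n₁) (𝔖 k₁) M Bₚ Bₚ (X ^ₚ_) (λ r π → A (suc r) (ℓ π)) (λ r σ → A (suc r) (ℓ σ)) ⟩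
  Σ< M (λ r → X ^ₚ r ⊗ (ΣL (𝔖 n₁) (λ π → Bₚ π ⊗ A (suc r) (ℓ π))
                        ⊗ ΣL (𝔖 k₁) (λ σ → Bₚ σ ⊗ A (suc r) (ℓ σ))))
    ≈⟨ Σ<-cong M (λ r → ≋-trans
         (*-congˡ {X ^ₚ r} (*-cong (∑-cycleWeights n₁ (suc r)) (∑-cycleWeights k₁ (suc r))))
         (solve 5 (λ w p u q v → w :* ((p :* u) :* (q :* v)) := p :* q :* (w :* (u :* v)))
           ≋-refl (X ^ₚ r) ⌜ n₁ ! ⌝ (ν (suc r) n₁) ⌜ k₁ ! ⌝ (ν (suc r) k₁))) ⟩
  Σ< M (λ r → ⌜ n₁ ! ⌝ ⊗ ⌜ k₁ ! ⌝ ⊗ (X ^ₚ r ⊗ (ν (suc r) n₁ ⊗ ν (suc r) k₁)))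
    ≈⟨ Σ<-*ˡ M (⌜ n₁ ! ⌝ ⊗ ⌜ k₁ ! ⌝) (λ r → X ^ₚ r ⊗ (ν (suc r) n₁ ⊗ ν (suc r) k₁)) ⟩
  ⌜ n₁ ! ⌝ ⊗ ⌜ k₁ ! ⌝ ⊗ pairing M n₁ k₁
    ≈⟨ *-cong (≋-sym (⌜⌝-* (n₁ !) (k₁ !))) (≋-trans (pairing-ν M n k n+k<M) (≋-sym (N-ν (n + k)))) ⟩
  ⌜ n₁ ! ℕ.* k₁ ! ⌝ ⊗ N (suc (n + k)) ∎
  where
  n₁ = suc n
  k₁ = suc k
  -- Large enough for two purposes: it exceeds the number of cycles of every `π`, which bounds the
  -- runs of small letters, and it exceeds `n + k`, as needed for moving the steps.
  M  = suc (n₁ + k₁)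
  n+k<M : n + k < M
  n+k<M = s≤s (ℕₚ.+-mono-≤ (ℕₚ.n≤1+n n) (ℕₚ.n≤1+n k))

corollary5p8 : ∀ (n k : ℕ) → n ≥ 1 → k ≥ 1 →
    N (n + k ∸ 1) ≈
    1/[ n !* k !] · (∑[ π ∈ 𝔖 n ] ∑[ σ ∈ 𝔖 k ] Bₚ π ⊗ Bₚ σ ⊗ E (ℓ π) (ℓ σ))
corollary5p8 (suc n) (suc k) _ _ = _≋_.at (begin
  N (n + suc k)
    ≡⟨ cong N (ℕₚ.+-suc n k) ⟩
  N (suc (n + k))
    ≈⟨ 1· (N (suc (n + k))) ⟨
  1ℚ · N (suc (n + k))
    ≡⟨ cong (_· N (suc (n + k))) (1/n*n d {{d≢0}}) ⟨
  (1/[ suc n !* suc k !] ℚ.* ℕ→ℚ d) · N (suc (n + k))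
    ≈⟨ ·-assoc 1/[ suc n !* suc k !] (ℕ→ℚ d) (N (suc (n + k))) ⟨
  1/[ suc n !* suc k !] · (ℕ→ℚ d · N (suc (n + k)))
    ≈⟨ ·-congˡ 1/[ suc n !* suc k !] (≋-trans (∑∑-E n k) (⌜⌝-⊗ d (N (suc (n + k))))) ⟨
  1/[ suc n !* suc k !]
    · (∑[ π ∈ 𝔖 (suc n) ] ∑[ σ ∈ 𝔖 (suc k) ] Bₚ π ⊗ Bₚ σ ⊗ E (ℓ π) (ℓ σ)) ∎)
  where
  d = suc n ! ℕ.* suc k !
  d≢0 = suc n ℕₚ.!* suc k !≢0
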